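{- Let $m=2\ell$ with $\ell\ge 1$, and let $\mathfrak{I}^{(m)}$ be the set of all involutions having no descending subsequence of length $m+1$. Write $\bar x_j=1/x_j$. Then the ordinary generating function of these involutions is $$\sum_{\tau\in\mathfrak{I}^{(m)}}t^{|\tau|}=\left[x_1^0x_2^1\cdots x_\ell^{\ell-1}\right]\ \frac{\det\left(x_j^{i-1}+\bar x_j^i\right)_{1\le i,j\le\ell}}{1-t(x_1+\cdots+x_\ell+\bar x_1+\cdots+\bar x_\ell)}.$$ Equivalently, their exponential generating function is $$\sum_{\tau\in\mathfrak{I}^{(m)}}\frac{t^{|\tau|}}{|\tau|!}=\left[x_1^0x_2^1\cdots x_\ell^{\ell-1}\right]\ \det\left((x_j^{i-1}+\bar x_j^i)\,e^{t(x_j+\bar x_j)}\right)_{1\le i,j\le\ell}.$$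
   Context: An involution of length $n$ is a permutation $\tau$ of $\{1,\dots,n\}$ with $\tau\circ\tau=\mathrm{id}$; $|\tau|=n$, and the empty permutation (length $0$) is included. A descending subsequence of length $k$ is a $k$-tuple $(\tau(i_1),\dots,\tau(i_k))$ with $i_1<\cdots<i_k$ and $\tau(i_1)>\cdots>\tau(i_k)$. The expressions on the right are regarded as formal power series in $t$ with coefficients in the Laurent polynomial ring $\mathbb{Q}[x_1,\bar x_1,\dots,x_\ell,\bar x_\ell]$, and $[x_1^0x_2^1\cdots x_\ell^{\ell-1}]$ denotes extraction (coefficientwise in $t$) of the coefficient of the monomial $x_1^0x_2^1\cdots x_\ell^{\ell-1}$. -}

module Defs where

open import Algebra.Bundles using (RawRing)
open import Algebra.Definitions using (Involutive)
import Algebra.Definitions.RawMonoid as RawMonoidDefs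
import Algebra.Definitions.RawSemiring as RawSemiringDefs
open import Data.Bool.Base using (if_then_else_)
open import Data.Fin.Base as Fin using (Fin; zero; suc; toℕ)
import Data.Fin.Properties as Fin
open import Data.Integer.Base as ℤ using (ℤ)
import Data.Integer.Properties as ℤ
open import Data.List.Base as List
  using (List; []; _∷_; _++_; allFin; cartesianProductWith; filter; length)
open import Data.Nat.Base as ℕ using (ℕ; zero; suc; _∸_; _!)
open import Data.Nat.Properties using (_!≢0)
open import Data.Product.Base using (∃-syntax; _×_; _,_; map₁)
open import Data.Rational.Base as ℚ using (ℚ; 0ℚ; 1ℚ)
open import Data.Vec.Base as Vec using (Vec; []; _∷_; lookup; tabulate; zipWith)
import Data.Vec.Functional as Vector
open import Data.Vec.Properties using (≡-dec)
open import Data.Vec.Relation.Unary.Linked using (Linked; linked?)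
open import Level using (Level; 0ℓ)
open import Relation.Binary.PropositionalEquality.Core using (_≡_)
open import Relation.Nullary using (Dec)
open import Relation.Nullary.Decidable using (does; map′; _×-dec_; ¬?)
open import Relation.Unary using (Decidable)

private
  variable
    c r p : Level

-- A self-map τ of Fin n in one-line notation τ(1) … τ(n).  If it satisfies
-- τ ∘ τ = id it is its own inverse, hence a permutation.
IsInvolution : ∀ {n} → Vec (Fin n) n → Set
IsInvolution τ = Involutive _≡_ (lookup τ)

isInvolution? : ∀ {n} → Decidable (IsInvolution {n})
isInvolution? τ = Fin.all? λ i → lookup τ (lookup τ i) Fin.≟ i

-- ι = (i₁ , … , iₖ) with i₁ < ⋯ < iₖ and τ(i₁) > ⋯ > τ(iₖ).
IsDescending : ∀ {n k} → Vec (Fin n) n → Vec (Fin n) k → Set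
IsDescending τ ι = Linked Fin._<_ ι × Linked Fin._>_ (Vec.map (lookup τ) ι)

isDescending? : ∀ {n k} (τ : Vec (Fin n) n) → Decidable (IsDescending {k = k} τ)
isDescending? τ ι =
  linked? Fin._<?_ ι ×-dec linked? (λ i j → j Fin.<? i) (Vec.map (lookup τ) ι)

HasDescending : ∀ {n} → ℕ → Vec (Fin n) n → Set
HasDescending {n} k τ = ∃[ ι ] IsDescending {n} {k} τ ι

anyVec? : ∀ {n k} {P : Vec (Fin n) k → Set p} → Decidable P → Dec (∃[ v ] P v)
anyVec? {k = zero}  P? = map′ (λ p → [] , p) (λ { ([] , p) → p }) (P? [])
anyVec? {k = suc k} P? =
  map′ (λ { (i , v , p) → i ∷ v , p }) (λ { (i ∷ v , p) → i , v , p })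
       (Fin.any? λ i → anyVec? λ v → P? (i ∷ v))

hasDescending? : ∀ {n} k → Decidable (HasDescending {n} k)
hasDescending? k τ = anyVec? (isDescending? {k = k} τ)

allVecs : ∀ n k → List (Vec (Fin n) k)
allVecs n zero    = [] ∷ []
allVecs n (suc k) = cartesianProductWith _∷_ (allFin n) (allVecs n k)

-- The involutions of length n having no descending subsequence of length
-- m + 1, each listed once.
involutions : (m n : ℕ) → List (Vec (Fin n) n)
involutions m n =
  filter (λ τ → isInvolution? τ ×-dec ¬? (hasDescending? (suc m) τ)) (allVecs n n)

module Determinant (R : RawRing c r) where
  open RawRing R
  open RawMonoidDefs +-rawMonoid using (sum)
  open RawSemiringDefs rawSemiring using (_^_)

  -- Laplace expansion along the first row.
  det : ∀ {n} → (Fin n → Fin n → Carrier) → Carrier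
  det {zero}  M = 1#
  det {suc n} M = sum λ j →
    (- 1#) ^ toℕ j * (M zero j * det (λ i → Vector.removeAt (M (suc i)) j))

module PowerSeries (R : RawRing c r) where
  open RawRing R
  open RawMonoidDefs +-rawMonoid using (sum)

  Series : Set c
  Series = ℕ → Carrier

  constant : Carrier → Series
  constant a zero    = a
  constant a (suc n) = 0#

  t : Series
  t zero          = 0#
  t (suc zero)    = 1#
  t (suc (suc n)) = 0#

  rawRing⟦t⟧ : RawRing c r
  rawRing⟦t⟧ = record
    { Carrier = Series
    ; _≈_     = λ f g → ∀ n → f n ≈ g n
    ; _+_     = λ f g n → f n + g n
    ; _*_     = λ f g n → sum {suc n} λ k → f (toℕ k) * g (n ∸ toℕ k)
    ; -_      = λ f n → - f n
    ; 0#      = constant 0#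
    ; 1#      = constant 1#
    }

  -- The quotient f / g, for g with constant coefficient 1, by long division:
  -- if f = f₀ + t f′ and g = 1 + t g′ then f / g = f₀ + t ((f′ − f₀ g′) / g).
  infixl 7 _/_
  _/_ : Series → Series → Series
  (f / g) zero    = f 0
  (f / g) (suc n) = ((λ k → f (suc k) + - (f 0 * g (suc k))) / g) n

-- An element of ℚ[x₁, x̄₁, …, x_ℓ, x̄_ℓ] is given by a finite sum of terms q · x^e,
-- e ∈ ℤ^ℓ; exponents may repeat, and two such sums are identified when all
-- their coefficients agree.
Laurent : ℕ → Set
Laurent ℓ = List (ℚ × Vec ℤ ℓ)

coefficient : ∀ {ℓ} → Vec ℤ ℓ → Laurent ℓ → ℚ
coefficient e []            = 0ℚ
coefficient e ((q , a) ∷ f) =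
  (if does (≡-dec ℤ._≟_ a e) then q else 0ℚ) ℚ.+ coefficient e f

monomial : ∀ {ℓ} → ℚ → Vec ℤ ℓ → Laurent ℓ
monomial q e = (q , e) ∷ []

scalar : ∀ {ℓ} → ℚ → Laurent ℓ
scalar q = monomial q (Vec.replicate _ ℤ.0ℤ)

mulTerm : ∀ {ℓ} → ℚ × Vec ℤ ℓ → ℚ × Vec ℤ ℓ → ℚ × Vec ℤ ℓ
mulTerm (q , a) (r , b) = q ℚ.* r , zipWith ℤ._+_ a b

laurentRawRing : ℕ → RawRing 0ℓ 0ℓ
laurentRawRing ℓ = record
  { Carrier = Laurent ℓ
  ; _≈_     = λ f g → ∀ e → coefficient e f ≡ coefficient e g
  ; _+_     = _++_
  ; _*_     = cartesianProductWith mulTerm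
  ; -_      = List.map (map₁ (ℚ.-_))
  ; 0#      = []
  ; 1#      = scalar 1ℚ
  }

variablePower : ∀ {ℓ} → Fin ℓ → ℤ → Laurent ℓ
variablePower j k = monomial 1ℚ (tabulate λ i → if does (i Fin.≟ j) then k else ℤ.0ℤ)

ℚ⟦t⟧ : RawRing 0ℓ 0ℓ
ℚ⟦t⟧ = PowerSeries.rawRing⟦t⟧ ℚ.+-*-rawRing

-- Σ t^|τ| over the involutions with no descending subsequence of length m + 1.
ogf : ℕ → RawRing.Carrier ℚ⟦t⟧
ogf m n = ℤ.+ length (involutions m n) ℚ./ 1

-- The same sum with t^|τ| / |τ|!.
egf : ℕ → RawRing.Carrier ℚ⟦t⟧
egf m n = (ℤ.+ length (involutions m n) ℚ./ n !) {{n !≢0}}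

module RightHandSides (ℓ : ℕ) where
  open RawRing (laurentRawRing ℓ)
  open RawMonoidDefs +-rawMonoid using (sum)
  open RawSemiringDefs rawSemiring using (_^_)
  open Determinant
  open PowerSeries (laurentRawRing ℓ)
  private module S = RawRing rawRing⟦t⟧

  x x̄ : Fin ℓ → Laurent ℓ
  x j = variablePower j ℤ.1ℤ
  x̄ j = variablePower j ℤ.-1ℤ

  -- With i counted from 0, the (i + 1)-st row has entries x_j^i + x̄_j^(i+1).
  entry : Fin ℓ → Fin ℓ → Laurent ℓ
  entry i j = x j ^ toℕ i + x̄ j ^ suc (toℕ i)

  -- e^(t a) = Σₙ aⁿ tⁿ / n!
  exp-t : Laurent ℓ → Series
  exp-t a n = scalar ((ℤ.1ℤ ℚ./ n !) {{n !≢0}}) * a ^ n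

  ogfKernel : Series
  ogfKernel =
    constant (det (laurentRawRing ℓ) entry)
      / (S.1# S.+ S.- (t S.* constant (sum x + sum x̄)))

  egfKernel : Series
  egfKernel =
    det rawRing⟦t⟧ λ i j → constant (entry i j) S.* exp-t (x j + x̄ j)

  -- [x₁⁰ x₂¹ ⋯ x_ℓ^(ℓ-1)], coefficientwise in t.
  extract : Series → RawRing.Carrier ℚ⟦t⟧
  extract f n = coefficient (tabulate λ j → ℤ.+ toℕ j) (f n)

{-# OPTIONS --safe #-}

-- Read an involution τ from left to right.  The arcs i < τ(i) begun in a prefix and not yet ended
-- are dealt into piles by patience sorting of their right ends, and τ has a descending subsequence
-- of length 2ℓ + 1 exactly when at some moment there are more than ℓ piles, or a fixed point is met
-- under ℓ piles.  So the involutions are counted by the walks of an automaton whose states are words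
-- over {free, buried, top}.
--
-- Let c_n(y) be the coefficient of x^y in det (x_j^(i-1) + x̄_j^i) (Σ x_j + x̄_j)^n.  It is
-- antisymmetric in y and invariant under y₁ ↦ -1 - y₁.  The number of walks of length n ending in a
-- word X is a sum of values of c_n: starting at δ = (0, 1, …, ℓ-1), every top letter of X raises one
-- new coordinate, from the last to the first, and every buried letter raises any of the coordinates
-- already in use.  Indeed c_{n+1}(y) = Σ_i c_n(y + e_i) + c_n(y - e_i), where raising corresponds to
-- ending an arc, lowering a used coordinate to beginning one, and lowering the first coordinate
-- at 0 to a fixed point by the reflection; all other terms cancel because two coordinates collide.
-- For the empty word this is c_n(δ), the coefficient to be extracted.
--
-- For the exponential generating function, multiplying column j by e^(t a_j) multiplies the
-- determinant by e^(t Σ a_j).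

module Submission where

open import Algebra.Bundles using (CommutativeRing; RawRing)
import Algebra.Definitions.RawMonoid as RawMonoidDefs
import Algebra.Definitions.RawSemiring as RawSemiringDefs
import Algebra.Properties.CommutativeMonoid.Sum
import Algebra.Properties.CommutativeSemiring.Binomial
import Algebra.Properties.Ring
import Algebra.Properties.Semiring.Exp
import Algebra.Properties.Semiring.Mult
import Algebra.Properties.Semiring.Sum
import Algebra.Solver.Ring.NaturalCoefficients.Default
open import Data.Bool.Base using (Bool; true; false; if_then_else_; _∧_; T)
import Data.Bool.Properties as Bool
open import Data.Empty using (⊥-elim)
open import Data.Fin.Base as Fin using (Fin; zero; suc; toℕ; punchIn; punchOut)
import Data.Fin.Properties as Fin
open import Data.Integer.Base as ℤ using (ℤ; 0ℤ; 1ℤ; -1ℤ)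
import Data.Integer.Properties as ℤ
import Data.Integer.Solver as ℤ
open import Data.List.Base as List using ([]; _∷_; _++_; filter; length; cartesianProductWith)
import Data.List.Properties as List
open import Data.List.Relation.Unary.All as All using (All; []; _∷_)
import Data.List.Relation.Unary.All.Properties as All
open import Data.Maybe.Base using (Maybe; just; nothing; maybe′)
open import Data.Nat.Base as ℕ using (ℕ; zero; suc; pred; _∸_; _!; _≤ᵇ_; _<ᵇ_; z≤n; s≤s; NonZero)
import Data.Nat.Combinatorics as ℕ
import Data.Nat.DivMod as ℕ
import Data.Nat.Properties as ℕ
open import Data.Product.Base using (∃-syntax; _×_; _,_; proj₁; proj₂; uncurry)
open import Data.Rational.Base as ℚ using (ℚ; 0ℚ; 1ℚ)
import Data.Rational.Properties as ℚ
open import Data.Rational.Solver using (module +-*-Solver)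
open import Data.Rational.Unnormalised.Base as ℚᵘ using (mkℚᵘ; *≡*)
import Data.Rational.Unnormalised.Properties as ℚᵘ
open import Data.Sum.Base using (_⊎_; inj₁; inj₂)
open import Data.Unit.Base using (⊤; tt)
open import Data.Vec.Base as Vec using (Vec; []; _∷_; lookup; replicate; tabulate; updateAt; zipWith)
import Data.Vec.Functional as Vector
import Data.Vec.Functional.Properties as Vector
import Data.Vec.Properties as Vec
open import Data.Vec.Relation.Unary.Linked using ([]; [-]; _∷_)
open import Function.Base using (_∘_; const; id)
open import Function.Bundles using (Equivalence)
open import Level using (0ℓ)
open import Relation.Binary.Definitions using (tri<; tri≈; tri>)
open import Relation.Binary.PropositionalEquality as ≡ using (_≡_; _≢_; _≗_)
import Relation.Binary.Reasoning.Setoid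
open import Relation.Nullary using (¬_; Dec; yes; no; does)
open import Relation.Nullary.Decidable using (dec-true; dec-false; _×-dec_; ¬?)
open import Relation.Nullary.Reflects using (ofʸ; ofⁿ)
open import Relation.Unary using (Decidable)

open import Defs

-- The number of walks reaching a given word is never computed. What is followed is the pairing of
-- `weight X c` with `completions X`, summed over all words `X` of one length: making the words one
-- letter shorter while replacing `c` by `step c` leaves it unchanged. At full length, with c_0,
-- only the all-free word contributes, because c_0 vanishes at every point that is coordinatewise at
-- least δ and differs from δ; at length 0 the pairing is c_n(δ). Shortening the words moves the sum
-- over insertions from `completions` to `weight`. This is why `newWeight` and `buryWeight` appear:
-- they add up the weights of the words from which a given word arises.
--
-- The bound 2ℓ splits as ℓ + ℓ because the points (i, τ(i)) are symmetric about the diagonal: a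
-- descending sequence of open arcs and its mirror image join into one of double length, possibly
-- with a fixed point between them. The reflection of the first coordinate comes from the exponents
-- r and -(r + 1) that each entry combines.

module Σℕ = Algebra.Properties.CommutativeMonoid.Sum ℕ.+-0-commutativeMonoid
module Σℚ = Algebra.Properties.CommutativeMonoid.Sum ℚ.+-0-commutativeMonoid

-- Natural numbers and their reciprocals as rationals

module Numbers where
  open ≡ using (refl; sym; trans; cong; cong₂)
  open import Data.Rational.Base using (_+_; _*_)

  module _ where
    open ℤ.+-*-Solver

    [i+j]-i≡j : ∀ i j → (i ℤ.+ j) ℤ.- i ≡ j
    [i+j]-i≡j = solve 2 (λ i j → (i :+ j) :- i := j) refl

    i+[j-i]≡j : ∀ i j → i ℤ.+ (j ℤ.- i) ≡ j
    i+[j-i]≡j = solve 2 (λ i j → i :+ (j :- i) := j) refl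

    i-k-p*k≡i-[1+p]*k : ∀ i k p → i ℤ.- k ℤ.- ℤ.+ p ℤ.* k ≡ i ℤ.- ℤ.+ suc p ℤ.* k
    i-k-p*k≡i-[1+p]*k i k p = solve 3 (λ i k p → i :- k :- p :* k := i :- (con ℤ.1ℤ :+ p) :* k) refl
        i k (ℤ.+ p)

  opaque
    fromℕ : ℕ → ℚ
    fromℕ n = ℤ.+ n ℚ./ 1

  infix 8 1/_
  1/_ : (d : ℕ) .{{_ : NonZero d}} → ℚ
  1/ d = ℤ.1ℤ ℚ./ d

  private
    raw : ∀ i d → ℚ.toℚᵘ (i ℚ./ suc d) ℚᵘ.≃ mkℚᵘ i d
    raw i d = ℚ.toℚᵘ-fromℚᵘ (mkℚᵘ i d)

  opaque
    unfolding fromℕ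

    fromℕ-/1 : ∀ n → fromℕ n ≡ ℤ.+ n ℚ./ 1
    fromℕ-/1 n = refl

    fromℕ-1 : fromℕ 1 ≡ 1ℚ
    fromℕ-1 = refl

    fromℕ-0 : fromℕ 0 ≡ 0ℚ
    fromℕ-0 = refl

    fromℕ-+ : ∀ m n → fromℕ (m ℕ.+ n) ≡ fromℕ m + fromℕ n
    fromℕ-+ m n = ℚ.toℚᵘ-injective (begin
      ℚ.toℚᵘ (fromℕ (m ℕ.+ n))            ≈⟨ raw (ℤ.+ (m ℕ.+ n)) 0 ⟩
      mkℚᵘ (ℤ.+ (m ℕ.+ n)) 0
          ≈⟨ *≡* (cong (ℤ._* ℤ.+ 1) (cong₂ ℤ._+_ (ℤ.*-identityʳ (ℤ.+ m)) (ℤ.*-identityʳ (ℤ.+ n)))) ⟨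
      mkℚᵘ (ℤ.+ m) 0 ℚᵘ.+ mkℚᵘ (ℤ.+ n) 0  ≈⟨ ℚᵘ.+-cong (raw (ℤ.+ m) 0) (raw (ℤ.+ n) 0) ⟨
      ℚ.toℚᵘ (fromℕ m) ℚᵘ.+ ℚ.toℚᵘ (fromℕ n) ≈⟨ ℚ.toℚᵘ-homo-+ (fromℕ m) (fromℕ n) ⟨
      ℚ.toℚᵘ (fromℕ m + fromℕ n)          ∎)
      where open ℚᵘ.≃-Reasoning

    fromℕ-* : ∀ m n → fromℕ (m ℕ.* n) ≡ fromℕ m * fromℕ n
    fromℕ-* m n = ℚ.toℚᵘ-injective (begin
      ℚ.toℚᵘ (fromℕ (m ℕ.* n))            ≈⟨ raw (ℤ.+ (m ℕ.* n)) 0 ⟩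
      mkℚᵘ (ℤ.+ (m ℕ.* n)) 0              ≈⟨ *≡* (cong (ℤ._* ℤ.+ 1) (ℤ.pos-* m n)) ⟩
      mkℚᵘ (ℤ.+ m) 0 ℚᵘ.* mkℚᵘ (ℤ.+ n) 0  ≈⟨ ℚᵘ.*-cong (raw (ℤ.+ m) 0) (raw (ℤ.+ n) 0) ⟨
      ℚ.toℚᵘ (fromℕ m) ℚᵘ.* ℚ.toℚᵘ (fromℕ n) ≈⟨ ℚ.toℚᵘ-homo-* (fromℕ m) (fromℕ n) ⟨
      ℚ.toℚᵘ (fromℕ m * fromℕ n)          ∎)
      where open ℚᵘ.≃-Reasoning

    /-fromℕ : ∀ m d .{{_ : NonZero d}} → ℤ.+ m ℚ./ d ≡ 1/ d * fromℕ m
    /-fromℕ m (suc d) = ℚ.toℚᵘ-injective (begin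
      ℚ.toℚᵘ (ℤ.+ m ℚ./ suc d)            ≈⟨ raw (ℤ.+ m) d ⟩
      mkℚᵘ (ℤ.+ m) d
          ≈⟨ *≡* (cong₂ ℤ._*_ (sym (ℤ.*-identityˡ (ℤ.+ m))) (cong (ℤ.+_ ∘ suc) (ℕ.*-identityʳ d))) ⟩
      mkℚᵘ ℤ.1ℤ d ℚᵘ.* mkℚᵘ (ℤ.+ m) 0     ≈⟨ ℚᵘ.*-cong (raw ℤ.1ℤ d) (raw (ℤ.+ m) 0) ⟨
      ℚ.toℚᵘ (1/ suc d) ℚᵘ.* ℚ.toℚᵘ (fromℕ m) ≈⟨ ℚ.toℚᵘ-homo-* (1/ suc d) (fromℕ m) ⟨
      ℚ.toℚᵘ (1/ suc d * fromℕ m)         ∎)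
      where open ℚᵘ.≃-Reasoning

    1/-inverseˡ : ∀ d .{{_ : NonZero d}} → 1/ d * fromℕ d ≡ 1ℚ
    1/-inverseˡ (suc d) = trans (sym (/-fromℕ (suc d) (suc d))) (ℚ.toℚᵘ-injective (begin
      ℚ.toℚᵘ (ℤ.+ suc d ℚ./ suc d) ≈⟨ raw (ℤ.+ suc d) d ⟩
      mkℚᵘ (ℤ.+ suc d) d           ≈⟨ *≡* (ℤ.*-comm (ℤ.+ suc d) ℤ.1ℤ) ⟩
      ℚ.toℚᵘ 1ℚ                    ∎))
      where open ℚᵘ.≃-Reasoning

  fromℕ-sum : ∀ {n} (f : Fin n → ℕ) → fromℕ (Σℕ.sum f) ≡ Σℚ.sum (fromℕ ∘ f)
  fromℕ-sum {zero}  f = fromℕ-0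
  fromℕ-sum {suc n} f = trans (fromℕ-+ (f zero) _) (cong (fromℕ (f zero) +_) (fromℕ-sum (f ∘ suc)))

  fromℕ-if : ∀ b {x} → fromℕ (if b then x else 0) ≡ (if b then fromℕ x else 0ℚ)
  fromℕ-if false = fromℕ-0
  fromℕ-if true  = refl

open Numbers

-- Shift operators on functions ℤⁿ → ℚ

module LatticeFunctions where
  open ≡ using (refl; sym; trans; cong; cong₂; module ≡-Reasoning)
  open import Data.Rational.Base using (_+_; _*_; -_)
  open ≡-Reasoning
  open +-*-Solver using (solve; _:=_; _:+_; _:*_; :-_)

  private variable
    m n i k : ℕ

  Lattice : ℕ → Set
  Lattice n = Vec ℤ n → ℚ

  -- The value 0 for a coordinate out of range lets `shiftsFrom-split` hold for every `k`.
  shift : (ℤ → ℤ) → ℕ → Lattice n → Lattice n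
  shift φ k       c []       = 0ℚ
  shift φ zero    c (y ∷ ys) = c (φ y ∷ ys)
  shift φ (suc k) c (y ∷ ys) = shift φ k (c ∘ (y ∷_)) ys

  shiftsFrom : (ℤ → ℤ) → ℕ → Lattice n → Lattice n
  shiftsFrom φ k       c []       = 0ℚ
  shiftsFrom φ zero    c (y ∷ ys) = c (φ y ∷ ys) + shiftsFrom φ zero (c ∘ (y ∷_)) ys
  shiftsFrom φ (suc k) c (y ∷ ys) = shiftsFrom φ k (c ∘ (y ∷_)) ys

  shift-cong : ∀ φ k {c c′ : Lattice n} → c ≗ c′ → shift φ k c ≗ shift φ k c′
  shift-cong φ k       eq []       = refl
  shift-cong φ zero    eq (y ∷ ys) = eq _
  shift-cong φ (suc k) eq (y ∷ ys) = shift-cong φ k (eq ∘ (y ∷_)) ys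

  shiftsFrom-cong : ∀ φ k {c c′ : Lattice n} → c ≗ c′ → shiftsFrom φ k c ≗ shiftsFrom φ k c′
  shiftsFrom-cong φ k       eq []       = refl
  shiftsFrom-cong φ zero    eq (y ∷ ys) = cong₂ _+_ (eq _) (shiftsFrom-cong φ zero (eq ∘ (y ∷_)) ys)
  shiftsFrom-cong φ (suc k) eq (y ∷ ys) = shiftsFrom-cong φ k (eq ∘ (y ∷_)) ys

  +-interchange : ∀ a b c d → (a + b) + (c + d) ≡ (a + c) + (b + d)
  +-interchange = solve 4 (λ a b c d → (a :+ b) :+ (c :+ d) := (a :+ c) :+ (b :+ d)) refl

  shift-+ : ∀ φ k (c c′ : Lattice n) y → shift φ k (λ z → c z + c′ z) y ≡ shift φ k c y + shift φ k c′ y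
  shift-+ φ k       c c′ []       = refl
  shift-+ φ zero    c c′ (y ∷ ys) = refl
  shift-+ φ (suc k) c c′ (y ∷ ys) = shift-+ φ k _ _ ys

  shiftsFrom-+ : ∀ φ k (c c′ : Lattice n) y →
    shiftsFrom φ k (λ z → c z + c′ z) y ≡ shiftsFrom φ k c y + shiftsFrom φ k c′ y
  shiftsFrom-+ φ k       c c′ []       = refl
  shiftsFrom-+ φ zero    c c′ (y ∷ ys) =
    trans (cong (c (φ y ∷ ys) + c′ (φ y ∷ ys) +_) (shiftsFrom-+ φ zero _ _ ys))
        (+-interchange (c _) (c′ _) _ _)
  shiftsFrom-+ φ (suc k) c c′ (y ∷ ys) = shiftsFrom-+ φ k _ _ ys

  shiftsFrom-neg : ∀ φ k (c : Lattice n) y → shiftsFrom φ k (λ z → - c z) y ≡ - shiftsFrom φ k c y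
  shiftsFrom-neg φ k       c []       = refl
  shiftsFrom-neg φ zero    c (y ∷ ys) =
    trans (cong (- c (φ y ∷ ys) +_) (shiftsFrom-neg φ zero _ ys)) (sym (ℚ.neg-distrib-+ (c _) _))
  shiftsFrom-neg φ (suc k) c (y ∷ ys) = shiftsFrom-neg φ k _ ys

  shift-neg : ∀ φ k (c : Lattice n) y → shift φ k (λ z → - c z) y ≡ - shift φ k c y
  shift-neg φ k       c []       = refl
  shift-neg φ zero    c (y ∷ ys) = refl
  shift-neg φ (suc k) c (y ∷ ys) = shift-neg φ k _ ys

  shiftsFrom-split : ∀ φ k (c : Lattice n) y → shiftsFrom φ k c y ≡ shift φ k c y
      + shiftsFrom φ (suc k) c y
  shiftsFrom-split φ k       c []       = refl
  shiftsFrom-split φ zero    c (y ∷ ys) = refl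
  shiftsFrom-split φ (suc k) c (y ∷ ys) = shiftsFrom-split φ k _ ys

  shiftsFrom-empty : ∀ φ k (c : Lattice n) y → n ℕ.≤ k → shiftsFrom φ k c y ≡ 0ℚ
  shiftsFrom-empty φ k       c []       _       = refl
  shiftsFrom-empty φ (suc k) c (y ∷ ys) (s≤s p) = shiftsFrom-empty φ k _ ys p

  shiftsFrom-shift-comm : ∀ φ ψ (c : Lattice n) y → i ℕ.< k →
    shiftsFrom φ k (shift ψ i c) y ≡ shift ψ i (shiftsFrom φ k c) y
  shiftsFrom-shift-comm         φ ψ c []       p       = refl
  shiftsFrom-shift-comm {i = zero}  φ ψ c (y ∷ ys) (s≤s p) = refl
  shiftsFrom-shift-comm {i = suc i} φ ψ c (y ∷ ys) (s≤s p) = shiftsFrom-shift-comm φ ψ _ ys p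

  shiftsFrom-comm : ∀ φ ψ → φ ∘ ψ ≗ ψ ∘ φ → ∀ k (c : Lattice n) y →
    shiftsFrom φ k (shiftsFrom ψ k c) y ≡ shiftsFrom ψ k (shiftsFrom φ k c) y
  shiftsFrom-comm φ ψ eq k       c []       = refl
  shiftsFrom-comm φ ψ eq zero    c (y ∷ ys) = begin
    (c (ψ (φ y) ∷ ys) + Σ ψ (φ y)) + shiftsFrom φ 0 (λ zs → c (ψ y ∷ zs)
        + shiftsFrom ψ 0 (c ∘ (y ∷_)) zs) ys
      ≡⟨ cong₂ (λ u v → (c (u ∷ ys) + Σ ψ (φ y)) + v) (sym (eq y)) (shiftsFrom-+ φ 0 _ _ ys) ⟩
    (c (φ (ψ y) ∷ ys) + Σ ψ (φ y)) + (Σ φ (ψ y) + shiftsFrom φ 0 (shiftsFrom ψ 0 (c ∘ (y ∷_))) ys)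
      ≡⟨ cong (λ u → (c (φ (ψ y) ∷ ys) + Σ ψ (φ y)) + (Σ φ (ψ y) + u)) (shiftsFrom-comm φ ψ eq 0 _ ys) ⟩
    (c (φ (ψ y) ∷ ys) + Σ ψ (φ y)) + (Σ φ (ψ y) + shiftsFrom ψ 0 (shiftsFrom φ 0 (c ∘ (y ∷_))) ys)
      ≡⟨ +-interchange (c _) (Σ ψ (φ y)) (Σ φ (ψ y)) _ ⟩
    (c (φ (ψ y) ∷ ys) + Σ φ (ψ y)) + (Σ ψ (φ y) + shiftsFrom ψ 0 (shiftsFrom φ 0 (c ∘ (y ∷_))) ys)
      ≡⟨ cong (c (φ (ψ y) ∷ ys) + Σ φ (ψ y) +_) (shiftsFrom-+ ψ 0 _ _ ys) ⟨
    (c (φ (ψ y) ∷ ys) + Σ φ (ψ y)) + shiftsFrom ψ 0 (λ zs → c (φ y ∷ zs)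
        + shiftsFrom φ 0 (c ∘ (y ∷_)) zs) ys ∎
    where
    Σ : (ℤ → ℤ) → ℤ → ℚ
    Σ χ z = shiftsFrom χ 0 (c ∘ (z ∷_)) ys
  shiftsFrom-comm φ ψ eq (suc k) c (y ∷ ys) = shiftsFrom-comm φ ψ eq k _ ys

  shift-inverse : ∀ φ ψ → ψ ∘ φ ≗ (λ z → z) → ∀ {k} (c : Lattice n) y → k ℕ.< n →
    shift φ k (shift ψ k c) y ≡ c y
  shift-inverse φ ψ eq {zero}  c (y ∷ ys) _       = cong (λ z → c (z ∷ ys)) (eq y)
  shift-inverse φ ψ eq {suc k} c (y ∷ ys) (s≤s p) = shift-inverse φ ψ eq _ ys p

  -- Adjacent exchanges are enough, since every collision used below is between neighbouring
  -- coordinates.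
  data Swap : ℕ → Vec ℤ n → Vec ℤ n → Set where
    here  : ∀ {a b} {ys : Vec ℤ n} → Swap zero (a ∷ b ∷ ys) (b ∷ a ∷ ys)
    there : ∀ {y k} {ys zs : Vec ℤ n} → Swap k ys zs → Swap (suc k) (y ∷ ys) (y ∷ zs)

  Alternating : ℕ → Lattice n → Set
  Alternating k c = ∀ {y z} → Swap k y z → c z ≡ - c y

  -- With `i ≤ k` both exchanged coordinates are in the range of the sum, so the exchange only
  -- permutes its summands.
  shiftsFrom-alternating : ∀ φ {i k} {c : Lattice n} → i ℕ.≤ k →
    Alternating k c → Alternating k (shiftsFrom φ i c)
  shiftsFrom-alternating φ {zero} {c = c} _ anti (here {a = a} {b} {ys}) = begin
    c (φ b ∷ a ∷ ys) + (c (b ∷ φ a ∷ ys) + shiftsFrom φ 0 (λ zs → c (b ∷ a ∷ zs)) ys)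
      ≡⟨ cong₂ _+_ (anti here) (cong₂ _+_ (anti here)
          (trans (shiftsFrom-cong φ 0 (λ _ → anti here) ys) (shiftsFrom-neg φ 0 _ ys))) ⟩
    - c (a ∷ φ b ∷ ys) + (- c (φ a ∷ b ∷ ys) + - shiftsFrom φ 0 (λ zs → c (a ∷ b ∷ zs)) ys)
      ≡⟨ solve 3 (λ p q r → :- p :+ (:- q :+ :- r) := :- (q :+ (p :+ r))) refl (c _) (c _) _ ⟩
    - (c (φ a ∷ b ∷ ys) + (c (a ∷ φ b ∷ ys) + shiftsFrom φ 0 (λ zs → c (a ∷ b ∷ zs)) ys)) ∎
  shiftsFrom-alternating φ {zero} {c = c} _ anti (there {y = y} sw) =
    trans (cong₂ _+_ (anti (there sw)) (shiftsFrom-alternating φ z≤n (anti ∘ there) sw))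
        (sym (ℚ.neg-distrib-+ (c _) _))
  shiftsFrom-alternating φ {suc i} (s≤s p) anti (there sw) =
      shiftsFrom-alternating φ p (anti ∘ there) sw

  shift-alternating : ∀ φ {i k} {c : Lattice n} → i ℕ.< k →
    Alternating k c → Alternating k (shift φ i c)
  shift-alternating φ {zero}  (s≤s p) anti (there sw) = anti (there sw)
  shift-alternating φ {suc i} (s≤s p) anti (there sw) = shift-alternating φ p (anti ∘ there) sw

  -- Turns antisymmetry into vanishing at points with two equal coordinates.
  p≡-p⇒p≡0 : ∀ p → p ≡ - p → p ≡ 0ℚ
  p≡-p⇒p≡0 p eq = begin
    p           ≡⟨ solve 1 (λ x → x := con ℚ.½ :* (x :+ x)) refl p ⟩
    ℚ.½ * (p + p) ≡⟨ cong (λ x → ℚ.½ * (p + x)) eq ⟩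
    ℚ.½ * (p + - p) ≡⟨ cong (ℚ.½ *_) (ℚ.+-inverseʳ p) ⟩
    ℚ.½ * 0ℚ      ≡⟨ ℚ.*-zeroʳ ℚ.½ ⟩
    0ℚ          ∎
    where open +-*-Solver using (con)

  -- Coordinates that no letter has made active still have their values in δ; this is all that the
  -- collision arguments know about a point.
  Staircase : ℕ → ℕ → Vec ℤ n → Set
  Staircase s zero    y        = ⊤
  Staircase s (suc k) []       = ⊤
  Staircase s (suc k) (y ∷ ys) = (y ≡ ℤ.+ s) × Staircase (suc s) k ys

  staircase-weaken : ∀ {s k} (y : Vec ℤ n) → Staircase s (suc k) y → Staircase s k y
  staircase-weaken {k = zero}  y        _         = tt
  staircase-weaken {k = suc k} []       _         = tt
  staircase-weaken {k = suc k} (y ∷ ys) (eq , st) = eq , staircase-weaken ys st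

  -- Coordinate `k`, raised from s + k to s + k + 1, meets its right neighbour; the bound on `k`
  -- ensures that there is one.
  shift-suc-collision : ∀ {s k} {c : Lattice n} y → suc k ℕ.< n → Alternating k c →
    Staircase s (suc (suc k)) y → shift ℤ.suc k c y ≡ 0ℚ
  shift-suc-collision {k = zero} (y ∷ []) (s≤s ())
  shift-suc-collision {k = zero} (y ∷ z ∷ ys) _ anti (refl , refl , _) = p≡-p⇒p≡0 _ (anti here)
  shift-suc-collision {k = suc k} (y ∷ ys) (s≤s p) anti (_ , st) =
      shift-suc-collision ys p (anti ∘ there) st

  -- Coordinate `k + 1`, when lowered, meets its left neighbour.
  shift-pred-collision : ∀ {s k} {c : Lattice n} y → Alternating k c →
    Staircase s (suc (suc k)) y → shift ℤ.pred (suc k) c y ≡ 0ℚ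
  shift-pred-collision []       anti st = refl
  shift-pred-collision {k = zero} (y ∷ []) anti st = refl
  shift-pred-collision {k = zero} (y ∷ z ∷ ys) anti (refl , refl , _) = p≡-p⇒p≡0 _ (anti here)
  shift-pred-collision {k = suc k} (y ∷ ys) anti (_ , st) = shift-pred-collision ys (anti ∘ there) st

  staircase-shiftsFrom-zero : ∀ φ {s i k} {c : Lattice n} → k ℕ.≤ i →
    (∀ y → Staircase s k y → c y ≡ 0ℚ) → ∀ y → Staircase s k y → shiftsFrom φ i c y ≡ 0ℚ
  staircase-shiftsFrom-zero φ le v [] st = refl
  staircase-shiftsFrom-zero φ {i = zero}  {zero}  le v (y ∷ ys) st =
    cong₂ _+_ (v _ tt) (staircase-shiftsFrom-zero φ {s = zero} z≤n (λ _ _ → v _ tt) ys tt)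
  staircase-shiftsFrom-zero φ {s} {suc i} {zero}  le v (y ∷ ys) st =
    staircase-shiftsFrom-zero φ {s = s} z≤n (λ _ _ → v _ tt) ys tt
  staircase-shiftsFrom-zero φ {i = suc i} {suc k} (s≤s le) v (y ∷ ys) (eq , st) =
    staircase-shiftsFrom-zero φ le (λ zs st → v _ (eq , st)) ys st

  staircase-shift-zero : ∀ φ {s k} {c : Lattice n} →
    (∀ y → Staircase s k y → c y ≡ 0ℚ) → ∀ y → Staircase s k y → shift φ k c y ≡ 0ℚ
  staircase-shift-zero φ v [] st = refl
  staircase-shift-zero φ {k = zero}  v (y ∷ ys) st = v _ tt
  staircase-shift-zero φ {k = suc k} v (y ∷ ys) (eq , st) =
    staircase-shift-zero φ (λ zs st → v _ (eq , st)) ys st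

open LatticeFunctions

-- Words and their weights

module Words where
  open ≡ using (refl; sym; trans; cong; cong₂; subst; module ≡-Reasoning)
  open import Data.Rational.Base using (_+_; _*_)
  open ≡-Reasoning
  open +-*-Solver using (solve; _:=_; _:+_)

  private variable
    m : ℕ

  -- The state after a prefix has been read, as a word with one letter for each later position:
  -- free if it is not the right end of an arc begun in the prefix, and otherwise top or buried
  -- according to its place when the right ends are dealt into piles by patience sorting.
  data Slot : Set where
    free buried top : Slot

  tops : Vec Slot m → ℕ
  tops []           = 0
  tops (free   ∷ X) = tops X
  tops (buried ∷ X) = tops X
  tops (top    ∷ X) = suc (tops X)

  sumWords : ∀ m → (Vec Slot m → ℚ) → ℚ
  sumWords zero    h = h []
  sumWords (suc m) h =
    sumWords m (h ∘ (free ∷_)) + (sumWords m (h ∘ (buried ∷_)) + sumWords m (h ∘ (top ∷_)))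

  sumWords-cong : ∀ m {h h′ : Vec Slot m → ℚ} → h ≗ h′ → sumWords m h ≡ sumWords m h′
  sumWords-cong zero    eq = eq []
  sumWords-cong (suc m) eq = cong₂ _+_ (sumWords-cong m (eq ∘ (free ∷_)))
    (cong₂ _+_ (sumWords-cong m (eq ∘ (buried ∷_))) (sumWords-cong m (eq ∘ (top ∷_))))

  sumWords-+ : ∀ m (h h′ : Vec Slot m → ℚ) → sumWords m (λ X → h X + h′ X) ≡ sumWords m h
      + sumWords m h′
  sumWords-+ zero    h h′ = refl
  sumWords-+ (suc m) h h′ =
    trans (cong₂ _+_ (sumWords-+ m _ _) (cong₂ _+_ (sumWords-+ m _ _) (sumWords-+ m _ _)))
          (solve 6 (λ a b c d e f → (a :+ b) :+ ((c :+ d) :+ (e :+ f)) := (a :+ (c :+ e)) :+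
              (b :+ (d :+ f))) refl
            (sumWords m (h ∘ (free ∷_))) (sumWords m (h′ ∘ (free ∷_)))
            (sumWords m (h ∘ (buried ∷_))) (sumWords m (h′ ∘ (buried ∷_)))
            (sumWords m (h ∘ (top ∷_))) (sumWords m (h′ ∘ (top ∷_))))

  sumWords-zero : ∀ m {h : Vec Slot m → ℚ} → (∀ X → h X ≡ 0ℚ) → sumWords m h ≡ 0ℚ
  sumWords-zero zero    eq = eq []
  sumWords-zero (suc m) eq = cong₂ _+_ (sumWords-zero m (eq ∘ (free ∷_)))
    (cong₂ _+_ (sumWords-zero m (eq ∘ (buried ∷_))) (sumWords-zero m (eq ∘ (top ∷_))))

  -- Sums over the results of inserting a new pile top into a word: for sumNew it starts
  -- a new pile, for sumBury it buries the closest pile top to its left.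
  sumNew sumBury : (Vec Slot m → ℚ) → Vec Slot m → ℚ
  sumNew g []           = 0ℚ
  sumNew g (free   ∷ X) = g (top ∷ X) + sumNew (g ∘ (free ∷_)) X
  sumNew g (buried ∷ X) = sumNew (g ∘ (buried ∷_)) X
  sumNew g (top    ∷ X) = 0ℚ
  sumBury g []           = 0ℚ
  sumBury g (free   ∷ X) = sumBury (g ∘ (free ∷_)) X
  sumBury g (buried ∷ X) = sumBury (g ∘ (buried ∷_)) X
  sumBury g (top    ∷ X) = sumNew (g ∘ (buried ∷_)) X + sumBury (g ∘ (top ∷_)) X

  module Weights (ℓ : ℕ) where

    inactive : Vec Slot m → ℕ
    inactive X = ℓ ∸ tops X

    raiseActive lowerActive activate : ℕ → Lattice ℓ → Lattice ℓ
    raiseActive = shiftsFrom ℤ.suc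
    lowerActive = shiftsFrom ℤ.pred
    -- No coordinate is left for a further pile. Otherwise the last inactive coordinate is raised,
    -- which has index one less than their number.
    activate zero    c y = 0ℚ
    activate (suc k) c   = shift ℤ.suc k c

    δ : Vec ℤ ℓ
    δ = tabulate λ j → ℤ.+ toℕ j

    -- If c y is the coefficient of x^y in det (entry) (Σ x_j + x̄_j)^n then weight X c turns out to be
    -- the number of ways of reading n positions that leave X.  Each pile makes one more coordinate
    -- active, from the last to the first; words with more than ℓ piles have weight 0.
    weight : Vec Slot m → Lattice ℓ → ℚ
    weight []           c = c δ
    weight (free   ∷ X) c = weight X c
    weight (buried ∷ X) c = weight X (raiseActive (inactive X) c)
    weight (top    ∷ X) c = weight X (activate (inactive X) c)

    -- Adjoints of sumNew and sumBury.
    newWeight buryWeight : Vec Slot m → Lattice ℓ → ℚ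
    newWeight []           c = 0ℚ
    newWeight (free   ∷ X) c = newWeight X c
    newWeight (buried ∷ X) c = newWeight X (raiseActive (ℓ ∸ pred (tops X)) c)
    newWeight (top    ∷ X) c = weight X c
    buryWeight []           c = 0ℚ
    buryWeight (free   ∷ X) c = buryWeight X c
    buryWeight (buried ∷ X) c =
      newWeight X (activate (ℓ ∸ pred (tops X)) c) + buryWeight X (raiseActive (inactive X) c)
    buryWeight (top    ∷ X) c = buryWeight X (activate (inactive X) c)

    -- The induction strips the first letter, whose operator depends on the number of piles behind
    -- it, so `c` must be allowed to depend on that number. The index of `C` is the pile count after
    -- the insertion, hence `suc` on the left; on the right the operators are those of the word
    -- before it, hence `pred (tops X)` in `newWeight`.
    sumNew-adjoint : ∀ m (C : ℕ → Lattice ℓ) (g : Vec Slot m → ℚ) →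
      sumWords m (λ X → weight X (C (suc (tops X))) * sumNew g X) ≡
      sumWords m (λ X → newWeight X (C (tops X)) * g X)
    sumNew-adjoint zero    C g = trans (ℚ.*-zeroʳ (C 1 δ)) (sym (ℚ.*-zeroˡ (g [])))
    sumNew-adjoint (suc m) C g = begin
      sumWords m (λ X → weight X (C (suc (tops X))) * (g (top ∷ X) + sumNew (g ∘ (free ∷_)) X))
          + (b + c)
        ≡⟨ cong₂ _+_ (trans (sumWords-cong m
            (λ X → ℚ.*-distribˡ-+ (weight X (C (suc (tops X)))) _ _)) (sumWords-+ m _ _))
             (cong₂ _+_ (sumNew-adjoint m (λ r → raiseActive (ℓ ∸ pred r) (C r)) (g ∘ (buried ∷_)))
                        (sumWords-zero m (λ X → ℚ.*-zeroʳ (weight X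
                            (activate (inactive X) (C (suc (suc (tops X))))))))) ⟩
      (t + sumWords m (λ X → weight X (C (suc (tops X))) * sumNew (g ∘ (free ∷_)) X)) + (b′ + 0ℚ)
        ≡⟨ cong (λ u → (t + u) + (b′ + 0ℚ)) (sumNew-adjoint m C (g ∘ (free ∷_))) ⟩
      (t + f) + (b′ + 0ℚ)
        ≡⟨ cong ((t + f) +_) (ℚ.+-identityʳ b′) ⟩
      (t + f) + b′
        ≡⟨ solve 3 (λ t f b → (t :+ f) :+ b := f :+ (b :+ t)) refl t f b′ ⟩
      f + (b′ + t) ∎
      where
      b = sumWords m (λ X → weight X (raiseActive (inactive X) (C (suc (tops X))))
          * sumNew (g ∘ (buried ∷_)) X)
      c = sumWords m (λ X → weight X (activate (inactive X) (C (suc (suc (tops X))))) * 0ℚ)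
      t = sumWords m (λ X → weight X (C (suc (tops X))) * g (top ∷ X))
      b′ = sumWords m (λ X → newWeight X (raiseActive (ℓ ∸ pred (tops X)) (C (tops X)))
          * g (buried ∷ X))
      f = sumWords m (λ X → newWeight X (C (tops X)) * g (free ∷ X))

    -- Burying keeps the pile count, so `C` has the same index on both sides. A buried first letter
    -- of the new word has two origins: it was buried already, or it was a pile top and the first
    -- top behind it is the new one. These are the two terms of `buryWeight`.
    sumBury-adjoint : ∀ m (C : ℕ → Lattice ℓ) (g : Vec Slot m → ℚ) →
      sumWords m (λ X → weight X (C (tops X)) * sumBury g X) ≡
      sumWords m (λ X → buryWeight X (C (tops X)) * g X)
    sumBury-adjoint zero    C g = trans (ℚ.*-zeroʳ (C 0 δ)) (sym (ℚ.*-zeroˡ (g [])))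
    sumBury-adjoint (suc m) C g = begin
      sumWords m (λ X → weight X (C (tops X)) * sumBury (g ∘ (free ∷_)) X) +
        (sumWords m (λ X → weight X (raiseActive (inactive X) (C (tops X)))
            * sumBury (g ∘ (buried ∷_)) X) +
         sumWords m (λ X → weight X (activate (inactive X) (C (suc (tops X)))) *
                           (sumNew (g ∘ (buried ∷_)) X + sumBury (g ∘ (top ∷_)) X)))
        ≡⟨ cong₂ _+_ (sumBury-adjoint m C _)
             (cong₂ _+_ (sumBury-adjoint m (λ r → raiseActive (ℓ ∸ r) (C r)) _)
               (trans (sumWords-cong m (λ X → ℚ.*-distribˡ-+
                   (weight X (activate (inactive X) (C (suc (tops X))))) _ _))
                 (trans (sumWords-+ m _ _)
                   (cong₂ _+_ (sumNew-adjoint m (λ r → activate (ℓ ∸ pred r) (C r)) _)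
                              (sumBury-adjoint m (λ r → activate (ℓ ∸ r) (C (suc r))) _))))) ⟩
      f + (b + (p + t))
        ≡⟨ solve 4 (λ f b p t → f :+ (b :+ (p :+ t)) := f :+ ((p :+ b) :+ t)) refl f b p t ⟩
      f + ((p + b) + t)
        ≡⟨ cong (λ u → f + (u + t)) (trans (sym (sumWords-+ m _ _))
             (sumWords-cong m (λ X → sym (ℚ.*-distribʳ-+ (g (buried ∷ X)) (newWeight X _)
                 (buryWeight X _))))) ⟩
      f + (sumWords m (λ X → buryWeight (buried ∷ X) (C (tops X)) * g (buried ∷ X)) + t) ∎
      where
      f = sumWords m (λ X → buryWeight X (C (tops X)) * g (free ∷ X))
      b = sumWords m (λ X → buryWeight X (raiseActive (inactive X) (C (tops X))) * g (buried ∷ X))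
      p = sumWords m (λ X → newWeight X (activate (ℓ ∸ pred (tops X)) (C (tops X))) * g (buried ∷ X))
      t = sumWords m (λ X → buryWeight X (activate (inactive X) (C (suc (tops X)))) * g (top ∷ X))

    activate-cong : ∀ k {c c′ : Lattice ℓ} → c ≗ c′ → activate k c ≗ activate k c′
    activate-cong zero    eq y = refl
    activate-cong (suc k) eq   = shift-cong ℤ.suc k eq

    activate-+ : ∀ k (c c′ : Lattice ℓ) y → activate k (λ z → c z + c′ z) y ≡ activate k c y
        + activate k c′ y
    activate-+ zero    c c′ y = refl
    activate-+ (suc k) c c′ y = shift-+ ℤ.suc k c c′ y

    weight-cong : ∀ (X : Vec Slot m) {c c′} → c ≗ c′ → weight X c ≡ weight X c′
    weight-cong []           eq = eq δ
    weight-cong (free   ∷ X) eq = weight-cong X eq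
    weight-cong (buried ∷ X) eq = weight-cong X (shiftsFrom-cong ℤ.suc (inactive X) eq)
    weight-cong (top    ∷ X) eq = weight-cong X (activate-cong (inactive X) eq)

    newWeight-cong : ∀ (X : Vec Slot m) {c c′} → c ≗ c′ → newWeight X c ≡ newWeight X c′
    newWeight-cong []           eq = refl
    newWeight-cong (free   ∷ X) eq = newWeight-cong X eq
    newWeight-cong (buried ∷ X) eq = newWeight-cong X (shiftsFrom-cong ℤ.suc (ℓ ∸ pred (tops X)) eq)
    newWeight-cong (top    ∷ X) eq = weight-cong X eq

    weight-+ : ∀ (X : Vec Slot m) c c′ → weight X (λ y → c y + c′ y) ≡ weight X c + weight X c′
    weight-+ []           c c′ = refl
    weight-+ (free   ∷ X) c c′ = weight-+ X c c′
    weight-+ (buried ∷ X) c c′ = trans (weight-cong X (shiftsFrom-+ ℤ.suc (inactive X) c c′))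
        (weight-+ X _ _)
    weight-+ (top    ∷ X) c c′ = trans (weight-cong X (activate-+ (inactive X) c c′)) (weight-+ X _ _)

    newWeight-+ : ∀ (X : Vec Slot m) c c′ → newWeight X (λ y → c y + c′ y) ≡ newWeight X c
        + newWeight X c′
    newWeight-+ []           c c′ = refl
    newWeight-+ (free   ∷ X) c c′ = newWeight-+ X c c′
    newWeight-+ (buried ∷ X) c c′ =
      trans (newWeight-cong X (shiftsFrom-+ ℤ.suc (ℓ ∸ pred (tops X)) c c′)) (newWeight-+ X _ _)
    newWeight-+ (top    ∷ X) c c′ = weight-+ X c c′

    newWeight-0 : ∀ (X : Vec Slot m) c → tops X ≡ 0 → newWeight X c ≡ 0ℚ
    newWeight-0 []           c eq = refl
    newWeight-0 (free   ∷ X) c eq = newWeight-0 X c eq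
    newWeight-0 (buried ∷ X) c eq = newWeight-0 X _ eq

    VanishesOn : ℕ → Lattice ℓ → Set
    VanishesOn k c = ∀ y → Staircase 0 k y → c y ≡ 0ℚ

    δ-staircase : ∀ k → Staircase 0 k δ
    δ-staircase = from ℓ 0
      where
      from : ∀ n s k → Staircase s k (tabulate {n = n} (λ j → ℤ.+ (s ℕ.+ toℕ j)))
      from n       s zero    = tt
      from zero    s (suc k) = tt
      from (suc n) s (suc k) = cong ℤ.+_ (ℕ.+-identityʳ s) ,
        subst (Staircase (suc s) k) (Data.Vec.Properties.tabulate-cong
            (λ j → cong ℤ.+_ (sym (ℕ.+-suc s (toℕ j))))) (from n (suc s) k)
        where import Data.Vec.Properties

    inactive-top : ∀ (X : Vec Slot m) → inactive (top ∷ X) ≡ pred (inactive X)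
    inactive-top X = sym (ℕ.pred[m∸n]≡m∸[1+n] ℓ (tops X))

    -- The letters of `X` act only on coordinates from `inactive X` on; at δ the earlier ones keep
    -- their values. So an identity needs to be checked on staircase points only.
    weight-vanishes : ∀ (X : Vec Slot m) {c} → VanishesOn (inactive X) c → weight X c ≡ 0ℚ
    weight-vanishes []           v = v δ (δ-staircase ℓ)
    weight-vanishes (free   ∷ X) v = weight-vanishes X v
    weight-vanishes (buried ∷ X) v = weight-vanishes X (staircase-shiftsFrom-zero ℤ.suc ℕ.≤-refl v)
    weight-vanishes (top    ∷ X) {c} v =
        weight-vanishes X (activate-vanishes (inactive X) (subst
        (λ k → VanishesOn k c) (inactive-top X) v))
      where
      activate-vanishes : ∀ k {c} → VanishesOn (pred k) c → VanishesOn k (activate k c)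
      activate-vanishes zero    v y st = refl
      activate-vanishes (suc k) v y st = staircase-shift-zero ℤ.suc v y (staircase-weaken y st)

    -- The word before the insertion has one pile fewer, so one more coordinate is still in place.
    newWeight-vanishes : ∀ (X : Vec Slot m) {c} → VanishesOn (ℓ ∸ pred (tops X)) c → newWeight X c ≡ 0ℚ
    newWeight-vanishes []           v = refl
    newWeight-vanishes (free   ∷ X) v = newWeight-vanishes X v
    newWeight-vanishes (buried ∷ X) v = newWeight-vanishes X
        (staircase-shiftsFrom-zero ℤ.suc ℕ.≤-refl v)
    newWeight-vanishes (top    ∷ X) v = weight-vanishes X v

    AlternatingFrom : ℕ → Lattice ℓ → Set
    AlternatingFrom k c = ∀ i → k ℕ.≤ i → Alternating i c

    -- Before the insertion one coordinate fewer was active. Raising that coordinate, by `activate`,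
    -- or one of those active then covers exactly the coordinates active now.
    newWeight-split : ∀ (X : Vec Slot m) c → tops X ℕ.≤ ℓ →
      newWeight X (raiseActive (ℓ ∸ pred (tops X)) c) + newWeight X (activate (ℓ ∸ pred (tops X)) c) ≡
      newWeight X (raiseActive (inactive X) c)
    newWeight-split X c le with tops X in eq
    ... | zero  = trans (cong₂ _+_ (newWeight-0 X _ eq) (newWeight-0 X _ eq)) (sym (newWeight-0 X _ eq))
    ... | suc r rewrite ℕ.+-∸-assoc 1 le = trans (sym (newWeight-+ X _ _)) (newWeight-cong X λ y →
      trans (ℚ.+-comm (raiseActive (suc (ℓ ∸ suc r)) c y) _)
          (sym (shiftsFrom-split ℤ.suc (ℓ ∸ suc r) c y)))

    -- Under `newWeight` coordinate `k + 1` is inactive too, so raising coordinate `k` produces a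
    -- collision.
    newWeight-shift : ∀ (X : Vec Slot m) {k c} → inactive X ≡ suc k → tops X ℕ.≤ ℓ →
        AlternatingFrom k c →
      newWeight X (shift ℤ.suc k c) ≡ 0ℚ
    newWeight-shift X {k} {c} eq le alt with tops X in teq
    ... | zero  = newWeight-0 X _ teq
    ... | suc r = newWeight-vanishes X λ y st → shift-suc-collision y k<ℓ (alt k ℕ.≤-refl)
      (subst (λ j → Staircase 0 j y) (trans (cong (λ r → ℓ ∸ pred r) teq) eq′) st)
      where
      eq′ : ℓ ∸ r ≡ suc (suc k)
      eq′ = trans (ℕ.+-∸-assoc 1 le) (cong suc eq)
      k<ℓ : suc k ℕ.< ℓ
      k<ℓ = subst (ℕ._≤ ℓ) eq′ (ℕ.m∸n≤m ℓ r)

    -- Lowering an active coordinate either undoes an insertion or, by antisymmetry, contributes nothing.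
    new+bury : ∀ (X : Vec Slot m) c → tops X ℕ.≤ ℓ → AlternatingFrom (inactive X) c →
      newWeight X c + buryWeight X c ≡ weight X (lowerActive (inactive X) c)
    new+bury []           c le alt = sym (shiftsFrom-empty ℤ.pred ℓ c δ ℕ.≤-refl)
    new+bury (free   ∷ X) c le alt = new+bury X c le alt
    new+bury (buried ∷ X) c le alt = begin
      newWeight X (raiseActive (ℓ ∸ pred (tops X)) c) +
        (newWeight X (activate (ℓ ∸ pred (tops X)) c) + buryWeight X (raiseActive (inactive X) c))
        ≡⟨ ℚ.+-assoc (newWeight X _) (newWeight X _) (buryWeight X _) ⟨
      (newWeight X (raiseActive (ℓ ∸ pred (tops X)) c) + newWeight X (activate (ℓ ∸ pred (tops X)) c)) +
        buryWeight X (raiseActive (inactive X) c)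
        ≡⟨ cong (_+ buryWeight X (raiseActive (inactive X) c)) (newWeight-split X c le) ⟩
      newWeight X (raiseActive (inactive X) c) + buryWeight X (raiseActive (inactive X) c)
        ≡⟨ new+bury X _ le (λ i p → shiftsFrom-alternating ℤ.suc p (alt i p)) ⟩
      weight X (lowerActive (inactive X) (raiseActive (inactive X) c))
        ≡⟨ weight-cong X (shiftsFrom-comm ℤ.pred ℤ.suc pred-suc-comm (inactive X) c) ⟩
      weight X (raiseActive (inactive X) (lowerActive (inactive X) c)) ∎
      where
      pred-suc-comm : ∀ i → ℤ.pred (ℤ.suc i) ≡ ℤ.suc (ℤ.pred i)
      pred-suc-comm i = trans (ℤ.pred-suc i) (sym (ℤ.suc-pred i))
    new+bury (top    ∷ X) c le alt = begin
      weight X c + buryWeight X (activate (inactive X) c)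
        ≡⟨ cong (λ j → weight X c + buryWeight X (activate j c)) k-eq ⟩
      weight X c + buryWeight X raised
        -- A collision term, equal to 0, is added so that the induction hypothesis applies.
        ≡⟨ cong (weight X c +_) (trans (sym (ℚ.+-identityˡ _)) (cong (_+ buryWeight X raised)
             (sym (newWeight-shift X k-eq (ℕ.<⇒≤ le) alt)))) ⟩
      weight X c + (newWeight X raised + buryWeight X raised)
        ≡⟨ cong (weight X c +_) (new+bury X raised (ℕ.<⇒≤ le)
             λ i p → let p′ = subst (ℕ._≤ i) k-eq p in shift-alternating ℤ.suc p′ (alt i (ℕ.<⇒≤ p′))) ⟩
      weight X c + weight X (lowerActive (inactive X) raised)
        ≡⟨ weight-+ X c _ ⟨
      weight X (λ y → c y + lowerActive (inactive X) raised y)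
        ≡⟨ weight-cong X pointwise ⟩
      weight X (activate (inactive X) (lowerActive k c)) ∎
      where
      k = ℓ ∸ suc (tops X)
      k-eq : inactive X ≡ suc k
      k-eq = ℕ.+-∸-assoc 1 le
      raised = shift ℤ.suc k c
      -- `c` itself is the summand that raises coordinate `k` and lowers it again; it completes the
      -- sum over the active coordinates of `top ∷ X`.
      pointwise : ∀ y → c y + lowerActive (inactive X) raised y
          ≡ activate (inactive X) (lowerActive k c) y
      pointwise y rewrite k-eq = begin
        c y + lowerActive (suc k) raised y
          ≡⟨ cong₂ _+_ (sym (shift-inverse ℤ.suc ℤ.pred ℤ.pred-suc c y
              (subst (ℕ._≤ ℓ) k-eq (ℕ.m∸n≤m ℓ (tops X)))))
                       (shiftsFrom-shift-comm ℤ.pred ℤ.suc c y (ℕ.n<1+n k)) ⟩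
        shift ℤ.suc k (shift ℤ.pred k c) y + shift ℤ.suc k (lowerActive (suc k) c) y
          ≡⟨ shift-+ ℤ.suc k _ _ y ⟨
        shift ℤ.suc k (λ z → shift ℤ.pred k c z + lowerActive (suc k) c z) y
          ≡⟨ shift-cong ℤ.suc k (shiftsFrom-split ℤ.pred k c) y ⟨
        shift ℤ.suc k (lowerActive k c) y ∎

open Words

-- Recurrence for the weights

module Recurrence where
  open ≡ using (refl; sym; trans; cong; cong₂; subst; module ≡-Reasoning)
  open import Data.Rational.Base using (_+_; _*_; -_)
  open ≡-Reasoning
  open +-*-Solver using (solve; _:=_; _:+_; _:*_; :-_)

  private variable
    m n : ℕ

  isFree : Slot → Bool
  isFree free   = true
  isFree buried = false
  isFree top    = false

  push : Slot → Bool × Vec Slot m → Bool × Vec Slot (suc m)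
  push top (false , Y) = true , buried ∷ Y
  push x   (β     , Y) = β , x ∷ Y

  -- Patience sorting: the new entry becomes a pile top and the closest pile top to its left
  -- is buried.  The flag records whether there is one.
  insert : Fin m → Vec Slot m → Bool × Vec Slot m
  insert zero    (_ ∷ X) = false , top ∷ X
  insert (suc b) (x ∷ X) = push x (insert b X)

  -- `h` sees the flag because the effect on a pile top in front depends on it: the top is buried if
  -- nothing behind it was, and survives otherwise.
  sum-insert : ∀ (h : Bool → Vec Slot m → ℚ) X →
    Σℚ.sum (λ b → if isFree (lookup X b) then uncurry h (insert b X) else 0ℚ) ≡
    sumNew (h false) X + sumBury (h true) X
  sum-insert h [] = refl
  sum-insert h (free ∷ X) = begin
    h false (top ∷ X) + Σℚ.sum
        (λ b → if isFree (lookup X b) then uncurry h (push free (insert b X)) else 0ℚ)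
      ≡⟨ cong (h false (top ∷ X) +_) (sum-insert (λ β → h β ∘ (free ∷_)) X) ⟩
    h false (top ∷ X) + (sumNew (h false ∘ (free ∷_)) X + sumBury (h true ∘ (free ∷_)) X)
      ≡⟨ ℚ.+-assoc (h false (top ∷ X)) _ _ ⟨
    (h false (top ∷ X) + sumNew (h false ∘ (free ∷_)) X) + sumBury (h true ∘ (free ∷_)) X ∎
  sum-insert h (buried ∷ X) =
    trans (ℚ.+-identityˡ _) (sum-insert (λ β → h β ∘ (buried ∷_)) X)
  sum-insert {suc m} h (top ∷ X) =
    cong (0ℚ +_) (trans (Σℚ.sum-cong-≗ pointwise) (sum-insert h′ X))
    where
    h′ : Bool → Vec Slot m → ℚ
    h′ false Y = h true (buried ∷ Y)
    h′ true  Y = h true (top ∷ Y)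
    pointwise : ∀ b → (if isFree (lookup X b) then uncurry h (push top (insert b X)) else 0ℚ) ≡
                      (if isFree (lookup X b) then uncurry h′ (insert b X) else 0ℚ)
    pointwise b with isFree (lookup X b) | insert b X
    ... | false | _         = refl
    ... | true  | false , Y = refl
    ... | true  | true  , Y = refl

  -- Exchanges the two exponents r and -(r + 1) of an entry of the determinant.
  mirror : ℤ → ℤ
  mirror z = ℤ.pred (ℤ.- z)

  mirrorHead : Vec ℤ n → Vec ℤ n
  mirrorHead []       = []
  mirrorHead (y ∷ ys) = mirror y ∷ ys

  Mirrored : Lattice n → Set
  Mirrored c = ∀ y → c (mirrorHead y) ≡ c y

  staircase-mono : ∀ {s j k} (y : Vec ℤ n) → j ℕ.≤ k → Staircase s k y → Staircase s j y
  staircase-mono {j = zero}              y        _       _         = tt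
  staircase-mono {j = suc j} {k = suc k} []       _       _         = tt
  staircase-mono {j = suc j} {k = suc k} (y ∷ ys) (s≤s p) (eq , st) = eq , staircase-mono ys p st

  suc-mirror : ∀ z → ℤ.suc (mirror z) ≡ mirror (ℤ.pred z)
  suc-mirror z = begin
    ℤ.suc (ℤ.pred (ℤ.- z))  ≡⟨ ℤ.suc-pred (ℤ.- z) ⟩
    ℤ.- z                   ≡⟨ ℤ.pred-suc (ℤ.- z) ⟨
    ℤ.pred (ℤ.suc (ℤ.- z))  ≡⟨ cong ℤ.pred (ℤ.neg-distrib-+ ℤ.-1ℤ z) ⟨
    mirror (ℤ.pred z)       ∎

  pred-mirror : ∀ z → ℤ.pred (mirror z) ≡ mirror (ℤ.suc z)
  pred-mirror z = cong ℤ.pred (sym (ℤ.neg-distrib-+ ℤ.1ℤ z))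

  -- For s = 0 these are the points coordinatewise at least δ, a set which raising never leaves.
  Above : ℕ → Vec ℤ n → Set
  Above s []       = ⊤
  Above s (y ∷ ys) = (ℤ.+ s ℤ.≤ y) × Above (suc s) ys

  shiftsFrom-above-zero : ∀ {n s} k {c : Lattice n} →
    (∀ y → Above s y → c y ≡ 0ℚ) → ∀ y → Above s y → shiftsFrom ℤ.suc k c y ≡ 0ℚ
  shiftsFrom-above-zero k       v []       ab       = refl
  shiftsFrom-above-zero zero    v (y ∷ ys) (p , ab) =
    cong₂ _+_ (v _ (ℤ.≤-trans p (ℤ.i≤suc[i] y) , ab)) (shiftsFrom-above-zero 0
        (λ zs ab → v _ (p , ab)) ys ab)
  shiftsFrom-above-zero (suc k) v (y ∷ ys) (p , ab) = shiftsFrom-above-zero k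
      (λ zs ab → v _ (p , ab)) ys ab

  shift-above-zero : ∀ {n s} k {c : Lattice n} →
    (∀ y → Above s y → c y ≡ 0ℚ) → ∀ y → Above s y → shift ℤ.suc k c y ≡ 0ℚ
  shift-above-zero k       v []       ab       = refl
  shift-above-zero zero    v (y ∷ ys) (p , ab) = v _ (ℤ.≤-trans p (ℤ.i≤suc[i] y) , ab)
  shift-above-zero (suc k) v (y ∷ ys) (p , ab) = shift-above-zero k (λ zs ab → v _ (p , ab)) ys ab

  -- Completions of a word, and the transfer of one letter

  module Completions (ℓ : ℕ) where
    open Weights ℓ

    -- The two bounds differ: a new arc may bring the piles up to ℓ, while a fixed point under r
    -- piles gives a descending sequence of length 2r + 1 and so needs r < ℓ. At the right end of an
    -- arc there is no choice.
    completions : Vec Slot m → ℕ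
    completions []           = 1
    completions (free   ∷ X) = (if tops X <ᵇ ℓ then completions X else 0) ℕ.+
      Σℕ.sum (λ b → if isFree (lookup X b)
                    then (let Y = proj₂ (insert b X) in if tops Y ≤ᵇ ℓ then completions Y else 0)
                    else 0)
    completions (buried ∷ X) = completions X
    completions (top    ∷ X) = completions X

    completionsℚ : Vec Slot m → ℚ
    completionsℚ X = fromℕ (completions X)

    bounded : (Vec Slot m → ℚ) → Vec Slot m → ℚ
    bounded g X = if tops X ≤ᵇ ℓ then g X else 0ℚ

    fixedPoint : Vec Slot m → ℚ
    fixedPoint X = if tops X <ᵇ ℓ then completionsℚ X else 0ℚ

    arc : (X : Vec Slot m) → Fin m → ℕ
    arc X b = if isFree (lookup X b)
              then (let Y = proj₂ (insert b X) in if tops Y ≤ᵇ ℓ then completions Y else 0)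
              else 0

    completions-free : ∀ (X : Vec Slot m) → completionsℚ (free ∷ X) ≡
      fixedPoint X + (sumNew (bounded completionsℚ) X + sumBury (bounded completionsℚ) X)
    completions-free X = begin
      completionsℚ (free ∷ X)
        ≡⟨ fromℕ-+ (if tops X <ᵇ ℓ then completions X else 0) (Σℕ.sum (arc X)) ⟩
      fromℕ (if tops X <ᵇ ℓ then completions X else 0) + fromℕ (Σℕ.sum (arc X))
        ≡⟨ cong₂ _+_ (fromℕ-if (tops X <ᵇ ℓ)) (fromℕ-sum (arc X)) ⟩
      fixedPoint X + Σℚ.sum (fromℕ ∘ arc X)
        ≡⟨ cong (fixedPoint X +_) (Σℚ.sum-cong-≗ λ b → trans (fromℕ-if (isFree (lookup X b)))
             (cong (λ x → if isFree (lookup X b) then x else 0ℚ)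
                 (fromℕ-if (tops (proj₂ (insert b X)) ≤ᵇ ℓ)))) ⟩
      fixedPoint X + Σℚ.sum (λ b → if isFree (lookup X b) then bounded completionsℚ
          (proj₂ (insert b X)) else 0ℚ)
        ≡⟨ cong (fixedPoint X +_) (sum-insert (λ _ → bounded completionsℚ) X) ⟩
      fixedPoint X + (sumNew (bounded completionsℚ) X + sumBury (bounded completionsℚ) X) ∎

    step : Lattice ℓ → Lattice ℓ
    step c y = shiftsFrom ℤ.suc 0 c y + shiftsFrom ℤ.pred 0 c y

    -- Of the coordinates 0 to `k`, all but the last collide with their right neighbour when raised
    -- and may be left out.
    raise-collapse : ∀ {k i} {c : Lattice ℓ} y → (∀ i → Alternating i c) → suc k ℕ.≤ ℓ →
      Staircase 0 (suc k) y → i ℕ.≤ k → shiftsFrom ℤ.suc 0 c y ≡ shiftsFrom ℤ.suc i c y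
    raise-collapse {i = zero}  y alt k<ℓ st p = refl
    raise-collapse {k} {i = suc i} {c} y alt k<ℓ st p = begin
      shiftsFrom ℤ.suc 0 c y                            ≡⟨ raise-collapse y alt k<ℓ st (ℕ.<⇒≤ p) ⟩
      shiftsFrom ℤ.suc i c y                            ≡⟨ shiftsFrom-split ℤ.suc i c y ⟩
      shift ℤ.suc i c y + shiftsFrom ℤ.suc (suc i) c y
        ≡⟨ cong (_+ shiftsFrom ℤ.suc (suc i) c y)
             (shift-suc-collision y (ℕ.≤-trans (s≤s p) k<ℓ) (alt i) (staircase-mono y (s≤s p) st)) ⟩
      0ℚ + shiftsFrom ℤ.suc (suc i) c y                 ≡⟨ ℚ.+-identityˡ _ ⟩
      shiftsFrom ℤ.suc (suc i) c y                      ∎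

    raise-all : ∀ k {c : Lattice ℓ} y → k ℕ.≤ ℓ → (∀ i → Alternating i c) → Staircase 0 k y →
      shiftsFrom ℤ.suc 0 c y ≡ activate k c y + raiseActive k c y
    raise-all zero        y le alt st = sym (ℚ.+-identityˡ _)
    raise-all (suc k) {c} y le alt st =
      trans (raise-collapse y alt le st ℕ.≤-refl) (shiftsFrom-split ℤ.suc k c y)

    lower-collapse : ∀ {k i} {c : Lattice ℓ} y → (∀ i → Alternating i c) →
      Staircase 0 (suc k) y → i ℕ.≤ k → shiftsFrom ℤ.pred 1 c y ≡ shiftsFrom ℤ.pred (suc i) c y
    lower-collapse {i = zero}  y alt st p = refl
    lower-collapse {k} {i = suc i} {c} y alt st p = begin
      shiftsFrom ℤ.pred 1 c y                            ≡⟨ lower-collapse y alt st (ℕ.<⇒≤ p) ⟩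
      shiftsFrom ℤ.pred (suc i) c y                      ≡⟨ shiftsFrom-split ℤ.pred (suc i) c y ⟩
      shift ℤ.pred (suc i) c y + shiftsFrom ℤ.pred (suc (suc i)) c y
        ≡⟨ cong (_+ shiftsFrom ℤ.pred (suc (suc i)) c y)
             (shift-pred-collision y (alt i) (staircase-mono y (s≤s p) st)) ⟩
      0ℚ + shiftsFrom ℤ.pred (suc (suc i)) c y           ≡⟨ ℚ.+-identityˡ _ ⟩
      shiftsFrom ℤ.pred (suc (suc i)) c y                ∎

    -- The inactive coordinates after the first collide with their left neighbour. The first goes
    -- from 0 to -1, which `mirror` sends back to 0; this leaves the summand `c y`.
    lower-all : ∀ k {c : Lattice ℓ} y → suc k ℕ.≤ ℓ → (∀ i → Alternating i c) → Mirrored c →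
      Staircase 0 (suc k) y → shiftsFrom ℤ.pred 0 c y ≡ c y + lowerActive (suc k) c y
    lower-all k {c} y le alt mir st = begin
      shiftsFrom ℤ.pred 0 c y                       ≡⟨ shiftsFrom-split ℤ.pred 0 c y ⟩
      shift ℤ.pred 0 c y + shiftsFrom ℤ.pred 1 c y
          ≡⟨ cong₂ _+_ (first y le mir st) (lower-collapse y alt st ℕ.≤-refl) ⟩
      c y + lowerActive (suc k) c y                 ∎
      where
      first : ∀ {n} {c : Lattice n} y → suc k ℕ.≤ n → Mirrored c → Staircase 0 (suc k) y →
          shift ℤ.pred 0 c y ≡ c y
      first (y ∷ ys) le mir (refl , st) = mir (ℤ.+ 0 ∷ ys)

    weight-agree : ∀ (X : Vec Slot m) {c c′} → (∀ y → Staircase 0 (inactive X) y → c y ≡ c′ y) →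
        weight X c ≡ weight X c′
    weight-agree X {c} {c′} eq = begin
      weight X c                                        ≡⟨ weight-cong X
          (λ y → solve 2 (λ a b → a := (a :+ :- b) :+ b) refl (c y) (c′ y)) ⟩
      weight X (λ y → (c y + - c′ y) + c′ y)            ≡⟨ weight-+ X _ c′ ⟩
      weight X (λ y → c y + - c′ y) + weight X c′
        ≡⟨ cong (_+ weight X c′) (weight-vanishes X λ y st →
            trans (cong (_+ - c′ y) (eq y st)) (ℚ.+-inverseʳ (c′ y))) ⟩
      0ℚ + weight X c′                                  ≡⟨ ℚ.+-identityˡ _ ⟩
      weight X c′                                       ∎

    weight-zero : ∀ (X : Vec Slot m) {c} → (∀ y → c y ≡ 0ℚ) → weight X c ≡ 0ℚ
    weight-zero X eq = weight-vanishes X (λ y _ → eq y)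

    activate-0 : ∀ {k} c → k ≡ 0 → ∀ y → activate k c y ≡ 0ℚ
    activate-0 c refl y = refl

    weight-excess : ∀ (X : Vec Slot m) {c} → ℓ ℕ.< tops X → weight X c ≡ 0ℚ
    weight-excess (free   ∷ X) p = weight-excess X p
    weight-excess (buried ∷ X) p = weight-excess X p
    weight-excess (top    ∷ X) {c} (s≤s p) = weight-zero X (activate-0 c (ℕ.m≤n⇒m∸n≡0 p))

    record Symmetric (c : Lattice ℓ) : Set where
      field
        alternating : ∀ i → Alternating i c
        mirrored    : Mirrored c
    open Symmetric

    module _ (X : Vec Slot m) {c : Lattice ℓ} (sym-c : Symmetric c) where
      private
        w = weight X c
        u = newWeight X c + buryWeight X c
        wb = weight (buried ∷ X) c
        wt = weight (top ∷ X) c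

      weight-raise : weight X (shiftsFrom ℤ.suc 0 c) ≡ wt + wb
      weight-raise = trans
        (weight-agree X λ y st → raise-all (inactive X) y (ℕ.m∸n≤m ℓ (tops X)) (alternating sym-c) st)
        (weight-+ X _ _)

      weight-lower : tops X ℕ.< ℓ → weight X (shiftsFrom ℤ.pred 0 c) ≡ w + u
      weight-lower lt = begin
        weight X (shiftsFrom ℤ.pred 0 c)
          ≡⟨ weight-agree X (λ y st →
              subst (λ k → shiftsFrom ℤ.pred 0 c y ≡ c y + lowerActive k c y) (sym k-eq)
               (lower-all (ℓ ∸ suc (tops X)) y (subst (ℕ._≤ ℓ) k-eq (ℕ.m∸n≤m ℓ (tops X)))
                 (alternating sym-c) (mirrored sym-c) (subst (λ k → Staircase 0 k y) k-eq st))) ⟩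
        weight X (λ y → c y + lowerActive (inactive X) c y)
          ≡⟨ weight-+ X c _ ⟩
        w + weight X (lowerActive (inactive X) c)
          ≡⟨ cong (w +_) (new+bury X c (ℕ.<⇒≤ lt) (λ i _ → alternating sym-c i)) ⟨
        w + u ∎
        where
        k-eq : inactive X ≡ suc (ℓ ∸ suc (tops X))
        k-eq = ℕ.+-∸-assoc 1 lt

      -- With more than ℓ piles everything is 0. With fewer than ℓ, the reflected summand of
      -- `lower-all` pays for the fixed point. With exactly ℓ every coordinate is active, so there
      -- is neither a reflected summand nor a fixed point.
      weight-step : ∀ (g : Vec Slot m → ℚ) →
        weight X (step c) * g X ≡
        (w * (if tops X <ᵇ ℓ then g X else 0ℚ) + u * bounded g X) + (wb * g X + wt * g X)
      weight-step g with tops X ≤ᵇ ℓ | ℕ.≤ᵇ-reflects-≤ (tops X) ℓ | tops X <ᵇ ℓ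
          | ℕ.<ᵇ-reflects-< (tops X) ℓ
      ... | false | ofⁿ ≰ | true | ofʸ lt = ⊥-elim (≰ (ℕ.<⇒≤ lt))
      ... | false | ofⁿ ≰ | false | _ = begin
        weight X (step c) * g X
          ≡⟨ cong (_* g X) (weight-excess X {step c} exc) ⟩
        0ℚ * g X
          ≡⟨ solve 3 (λ w u g → con 0ℚ :* g := (w :* con 0ℚ :+ u :* con 0ℚ) :+
              (con 0ℚ :* g :+ con 0ℚ :* g)) refl w u (g X) ⟩
        (w * 0ℚ + u * 0ℚ) + (0ℚ * g X + 0ℚ * g X)
          ≡⟨ cong₂ (λ p q → (w * 0ℚ + u * 0ℚ) + (p * g X + q * g X))
               (weight-excess X {raiseActive (inactive X) c} exc)
                   (weight-excess X {activate (inactive X) c} exc) ⟨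
        (w * 0ℚ + u * 0ℚ) + (wb * g X + wt * g X) ∎
        where
        open +-*-Solver using (con)
        exc : ℓ ℕ.< tops X
        exc = ℕ.≰⇒> ≰
      ... | true | ofʸ le | true | ofʸ lt = begin
        weight X (step c) * g X
          ≡⟨ cong (_* g X) (trans (weight-+ X _ _) (cong₂ _+_ weight-raise (weight-lower lt))) ⟩
        ((wt + wb) + (w + u)) * g X
          ≡⟨ solve 5 (λ w u b t g → ((t :+ b) :+ (w :+ u)) :* g := (w :* g :+ u :* g) :+
              (b :* g :+ t :* g))
               refl w u wb wt (g X) ⟩
        (w * g X + u * g X) + (wb * g X + wt * g X) ∎
      ... | true | ofʸ le | false | ofⁿ ≮ = begin
        weight X (step c) * g X
          ≡⟨ cong (_* g X) (trans (weight-+ X _ _) (cong₂ _+_ weight-raise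
               (trans (cong (λ k → weight X (shiftsFrom ℤ.pred k c)) (sym (ℕ.m≤n⇒m∸n≡0 (ℕ.≮⇒≥ ≮))))
                      (sym (new+bury X c le (λ i _ → alternating sym-c i)))))) ⟩
        ((wt + wb) + u) * g X
          ≡⟨ solve 5 (λ w u b t g → ((t :+ b) :+ u) :* g := (w :* con 0ℚ :+ u :* g) :+
              (b :* g :+ t :* g))
               refl w u wb wt (g X) ⟩
        (w * 0ℚ + u * g X) + (wb * g X + wt * g X) ∎
        where open +-*-Solver using (con)

    -- Once the adjoints have moved the insertions onto the weights, both sides agree word by word.
    -- The pile bound needs no separate argument here, as it is part of the function `g` to which
    -- the adjoints are applied.
    sumWords-step : ∀ m {c} → Symmetric c →
      sumWords (suc m) (λ X → weight X c * completionsℚ X) ≡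
      sumWords m (λ X → weight X (step c) * completionsℚ X)
    sumWords-step m {c} sym-c = begin
      sumWords m (λ X → weight X c * completionsℚ (free ∷ X)) + (sb + st)
        ≡⟨ cong (_+ (sb + st)) (begin
             sumWords m (λ X → weight X c * completionsℚ (free ∷ X))
               ≡⟨ sumWords-cong m (λ X → trans (cong (weight X c *_) (completions-free X))
                    (solve 4 (λ w f n b → w :* (f :+ (n :+ b)) := w :* f :+ (w :* n :+ w :* b)) refl
                      (weight X c) (fixedPoint X) (sumNew g X) (sumBury g X))) ⟩
             sumWords m (λ X → weight X c * fixedPoint X + (weight X c * sumNew g X + weight X c
                 * sumBury g X))
               ≡⟨ trans (sumWords-+ m _ _) (cong (sf +_) (sumWords-+ m _ _)) ⟩
             sf + (sumWords m (λ X → weight X c * sumNew g X) + sumWords m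
                 (λ X → weight X c * sumBury g X))
               ≡⟨ cong (sf +_) (trans (cong₂ _+_ (sumNew-adjoint m (λ _ → c) g)
                   (sumBury-adjoint m (λ _ → c) g))
                    (trans (sym (sumWords-+ m _ _))
                      (sumWords-cong m λ X → sym (ℚ.*-distribʳ-+ (g X) (newWeight X c)
                          (buryWeight X c))))) ⟩
             sf + sumWords m (λ X → (newWeight X c + buryWeight X c) * g X)
               ≡⟨ sumWords-+ m _ _ ⟨
             sumWords m (λ X → weight X c * fixedPoint X + (newWeight X c + buryWeight X c) * g X) ∎) ⟩
      sumWords m (λ X → weight X c * fixedPoint X + (newWeight X c + buryWeight X c) * g X) + (sb + st)
        ≡⟨ trans (cong (sumWords m (λ X → weight X c * fixedPoint X
            + (newWeight X c + buryWeight X c) * g X) +_) (sym (sumWords-+ m _ _)))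
            (sym (sumWords-+ m _ _)) ⟩
      sumWords m (λ X → (weight X c * fixedPoint X + (newWeight X c + buryWeight X c) * g X) +
                        (weight (buried ∷ X) c * completionsℚ X + weight (top ∷ X) c * completionsℚ X))
        ≡⟨ sumWords-cong m (λ X → weight-step X sym-c completionsℚ) ⟨
      sumWords m (λ X → weight X (step c) * completionsℚ X) ∎
      where
      g = bounded completionsℚ
      sf = sumWords m (λ X → weight X c * fixedPoint X)
      sb = sumWords m (λ X → weight (buried ∷ X) c * completionsℚ X)
      st = sumWords m (λ X → weight (top ∷ X) c * completionsℚ X)

    step-symmetric : ∀ {c} → Symmetric c → Symmetric (step c)
    step-symmetric {c} sym-c = record
      { alternating = λ i {y} sw → trans
          (cong₂ _+_ (shiftsFrom-alternating ℤ.suc z≤n (alternating sym-c i) sw)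
                     (shiftsFrom-alternating ℤ.pred z≤n (alternating sym-c i) sw))
          (sym (ℚ.neg-distrib-+ (shiftsFrom ℤ.suc 0 c y) (shiftsFrom ℤ.pred 0 c y)))
      ; mirrored = step-mirrored (mirrored sym-c)
      }
      where
      step-mirrored : ∀ {n} {c : Lattice n} → Mirrored c → Mirrored
          (λ y → shiftsFrom ℤ.suc 0 c y + shiftsFrom ℤ.pred 0 c y)
      step-mirrored mir [] = refl
      step-mirrored {c = c} mir (y ∷ ys) = begin
        (c (ℤ.suc (mirror y) ∷ ys) + shiftsFrom ℤ.suc 0 (c ∘ (mirror y ∷_)) ys) +
        (c (ℤ.pred (mirror y) ∷ ys) + shiftsFrom ℤ.pred 0 (c ∘ (mirror y ∷_)) ys)
          ≡⟨ cong₂ _+_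
               (cong₂ _+_ (trans (cong (λ z → c (z ∷ ys)) (suc-mirror y)) (mir (ℤ.pred y ∷ ys)))
                          (shiftsFrom-cong ℤ.suc 0 (λ zs → mir (y ∷ zs)) ys))
               (cong₂ _+_ (trans (cong (λ z → c (z ∷ ys)) (pred-mirror y)) (mir (ℤ.suc y ∷ ys)))
                          (shiftsFrom-cong ℤ.pred 0 (λ zs → mir (y ∷ zs)) ys)) ⟩
        (c (ℤ.pred y ∷ ys) + shiftsFrom ℤ.suc 0 (c ∘ (y ∷_)) ys) +
        (c (ℤ.suc y ∷ ys) + shiftsFrom ℤ.pred 0 (c ∘ (y ∷_)) ys)
          ≡⟨ solve 4 (λ p s u v → (p :+ s) :+ (u :+ v) := (u :+ s) :+ (p :+ v)) refl
              (c (ℤ.pred y ∷ ys)) _ (c (ℤ.suc y ∷ ys)) _ ⟩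
        (c (ℤ.suc y ∷ ys) + shiftsFrom ℤ.suc 0 (c ∘ (y ∷_)) ys) +
        (c (ℤ.pred y ∷ ys) + shiftsFrom ℤ.pred 0 (c ∘ (y ∷_)) ys) ∎

    step-cong : ∀ {c c′} → c ≗ c′ → step c ≗ step c′
    step-cong eq y = cong₂ _+_ (shiftsFrom-cong ℤ.suc 0 eq y) (shiftsFrom-cong ℤ.pred 0 eq y)

    steps : ℕ → Lattice ℓ → Lattice ℓ
    steps zero    c = c
    steps (suc n) c = steps n (step c)

    steps-cong : ∀ n {c c′} → c ≗ c′ → steps n c ≗ steps n c′
    steps-cong zero    eq = eq
    steps-cong (suc n) eq = steps-cong n (step-cong eq)

    sumWords-steps : ∀ n {c} → Symmetric c →
      sumWords n (λ X → weight X c * completionsℚ X) ≡ steps n c δ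
    sumWords-steps zero    {c} sym-c = trans (cong (c δ *_) fromℕ-1) (ℚ.*-identityʳ (c δ))
    sumWords-steps (suc n) {c} sym-c = trans (sumWords-step n sym-c)
        (sumWords-steps n (step-symmetric sym-c))

    δ-above : Above 0 δ
    δ-above = from ℓ 0
      where
      from : ∀ n s → Above s (tabulate {n = n} (λ j → ℤ.+ (s ℕ.+ toℕ j)))
      from zero    s = tt
      from (suc n) s = ℤ.+≤+ (ℕ.m≤m+n s 0) ,
        subst (Above (suc s)) (Vec.tabulate-cong (λ j → cong ℤ.+_ (sym (ℕ.+-suc s (toℕ j)))))
            (from n (suc s))

    weight-above-zero : ∀ (X : Vec Slot m) {c} → (∀ y → Above 0 y → c y ≡ 0ℚ) → weight X c ≡ 0ℚ
    weight-above-zero []           v = v δ δ-above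
    weight-above-zero (free   ∷ X) v = weight-above-zero X v
    weight-above-zero (buried ∷ X) v = weight-above-zero X (shiftsFrom-above-zero (inactive X) v)
    weight-above-zero (top    ∷ X) {c} v = weight-above-zero X (activate-above (inactive X))
      where
      activate-above : ∀ k y → Above 0 y → activate k c y ≡ 0ℚ
      activate-above zero    y ab = refl
      activate-above (suc k) y ab = shift-above-zero k v y ab

    Extremal : Lattice ℓ → Set
    Extremal c = ∀ k y → Above 0 y → shift ℤ.suc k c y ≡ 0ℚ

    -- A letter other than free raises some coordinate or has none to raise, and further letters
    -- only raise; starting from δ, the weight is 0 in either case.
    sumWords-extremal : ∀ m {c} → Extremal c →
      sumWords m (λ X → weight X c * completionsℚ X) ≡ c δ * completionsℚ (replicate m free)
    sumWords-extremal m {c} ext = go m completionsℚ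
      where
      shiftsFrom-zero : ∀ d k → k ℕ.+ d ≡ ℓ → ∀ y → Above 0 y → shiftsFrom ℤ.suc k c y ≡ 0ℚ
      shiftsFrom-zero zero    k eq y ab =
        shiftsFrom-empty ℤ.suc k c y (ℕ.≤-reflexive (trans (sym eq) (ℕ.+-identityʳ k)))
      shiftsFrom-zero (suc d) k eq y ab = trans (shiftsFrom-split ℤ.suc k c y)
        (cong₂ _+_ (ext k y ab) (shiftsFrom-zero d (suc k) (trans (sym (ℕ.+-suc k d)) eq) y ab))
      activate-zero : ∀ k y → Above 0 y → activate k c y ≡ 0ℚ
      activate-zero zero    y ab = refl
      activate-zero (suc k) y ab = ext k y ab
      times-zero : ∀ {p} q → p ≡ 0ℚ → p * q ≡ 0ℚ
      times-zero q refl = ℚ.*-zeroˡ q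
      go : ∀ m (g : Vec Slot m → ℚ) → sumWords m (λ X → weight X c * g X) ≡ c δ * g (replicate m free)
      go zero    g = refl
      go (suc m) g = trans (cong₂ _+_ (go m (g ∘ (free ∷_))) (cong₂ _+_
        (sumWords-zero m λ X → times-zero (g (buried ∷ X)) (weight-above-zero X
          (shiftsFrom-zero (ℓ ∸ inactive X) (inactive X) (ℕ.m+[n∸m]≡n (ℕ.m∸n≤m ℓ (tops X))))))
        (sumWords-zero m λ X → times-zero (g (top ∷ X)) (weight-above-zero X
            (activate-zero (inactive X))))))
        (ℚ.+-identityʳ _)

    completions-steps : ∀ n {c} → Symmetric c → Extremal c → c δ ≡ 1ℚ →
      completionsℚ (replicate n free) ≡ steps n c δ
    completions-steps n {c} sym-c ext one = begin
      completionsℚ (replicate n free)                ≡⟨ ℚ.*-identityˡ _ ⟨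
      1ℚ * completionsℚ (replicate n free)           ≡⟨ cong (_* completionsℚ (replicate n free)) one ⟨
      c δ * completionsℚ (replicate n free)          ≡⟨ sumWords-extremal n ext ⟨
      sumWords n (λ X → weight X c * completionsℚ X) ≡⟨ sumWords-steps n sym-c ⟩
      steps n c δ                                    ∎

open Recurrence

-- Descending subsequences

module Descending where
  open ≡ using (refl; sym; trans; cong; subst)
  open import Data.Nat.Base using (_+_; _*_; _≤_; _<_; _⊔_)

  module Descents {n} (f : Fin n → Fin n) where

    private variable
      r k j b p q : ℕ

    -- Descending subsequences of length r at positions < j (resp. ≥ j) with values ≥ b (resp. < b).
    data Before : ℕ → ℕ → ℕ → Set where
      []   : Before 0 j b
      snoc : ∀ i → toℕ i < j → b ≤ toℕ (f i) → Before r (toℕ i) (suc (toℕ (f i))) → Before (suc r) j b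

    data After : ℕ → ℕ → ℕ → Set where
      []   : After 0 j b
      cons : ∀ i → j ≤ toℕ i → toℕ (f i) < b → After r (suc (toℕ i)) (toℕ (f i)) → After (suc r) j b

    before-weaken : j ≤ p → q ≤ b → Before r j b → Before r p q
    before-weaken le le′ []             = []
    before-weaken le le′ (snoc i x y c) = snoc i (ℕ.≤-trans x le) (ℕ.≤-trans le′ y) c

    after-weaken : p ≤ j → b ≤ q → After r j b → After r p q
    after-weaken le le′ []             = []
    after-weaken le le′ (cons i x y c) = cons i (ℕ.≤-trans le x) (ℕ.≤-trans y le′) c

    after-rest : After (suc r) p q → After r p q
    after-rest (cons i x y c) = after-weaken (ℕ.<⇒≤ (s≤s x)) (ℕ.<⇒≤ y) c

    -- Everything before the cut has position below `j` and value at least `b`, everything after it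
    -- the opposite, so the two parts fit together.
    join : ∀ r → Before r j b → After k j b → After (r + k) 0 n
    join zero    []             []             = []
    join zero    []             (cons i x y c) = cons i z≤n (Fin.toℕ<n (f i)) c
    join {k = k} (suc r) (snoc i x y c) d = subst (λ k → After k 0 n) (ℕ.+-suc r k)
      (join r c (cons i ℕ.≤-refl ℕ.≤-refl (after-weaken x y d)))

    split : ∀ r {s} → Before s p q → After (r + k) p q → ∃[ p′ ] ∃[ q′ ]
        (Before (r + s) p′ q′ × After k p′ q′)
    split zero    c d              = _ , _ , c , d
    split (suc r) {s} c (cons i x y d) =
      let p′ , q′ , c′ , d′ = split r (snoc i ℕ.≤-refl ℕ.≤-refl (before-weaken x y c)) d
      in p′ , q′ , subst (λ k → Before k p′ q′) (ℕ.+-suc r s) c′ , d′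

    module _ (inv : ∀ i → f (f i) ≡ i) where

      -- Transposition of the points (i, f i): it preserves the graph of an involution and reverses
      -- the order along a descending sequence.
      reflect-before : Before r j b → After r b j
      reflect-before [] = []
      reflect-before {j = j} (snoc i x y c) = cons (f i) y (subst (_< j) (cong toℕ (sym (inv i))) x)
        (subst (After _ (suc (toℕ (f i)))) (cong toℕ (sym (inv i))) (reflect-before c))

      reflect-after : After r j b → Before r b j
      reflect-after [] = []
      reflect-after {j = j} (cons i x y c) = snoc (f i) y (subst (j ≤_) (cong toℕ (sym (inv i))) x)
        (subst (λ k → Before _ (toℕ (f i)) (suc k)) (cong toℕ (sym (inv i))) (reflect-after c))

    -- In an involution the arcs covering the middle of a descending subsequence are nested,
    -- which makes the bound on descending subsequences a condition on each prefix.
    Local : ℕ → Fin n → Set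
    Local ℓ i = (toℕ i < toℕ (f i) → ¬ Before (suc ℓ) (suc (toℕ i)) (suc (toℕ i))) ×
                (f i ≡ i → ¬ Before ℓ (toℕ i) (suc (toℕ i)))

    length-eq : ∀ ℓ → ℓ + suc ℓ ≡ suc (2 * ℓ)
    length-eq ℓ = trans (ℕ.+-suc ℓ ℓ) (cong (λ k → suc (ℓ + k)) (sym (ℕ.+-identityʳ ℓ)))

    -- A sequence of ℓ + 1 open arcs and its transpose join to length 2ℓ + 2, one more than
    -- required. Around a fixed point the length is exactly ℓ + 1 + ℓ.
    no-descent⇒local : ∀ {ℓ} → (∀ i → f (f i) ≡ i) → ¬ After (suc (2 * ℓ)) 0 n → ∀ i → Local ℓ i
    no-descent⇒local {ℓ} inv ¬d i =
      (λ _ c → ¬d (subst (λ k → After k 0 n) (length-eq ℓ) (after-rest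
          (join (suc ℓ) c (reflect-before inv c))))) ,
      (λ fix c → ¬d (subst (λ k → After k 0 n) (length-eq ℓ) (join ℓ c (cons i ℕ.≤-refl
        (subst (λ k → toℕ k < suc (toℕ i)) (sym fix) ℕ.≤-refl)
        (subst (λ k → After ℓ (suc (toℕ i)) (toℕ k)) (sym fix) (reflect-before inv c))))))

    -- The middle element decides. If it begins an arc, it and the ℓ elements before it are arcs
    -- open just after its position; if it is fixed, the ℓ elements before it pass over it; if it
    -- ends an arc, it and the ℓ elements after it are transposed first.
    local⇒no-descent : ∀ {ℓ} → (∀ i → f (f i) ≡ i) → (∀ i → Local ℓ i) → ¬ After (suc (2 * ℓ)) 0 n
    local⇒no-descent {ℓ} inv local d
      with split ℓ {0} [] (subst (λ k → After k 0 n) (sym (length-eq ℓ)) d)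
    ... | p , q , c , d@(cons i x y _) rewrite ℕ.+-identityʳ ℓ with ℕ.<-cmp (toℕ i) (toℕ (f i))
    ... | tri< lt _ _ = proj₁ (local i) lt (snoc i ℕ.≤-refl lt (before-weaken x y c))
    ... | tri≈ _ eq _ = proj₂ (local i) (sym (Fin.toℕ-injective eq))
                          (before-weaken x (subst (λ k → suc k ≤ q) (sym eq) y) c)
    local⇒no-descent {ℓ} inv local d | p , q , c , cons i x y e | tri> _ _ gt =
      proj₁ (local (f i)) (subst (λ k → toℕ (f i) < toℕ k) (sym (inv i)) gt)
        (before-weaken ℕ.≤-refl gt (reflect-after inv (cons {j = toℕ i} i ℕ.≤-refl ℕ.≤-refl e)))

  module _ {n} (τ : Vec (Fin n) n) where
    open Descents (lookup τ)

    private
      Starts : ∀ {k} → ℕ → ℕ → Vec (Fin n) k → Set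
      Starts p q []      = ⊤
      Starts p q (i ∷ _) = p ≤ toℕ i × toℕ (lookup τ i) < q

      fromVec : ∀ {k p q} (ι : Vec (Fin n) k) → Starts p q ι → IsDescending τ ι → After k p q
      fromVec []          _       _                        = []
      fromVec (i ∷ [])    (x , y) _                        = cons i x y []
      fromVec (i ∷ j ∷ ι) (x , y) (lt ∷ lts , gt ∷ gts) = cons i x y
          (fromVec (j ∷ ι) (lt , gt) (lts , gts))

      toVec : ∀ {k p q} → After k p q → ∃[ ι ] (Starts {k} p q ι × IsDescending τ ι)
      toVec [] = [] , tt , [] , []
      toVec (cons i x y c) with toVec c
      ... | []    , _       , _         = i ∷ [] , (x , y) , [-] , [-]
      ... | j ∷ ι , (u , v) , lts , gts = i ∷ j ∷ ι , (x , y) , u ∷ lts , v ∷ gts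

    hasDescending⇒after : ∀ {k} → HasDescending k τ → After k 0 n
    hasDescending⇒after ([]    , d) = []
    hasDescending⇒after (i ∷ ι , d) = fromVec (i ∷ ι) (z≤n , Fin.toℕ<n _) d

    after⇒hasDescending : ∀ {k} → After k 0 n → HasDescending k τ
    after⇒hasDescending c = let ι , _ , d = toVec c in ι , d

  -- Pile counts under insertion

  private variable
    m : ℕ

  -- By `chain` and `chain⁻¹` below, this is the greatest length of a descending sequence of open
  -- arcs with right ends at offset `c` or later.
  topsFrom : ℕ → Vec Slot m → ℕ
  topsFrom zero    X       = tops X
  topsFrom (suc c) []      = 0
  topsFrom (suc c) (_ ∷ X) = topsFrom c X

  push-tail : ∀ x (p : Bool × Vec Slot m) → Vec.tail (proj₂ (push x p)) ≡ proj₂ p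
  push-tail free   (β , Y)     = refl
  push-tail buried (β , Y)     = refl
  push-tail top    (false , Y) = refl
  push-tail top    (true , Y)  = refl

  push-head : ∀ x (p : Bool × Vec Slot m) → isFree (Vec.head (proj₂ (push x p))) ≡ isFree x
  push-head free   (β , Y)     = refl
  push-head buried (β , Y)     = refl
  push-head top    (false , Y) = refl
  push-head top    (true , Y)  = refl

  topsFrom-suc : ∀ c (Y : Vec Slot (suc m)) → topsFrom (suc c) Y ≡ topsFrom c (Vec.tail Y)
  topsFrom-suc c (_ ∷ Y) = refl

  lookup-suc : ∀ (Y : Vec Slot (suc m)) i → lookup Y (suc i) ≡ lookup (Vec.tail Y) i
  lookup-suc (_ ∷ Y) i = refl

  lookup-zero : ∀ (Y : Vec Slot (suc m)) → lookup Y zero ≡ Vec.head Y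
  lookup-zero (_ ∷ Y) = refl

  -- If the flag is true, a top left of `b` is buried: the count stays and exceeds that behind `b`.
  -- If it is false, all tops are behind `b` and the new one is extra. Either way the new count is a
  -- maximum.
  insert-tops-cases : ∀ (b : Fin m) X → lookup X b ≡ free →
    (if proj₁ (insert b X)
     then (tops (proj₂ (insert b X)) ≡ tops X × topsFrom (suc (toℕ b)) X < tops X)
     else (tops (proj₂ (insert b X)) ≡ suc (topsFrom (suc (toℕ b)) X) × tops X
         ≡ topsFrom (suc (toℕ b)) X))
  insert-tops-cases zero (free ∷ X) eq = refl , refl
  insert-tops-cases (suc b) (x ∷ X) eq with insert b X | insert-tops-cases b X eq
  insert-tops-cases (suc b) (free   ∷ X) eq | false , Y | p = p
  insert-tops-cases (suc b) (free   ∷ X) eq | true  , Y | p = p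
  insert-tops-cases (suc b) (buried ∷ X) eq | false , Y | p = p
  insert-tops-cases (suc b) (buried ∷ X) eq | true  , Y | p = p
  insert-tops-cases (suc b) (top    ∷ X) eq | false , Y | p , q =
    trans p (cong suc (sym q)) , s≤s (ℕ.≤-reflexive (sym q))
  insert-tops-cases (suc b) (top    ∷ X) eq | true  , Y | p , q = cong suc p , ℕ.m≤n⇒m≤1+n q

  insert-tops : ∀ (b : Fin m) X → lookup X b ≡ free →
    tops (proj₂ (insert b X)) ≡ tops X ⊔ suc (topsFrom (suc (toℕ b)) X)
  insert-tops b X eq with proj₁ (insert b X) | insert-tops-cases b X eq
  ... | true  | p , q = trans p (sym (ℕ.m≥n⇒m⊔n≡m q))
  ... | false | p , q = trans p (sym (ℕ.m≤n⇒m⊔n≡n (ℕ.m≤n⇒m≤1+n (ℕ.≤-reflexive q))))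

  -- The recurrence of longest descending sequences: the new entry is left out, or it comes last
  -- after entries with larger values.
  insert-topsFrom-≤ : ∀ {c} (b : Fin m) X → lookup X b ≡ free → c ≤ toℕ b →
    topsFrom c (proj₂ (insert b X)) ≡ topsFrom c X ⊔ suc (topsFrom (suc (toℕ b)) X)
  insert-topsFrom-≤ {c = zero}  b       X       eq le       = insert-tops b X eq
  insert-topsFrom-≤ {c = suc c} (suc b) (x ∷ X) eq (s≤s le) =
    trans (topsFrom-suc c (proj₂ (push x (insert b X))))
      (trans (cong (topsFrom c) (push-tail x (insert b X))) (insert-topsFrom-≤ b X eq le))

  insert-topsFrom-> : ∀ {c} (b : Fin m) X → toℕ b < c →
    topsFrom c (proj₂ (insert b X)) ≡ topsFrom c X
  insert-topsFrom-> {c = suc c} zero    (x ∷ X) _        = refl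
  insert-topsFrom-> {c = suc c} (suc b) (x ∷ X) (s≤s lt) =
    trans (topsFrom-suc c (proj₂ (push x (insert b X))))
      (trans (cong (topsFrom c) (push-tail x (insert b X))) (insert-topsFrom-> b X lt))

  insert-here : ∀ (b : Fin m) X → isFree (lookup (proj₂ (insert b X)) b) ≡ false
  insert-here zero    (x ∷ X) = refl
  insert-here (suc b) (x ∷ X) =
    trans (cong isFree (trans (lookup-suc (proj₂ (push x (insert b X))) b)
                              (cong (λ Y → lookup Y b) (push-tail x (insert b X)))))
          (insert-here b X)

  insert-elsewhere : ∀ (b i : Fin m) X → i ≢ b → isFree (lookup (proj₂ (insert b X)) i)
      ≡ isFree (lookup X i)
  insert-elsewhere zero    zero    X       i≢b = ⊥-elim (i≢b refl)
  insert-elsewhere zero    (suc i) (x ∷ X) i≢b = refl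
  insert-elsewhere (suc b) zero    (x ∷ X) i≢b =
    trans (cong isFree (lookup-zero (proj₂ (push x (insert b X))))) (push-head x (insert b X))
  insert-elsewhere (suc b) (suc i) (x ∷ X) i≢b =
    trans (cong isFree (trans (lookup-suc (proj₂ (push x (insert b X))) i)
                              (cong (λ Y → lookup Y i) (push-tail x (insert b X)))))
          (insert-elsewhere b i X (i≢b ∘ cong suc))

open Descending

-- Reading an involution from left to right

module Reading where
  open ≡ using (refl; sym; trans; cong; cong₂; subst; subst₂; module ≡-Reasoning)
  open import Data.Nat.Base using (_+_; _*_; _≤_; _<_)
  open ≡-Reasoning

  private variable
    m : ℕ

  true≢false : true ≢ false
  true≢false ()

  module Automaton (ℓ n : ℕ) where
    open Completions ℓ using (completions)

    predecessor : Maybe (Fin (suc m)) → Maybe (Fin m)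
    predecessor nothing        = nothing
    predecessor (just zero)    = nothing
    predecessor (just (suc b)) = just b

    -- The remaining positions ι 0, ι 1, … have inverse ρ; a remaining position which is not free
    -- is the right end of an arc, whose left end is given by d.
    accept : (ι : Fin m → Fin n) (ρ : Fin n → Maybe (Fin m)) (d : Fin m → Fin n) →
             Vec Slot m → Vec (Fin n) m → Bool
    choose : (ι : Fin (suc m) → Fin n) (ρ : Fin n → Maybe (Fin (suc m))) (d : Fin (suc m) → Fin n) →
             Vec Slot m → Vec (Fin n) m → Fin (suc m) → Bool

    accept ι ρ d []           []      = true
    accept ι ρ d (free   ∷ X) (v ∷ s) = maybe′ (choose ι ρ d X s) false (ρ v)
    accept ι ρ d (buried ∷ X) (v ∷ s) = does (v Fin.≟ d zero)
        ∧ accept (ι ∘ suc) (predecessor ∘ ρ) (d ∘ suc) X s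
    accept ι ρ d (top    ∷ X) (v ∷ s) = does (v Fin.≟ d zero)
        ∧ accept (ι ∘ suc) (predecessor ∘ ρ) (d ∘ suc) X s

    choose ι ρ d X s zero    = (tops X <ᵇ ℓ) ∧ accept (ι ∘ suc) (predecessor ∘ ρ) (d ∘ suc) X s
    choose ι ρ d X s (suc b) = isFree (lookup X b) ∧ ((tops Y ≤ᵇ ℓ) ∧
      accept (ι ∘ suc) (predecessor ∘ ρ) (Vector.updateAt (d ∘ suc) b (const (ι zero))) Y s)
      where Y = proj₂ (insert b X)

    count : ∀ k → (Vec (Fin n) k → Bool) → ℕ
    count zero    p = if p [] then 1 else 0
    count (suc k) p = Σℕ.sum λ v → count k (p ∘ (v ∷_))

    count-cong : ∀ k {p q : Vec (Fin n) k → Bool} → p ≗ q → count k p ≡ count k q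
    count-cong zero    eq = cong (if_then 1 else 0) (eq [])
    count-cong (suc k) eq = Σℕ.sum-cong-≗ λ v → count-cong k (eq ∘ (v ∷_))

    count-false : ∀ k → count k (const false) ≡ 0
    count-false zero    = refl
    count-false (suc k) = trans (Σℕ.sum-cong-≗ {n} λ v → count-false k) (Σℕ.sum-replicate-zero n)

    count-∧ : ∀ k b (p : Vec (Fin n) k → Bool) → count k (λ s → b ∧ p s) ≡ (if b then count k p else 0)
    count-∧ k false p = count-false k
    count-∧ k true  p = refl

    count-maybe : ∀ {A : Set} k (p : Vec (Fin n) k → A → Bool) x →
      count k (λ s → maybe′ (p s) false x) ≡ maybe′ (λ a → count k (λ s → p s a)) 0 x
    count-maybe k p nothing  = count-false k
    count-maybe k p (just a) = refl

    length-filter : ∀ k {P : Vec (Fin n) k → Set} (P? : Decidable P) →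
      length (filter P? (allVecs n k)) ≡ count k (does ∘ P?)
    length-filter zero P? with does (P? [])
    ... | false = refl
    ... | true  = refl
    length-filter (suc k) P? = trans (byHead id) (Σℕ.sum-cong-≗ λ v → length-filter k (P? ∘ (v ∷_)))
      where
      byHead : ∀ {j} (g : Fin j → Fin n) →
        length (filter P? (cartesianProductWith _∷_ (List.tabulate g) (allVecs n k))) ≡
        Σℕ.sum λ i → length (filter (P? ∘ (g i ∷_)) (allVecs n k))
      filter-∷ : ∀ v xs → length (filter P? (List.map (v ∷_) xs)) ≡ length (filter (P? ∘ (v ∷_)) xs)
      filter-∷ v List.[] = refl
      filter-∷ v (x List.∷ xs) with does (P? (v ∷ x))
      ... | false = filter-∷ v xs
      ... | true  = cong suc (filter-∷ v xs)
      byHead {zero}  g = refl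
      byHead {suc j} g = begin
        length (filter P? (List.map (g zero ∷_) (allVecs n k) ++ _))
          ≡⟨ cong length (List.filter-++ P? (List.map (g zero ∷_) (allVecs n k)) _) ⟩
        length (filter P? (List.map (g zero ∷_) (allVecs n k)) ++ _)
          ≡⟨ List.length-++ (filter P? (List.map (g zero ∷_) (allVecs n k))) ⟩
        length (filter P? (List.map (g zero ∷_) (allVecs n k))) + _
          ≡⟨ cong₂ _+_ (filter-∷ (g zero) (allVecs n k)) (byHead (g ∘ suc)) ⟩
        Σℕ.sum (λ i → length (filter (P? ∘ (g i ∷_)) (allVecs n k))) ∎

    -- Every remaining position is hit exactly once, put in the form in which it is used: a sum over
    -- values becomes a sum over remaining positions.
    Enumerates : (Fin n → Maybe (Fin m)) → Set
    Enumerates {m} ρ = ∀ (h : Fin m → ℕ) → Σℕ.sum (λ v → maybe′ h 0 (ρ v)) ≡ Σℕ.sum h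

    enumerates-predecessor : (ρ : Fin n → Maybe (Fin (suc m))) → Enumerates ρ →
        Enumerates (predecessor ∘ ρ)
    enumerates-predecessor ρ en h = trans (Σℕ.sum-cong-≗ λ v → pointwise (ρ v)) (en h′)
      where
      h′ : Fin (suc _) → ℕ
      h′ zero    = 0
      h′ (suc b) = h b
      pointwise : ∀ x → maybe′ h 0 (predecessor x) ≡ maybe′ h′ 0 x
      pointwise nothing        = refl
      pointwise (just zero)    = refl
      pointwise (just (suc b)) = refl

    sum-≟ : ∀ {j} (a : Fin j) x → Σℕ.sum (λ v → if does (v Fin.≟ a) then x else 0) ≡ x
    sum-≟ {suc j} zero    x = trans (cong (x +_) (Σℕ.sum-replicate-zero j)) (ℕ.+-identityʳ x)
    sum-≟ {suc j} (suc a) x = sum-≟ a x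

    -- The count forgets `ι` and `d`: at the right end of an arc exactly one value is accepted,
    -- whichever it is.
    count-accept : ∀ {ι : Fin m → Fin n} {ρ} {d} X → Enumerates ρ →
        count m (accept ι ρ d X) ≡ completions X
    count-accept [] en = refl
    count-accept {suc m} {ι} {ρ} {d} (free ∷ X) en = begin
      Σℕ.sum (λ v → count m (λ s → maybe′ (choose ι ρ d X s) false (ρ v)))
        ≡⟨ Σℕ.sum-cong-≗ (λ v → count-maybe m (choose ι ρ d X) (ρ v)) ⟩
      Σℕ.sum (λ v → maybe′ (λ b → count m (λ s → choose ι ρ d X s b)) 0 (ρ v))
        ≡⟨ en _ ⟩
      count m (λ s → choose ι ρ d X s zero) + Σℕ.sum (λ b → count m (λ s → choose ι ρ d X s (suc b)))
        ≡⟨ cong₂ _+_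
             (trans (count-∧ m (tops X <ᵇ ℓ) _) (cong (if tops X <ᵇ ℓ then_else 0)
                 (count-accept X (enumerates-predecessor ρ en))))
             (Σℕ.sum-cong-≗ λ b → trans (count-∧ m (isFree (lookup X b)) _)
               (cong (if isFree (lookup X b) then_else 0)
                   (trans (count-∧ m (tops (proj₂ (insert b X)) ≤ᵇ ℓ) _)
                 (cong (if tops (proj₂ (insert b X)) ≤ᵇ ℓ then_else 0)
                   (count-accept (proj₂ (insert b X)) (enumerates-predecessor ρ en)))))) ⟩
      completions (free ∷ X) ∎
    count-accept {suc m} {ρ = ρ} {d} (buried ∷ X) en =
      trans (Σℕ.sum-cong-≗ λ v → trans (count-∧ m (does (v Fin.≟ d zero)) _)
        (cong (if does (v Fin.≟ d zero) then_else 0) (count-accept X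
            (enumerates-predecessor ρ en)))) (sum-≟ (d zero) _)
    count-accept {suc m} {ρ = ρ} {d} (top ∷ X) en =
      trans (Σℕ.sum-cong-≗ λ v → trans (count-∧ m (does (v Fin.≟ d zero)) _)
        (cong (if does (v Fin.≟ d zero) then_else 0) (count-accept X
            (enumerates-predecessor ρ en)))) (sum-≟ (d zero) _)

    -- The automaton on the one-line notation of a fixed map

    module Correctness (f : Fin n → Fin n) where
      open Descents f

      -- `demand` and `taken` are the two directions of the correspondence between open arcs and
      -- letters that are not free; `chain` and `chain⁻¹` say that patience sorting measures
      -- descending sequences. `f` is not assumed to be an involution: `paired` and `local` record
      -- what the prefix read so far guarantees, so that soundness and completeness share the
      -- invariant.
      record Invariant (j : ℕ) (ι : Fin m → Fin n) (ρ : Fin n → Maybe (Fin m)) (d : Fin m → Fin n)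
                       (X : Vec Slot m) : Set where
        field
          toℕ-ι     : ∀ b → toℕ (ι b) ≡ j + toℕ b
          ρ-just    : ∀ {v b} → ρ v ≡ just b → v ≡ ι b
          ρ-nothing : ∀ {v} → ρ v ≡ nothing → toℕ v < j
          demand    : ∀ b → isFree (lookup X b) ≡ false → toℕ (d b) < j × f (d b) ≡ ι b
          taken     : ∀ a b → toℕ a < j → f a ≡ ι b → isFree (lookup X b) ≡ false × d b ≡ a
          paired    : ∀ i → toℕ i < j → toℕ (f i) < j → f (f i) ≡ i
          chain     : ∀ c r → r ≤ topsFrom c X → Before r j (j + c)
          chain⁻¹   : ∀ c r → Before r j (j + c) → r ≤ topsFrom c X
          local     : ∀ i → toℕ i < j → Local ℓ i

      module _ {j} {ι : Fin (suc m) → Fin n} {ρ d x X} (I : Invariant j ι ρ d (x ∷ X)) where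
        open Invariant I

        private
          p = ι zero

          toℕ-p : toℕ p ≡ j
          toℕ-p = trans (toℕ-ι zero) (ℕ.+-identityʳ j)

          toℕ-ι-suc : ∀ b → toℕ (ι (suc b)) ≡ suc j + toℕ b
          toℕ-ι-suc b = trans (toℕ-ι (suc b)) (ℕ.+-suc j (toℕ b))

          past : ∀ i → toℕ i < suc j → toℕ i < j ⊎ i ≡ p
          past i (s≤s le) with ℕ.m≤n⇒m<n∨m≡n le
          ... | inj₁ lt = inj₁ lt
          ... | inj₂ eq = inj₂ (Fin.toℕ-injective (trans eq (sym toℕ-p)))

          ρ-just′ : ∀ {v b} → predecessor (ρ v) ≡ just b → v ≡ ι (suc b)
          ρ-just′ {v} eq with ρ v in ρv
          ρ-just′ refl | just (suc b) = ρ-just ρv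

          ρ-nothing′ : ∀ {v} → predecessor (ρ v) ≡ nothing → toℕ v < suc j
          ρ-nothing′ {v} eq with ρ v in ρv
          ... | nothing   = ℕ.m≤n⇒m≤1+n (ρ-nothing ρv)
          ... | just zero = s≤s (ℕ.≤-reflexive (trans (cong toℕ (ρ-just ρv)) toℕ-p))

        -- Common to the end of an arc and a fixed point: no arc begins at `p`, so the sequences of
        -- open arcs stay the same and only the offsets move by one.
        closed : toℕ (f p) ≤ j → f (f p) ≡ p → (∀ i → toℕ i < j → f i ≡ p → f p ≡ i) →
          (f p ≡ p → ¬ Before ℓ j (suc j)) →
          Invariant (suc j) (ι ∘ suc) (predecessor ∘ ρ) (d ∘ suc) X
        closed le ffp unique loc = record
          { toℕ-ι     = toℕ-ι-suc
          ; ρ-just    = ρ-just′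
          ; ρ-nothing = ρ-nothing′
          ; demand    = λ b eq → let lt , eq′ = demand (suc b) eq in ℕ.m≤n⇒m≤1+n lt , eq′
          ; taken     = λ a b lt eq → taken′ a b (past a lt) eq
          ; paired    = λ i lt lt′ → paired′ i (past i lt) (past (f i) lt′)
          ; chain     = λ c r le → before-weaken (ℕ.n≤1+n j) (ℕ.≤-reflexive (sym (ℕ.+-suc j c)))
              (chain (suc c) r le)
          ; chain⁻¹   = λ c r bf → chain⁻¹ (suc c) r (subst (Before r j) (sym (ℕ.+-suc j c)) (strip bf))
          ; local     = λ i lt → local′ i (past i lt)
          }
          where
          taken′ : ∀ a b → toℕ a < j ⊎ a ≡ p → f a ≡ ι (suc b) →
              isFree (lookup X b) ≡ false × d (suc b) ≡ a
          taken′ a b (inj₁ lt)   eq = taken a (suc b) lt eq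
          taken′ a b (inj₂ refl) eq =
            ⊥-elim (ℕ.<-irrefl refl (ℕ.≤-trans (s≤s (ℕ.m≤m+n j (toℕ b)))
              (subst (_≤ j) (trans (cong toℕ eq) (toℕ-ι-suc b)) le)))
          paired′ : ∀ i → toℕ i < j ⊎ i ≡ p → toℕ (f i) < j ⊎ f i ≡ p → f (f i) ≡ i
          paired′ i (inj₁ lt)   (inj₁ lt′) = paired i lt lt′
          paired′ i (inj₁ lt)   (inj₂ eq)  = trans (cong f eq) (unique i lt eq)
          paired′ i (inj₂ refl) _          = ffp
          strip : ∀ {r b} → Before r (suc j) (suc j + b) → Before r j (suc j + b)
          strip [] = []
          strip (snoc i lt y c) with past i lt
          ... | inj₁ lt′  = snoc i lt′ y c
          ... | inj₂ refl = ⊥-elim (ℕ.<-irrefl refl (ℕ.≤-trans (s≤s (ℕ.m≤m+n j _)) (ℕ.≤-trans y le)))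
          local′ : ∀ i → toℕ i < j ⊎ i ≡ p → Local ℓ i
          local′ i (inj₁ lt)   = local i lt
          local′ i (inj₂ refl) =
            (λ lt → ⊥-elim (ℕ.<-irrefl refl (ℕ.≤-trans lt (subst (toℕ (f p) ≤_) (sym toℕ-p) le)))) ,
            (λ eq → subst (λ k → ¬ Before ℓ k (suc k)) (sym toℕ-p) (loc eq))

        close : isFree x ≡ false → f p ≡ d zero →
          Invariant (suc j) (ι ∘ suc) (predecessor ∘ ρ) (d ∘ suc) X
        close nf eq = closed (ℕ.<⇒≤ fp<j) (trans (cong f eq) (proj₂ (demand zero nf)))
          (λ i lt eq′ → trans eq (proj₂ (taken i zero lt eq′)))
          (λ fix → ⊥-elim (ℕ.<-irrefl (trans (cong toℕ fix) toℕ-p) fp<j))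
          where
          fp<j : toℕ (f p) < j
          fp<j = subst (λ v → toℕ v < j) (sym eq) (proj₁ (demand zero nf))

        fix : isFree x ≡ true → f p ≡ p → tops X < ℓ →
          Invariant (suc j) (ι ∘ suc) (predecessor ∘ ρ) (d ∘ suc) X
        fix fr eq lt = closed (ℕ.≤-reflexive (trans (cong toℕ eq) toℕ-p)) (trans (cong f eq) eq)
          (λ i lt eq′ → ⊥-elim (true≢false (trans (sym fr) (proj₁ (taken i zero lt eq′)))))
          -- Offset 1, because arcs passing over the fixed point have right ends beyond `j`.
          (λ _ bf → ℕ.<-irrefl refl (ℕ.≤-trans lt
            (chain⁻¹ 1 ℓ (subst (Before ℓ j)
                (trans (cong suc (sym (ℕ.+-identityʳ j))) (sym (ℕ.+-suc j 0))) bf))))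

        module _ (fr : isFree x ≡ true) (b : Fin m) (fp : f p ≡ ι (suc b)) (fb : lookup X b ≡ free)
            where
          private
            Y = proj₂ (insert b X)
            o = topsFrom (suc (toℕ b)) X

            value : toℕ (f p) ≡ suc j + toℕ b
            value = trans (cong toℕ fp) (toℕ-ι-suc b)

          -- A sequence longer than any present before can be made to end in `p`; its other arcs are
          -- those with right ends beyond that of `p`.
          open-chain : ∀ c r → r ≤ topsFrom c Y → Before r (suc j) (suc j + c)
          open-chain c r le with c ℕ.≤? toℕ b
          ... | no c≰b = before-weaken (ℕ.n≤1+n j) (ℕ.≤-reflexive (sym (ℕ.+-suc j c)))
            (chain (suc c) r (subst (r ≤_) (insert-topsFrom-> b X (ℕ.≰⇒> c≰b)) le))
          ... | yes c≤b with r ℕ.≤? topsFrom c X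
          ... | yes le′ = before-weaken (ℕ.n≤1+n j) (ℕ.≤-reflexive (sym (ℕ.+-suc j c)))
              (chain (suc c) r le′)
          ... | no ≰ = extend r (subst (r ≤_) (ℕ.m≤n⇒m⊔n≡n m≤o)
                         (subst (r ≤_) (insert-topsFrom-≤ b X fb c≤b) le))
            where
            m≤o : topsFrom c X ≤ suc o
            m≤o with ℕ.≤-total (topsFrom c X) (suc o)
            ... | inj₁ q = q
            ... | inj₂ q = ⊥-elim (≰ (subst (r ≤_)
                (trans (insert-topsFrom-≤ b X fb c≤b) (ℕ.m≥n⇒m⊔n≡m q)) le))
            extend : ∀ r → r ≤ suc o → Before r (suc j) (suc j + c)
            extend zero    _       = []
            extend (suc r) (s≤s q) = snoc p (s≤s (ℕ.≤-reflexive toℕ-p))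
              (subst (suc j + c ≤_) (sym value) (ℕ.+-monoʳ-≤ (suc j) c≤b))
              (before-weaken (ℕ.≤-reflexive (sym toℕ-p))
                (ℕ.≤-reflexive (trans (cong suc value)
                    (sym (trans (ℕ.+-suc j _) (cong suc (ℕ.+-suc j (toℕ b)))))))
                (chain (suc (suc (toℕ b))) r q))

          open-chain⁻¹ : ∀ c r → Before r (suc j) (suc j + c) → r ≤ topsFrom c Y
          open-chain⁻¹ c zero    _ = z≤n
          open-chain⁻¹ c (suc r) (snoc i lt y bf) with past i lt
          ... | inj₁ lt′ = ℕ.≤-trans
            (chain⁻¹ (suc c) (suc r) (snoc i lt′ (subst (_≤ toℕ (f i)) (sym (ℕ.+-suc j c)) y) bf)) grow
            where
            grow : topsFrom c X ≤ topsFrom c Y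
            grow with c ℕ.≤? toℕ b
            ... | yes c≤b = subst (topsFrom c X ≤_) (sym (insert-topsFrom-≤ b X fb c≤b)) (ℕ.m≤m⊔n _ _)
            ... | no  c≰b = ℕ.≤-reflexive (sym (insert-topsFrom-> b X (ℕ.≰⇒> c≰b)))
          ... | inj₂ refl = subst (suc r ≤_) (sym (insert-topsFrom-≤ b X fb c≤b))
            (ℕ.≤-trans (s≤s (chain⁻¹ (suc (suc (toℕ b))) r (before-weaken (ℕ.≤-reflexive toℕ-p)
                (ℕ.≤-reflexive (trans (trans (ℕ.+-suc j _) (cong suc (ℕ.+-suc j (toℕ b))))
                    (cong suc (sym value)))) bf)))
              (ℕ.m≤n⊔m _ _))
            where
            c≤b : c ≤ toℕ b
            c≤b = ℕ.+-cancelˡ-≤ (suc j) c (toℕ b) (subst (suc j + c ≤_) value y)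

          opened : tops Y ≤ ℓ →
            Invariant (suc j) (ι ∘ suc) (predecessor ∘ ρ) (Vector.updateAt (d ∘ suc) b (const p)) Y
          opened le = record
            { toℕ-ι     = toℕ-ι-suc
            ; ρ-just    = ρ-just′
            ; ρ-nothing = ρ-nothing′
            ; demand    = demand′
            ; taken     = λ a i lt eq → taken′ a i (past a lt) eq
            ; paired    = λ i lt lt′ → paired′ i (past i lt) (past (f i) lt′)
            ; chain     = open-chain
            ; chain⁻¹   = open-chain⁻¹
            ; local     = λ i lt → local′ i (past i lt)
            }
            where
            d′ = Vector.updateAt (d ∘ suc) b (const p)
            demand′ : ∀ i → isFree (lookup Y i) ≡ false → toℕ (d′ i) < suc j × f (d′ i) ≡ ι (suc i)
            demand′ i nf with i Fin.≟ b
            ... | yes refl rewrite Vector.updateAt-updates i {const p} (d ∘ suc) =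
                s≤s (ℕ.≤-reflexive toℕ-p) , fp
            ... | no i≢b rewrite Vector.updateAt-minimal i b {const p} (d ∘ suc) i≢b =
              let lt , eq = demand (suc i) (trans (sym (insert-elsewhere b i X i≢b)) nf) in
                      ℕ.m≤n⇒m≤1+n lt , eq
            taken′ : ∀ a i → toℕ a < j ⊎ a ≡ p → f a ≡ ι (suc i) →
                isFree (lookup Y i) ≡ false × d′ i ≡ a
            taken′ a i (inj₁ lt) eq with taken a (suc i) lt eq | i Fin.≟ b
            ... | nf , _  | yes refl = ⊥-elim (true≢false (trans (cong isFree (sym fb)) nf))
            ... | nf , da | no i≢b = trans (insert-elsewhere b i X i≢b) nf ,
              trans (Vector.updateAt-minimal i b {const p} (d ∘ suc) i≢b) da
            taken′ a i (inj₂ refl) eq with Fin.toℕ-injective (ℕ.+-cancelˡ-≡ (suc j) _ _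
              (trans (sym (toℕ-ι-suc i)) (trans (cong toℕ (trans (sym eq) fp)) (toℕ-ι-suc b))))
            ... | refl = insert-here b X , Vector.updateAt-updates b {const p} (d ∘ suc)
            p<fp : j < toℕ (f p)
            p<fp = subst (j <_) (sym value) (s≤s (ℕ.m≤m+n j (toℕ b)))
            paired′ : ∀ i → toℕ i < j ⊎ i ≡ p → toℕ (f i) < j ⊎ f i ≡ p → f (f i) ≡ i
            paired′ i (inj₁ lt)   (inj₁ lt′) = paired i lt lt′
            paired′ i (inj₁ lt)   (inj₂ eq)  =
                ⊥-elim (true≢false (trans (sym fr) (proj₁ (taken i zero lt eq))))
            paired′ i (inj₂ refl) (inj₁ lt′) = ⊥-elim (ℕ.<-irrefl refl (ℕ.<-trans p<fp lt′))
            paired′ i (inj₂ refl) (inj₂ eq)  =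
                ⊥-elim (ℕ.<-irrefl (sym (trans (cong toℕ eq) toℕ-p)) p<fp)
            local′ : ∀ i → toℕ i < j ⊎ i ≡ p → Local ℓ i
            local′ i (inj₁ lt)   = local i lt
            local′ i (inj₂ refl) =
              (λ _ bf → ℕ.<-irrefl refl (ℕ.≤-trans (open-chain⁻¹ 0 (suc ℓ)
                (before-weaken (s≤s (ℕ.≤-reflexive toℕ-p)) (s≤s
                    (ℕ.≤-reflexive (trans (ℕ.+-identityʳ j) (sym toℕ-p)))) bf)) le)) ,
              (λ eq → ⊥-elim (ℕ.<-irrefl (sym (trans (cong toℕ eq) toℕ-p)) p<fp))

      Good : Set
      Good = (∀ i → f (f i) ≡ i) × (∀ i → Local ℓ i)

      T-∧⇒ : ∀ {a b} → T (a ∧ b) → T a × T b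
      T-∧⇒ = Equivalence.to Bool.T-∧

      T-∧⇐ : ∀ {a b} → T a → T b → T (a ∧ b)
      T-∧⇐ p q = Equivalence.from Bool.T-∧ (p , q)

      T-isFree⇒ : ∀ {x} → T (isFree x) → x ≡ free
      T-isFree⇒ {free} _ = refl

      T-≟⇒ : ∀ {k} {u v : Fin k} → T (does (u Fin.≟ v)) → u ≡ v
      T-≟⇒ {u = u} {v} t with u Fin.≟ v
      ... | yes eq = eq

      T-≟⇐ : ∀ {k} {u v : Fin k} → u ≡ v → T (does (u Fin.≟ v))
      T-≟⇐ {u = u} {v} eq with u Fin.≟ v
      ... | yes _  = tt
      ... | no neq = neq eq

      finished : ∀ {j ι ρ d} → Invariant {zero} j ι ρ d [] → Good
      finished {j} {ρ = ρ} I = (λ i → paired i (all i) (all (f i))) , (λ i → local i (all i))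
        where
        open Invariant I
        all : ∀ i → toℕ i < j
        all i with ρ i in eq
        ... | nothing = ρ-nothing eq

      sound : ∀ {j ι ρ d} (X : Vec Slot m) s → (∀ b → f (ι b) ≡ lookup s b) → Invariant j ι ρ d X →
        T (accept ι ρ d X s) → Good
      sound [] [] fs I acc = finished I
      sound {ρ = ρ} (free ∷ X) (v ∷ s) fs I acc with ρ v in ρv
      ... | just zero =
        let lt , acc′ = T-∧⇒ acc
        in sound X s (fs ∘ suc) (fix I refl (trans (fs zero) (Invariant.ρ-just I ρv))
                (ℕ.<ᵇ⇒< _ _ lt)) acc′
      ... | just (suc b) =
        let fr , acc′ = T-∧⇒ acc
            le , acc″ = T-∧⇒ acc′
        in sound _ s (fs ∘ suc) (opened I refl b (trans (fs zero) (Invariant.ρ-just I ρv))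
                (T-isFree⇒ fr) (ℕ.≤ᵇ⇒≤ _ _ le)) acc″
      sound (buried ∷ X) (v ∷ s) fs I acc =
        let eq , acc′ = T-∧⇒ acc in sound X s (fs ∘ suc) (close I refl (trans (fs zero) (T-≟⇒ eq))) acc′
      sound (top ∷ X) (v ∷ s) fs I acc =
        let eq , acc′ = T-∧⇒ acc in sound X s (fs ∘ suc) (close I refl (trans (fs zero) (T-≟⇒ eq))) acc′

      complete : ∀ {j ι ρ d} (X : Vec Slot m) s → (∀ b → f (ι b) ≡ lookup s b) → Invariant j ι ρ d X →
        Good → T (accept ι ρ d X s)
      complete [] [] fs I good = tt
      complete {j = j} {ι} {ρ} {d} (free ∷ X) (v ∷ s) fs I good@(inv , loc) with ρ v in ρv
      -- The value lies in the prefix, so an arc begun there ends here and the letter could not be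
      -- free.
      ... | nothing = ⊥-elim (true≢false
          (proj₁ (taken v zero (ρ-nothing ρv) (trans (cong f (sym (fs zero))) (inv _)))))
        where open Invariant I
      ... | just zero = T-∧⇐ (ℕ.<⇒<ᵇ lt) (complete X s (fs ∘ suc) (fix I refl fp lt) good)
        where
        open Invariant I
        fp : f (ι zero) ≡ ι zero
        fp = trans (fs zero) (ρ-just ρv)
        toℕ-p : toℕ (ι zero) ≡ j
        toℕ-p = trans (toℕ-ι zero) (ℕ.+-identityʳ j)
        lt : tops X < ℓ
        lt = ℕ.≰⇒> λ ge → proj₂ (loc (ι zero)) fp (before-weaken (ℕ.≤-reflexive (sym toℕ-p))
          (ℕ.≤-reflexive (trans (cong suc toℕ-p)
              (sym (trans (ℕ.+-suc j 0) (cong suc (ℕ.+-identityʳ j)))))) (chain 1 ℓ ge))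
      ... | just (suc b) = T-∧⇐ (subst (T ∘ isFree) (sym fb) tt) (T-∧⇐ (ℕ.≤⇒≤ᵇ le)
                             (complete _ s (fs ∘ suc) (opened I refl b fp fb le) good))
        where
        open Invariant I
        fp : f (ι zero) ≡ ι (suc b)
        fp = trans (fs zero) (ρ-just ρv)
        toℕ-p : toℕ (ι zero) ≡ j
        toℕ-p = trans (toℕ-ι zero) (ℕ.+-identityʳ j)
        -- Another arc with the same right end would have left end `f (f p)`, which is `p` and not
        -- in the prefix.
        notTaken : isFree (lookup X b) ≢ false
        notTaken nf = let lt , eq = demand (suc b) nf in
          ℕ.<-irrefl toℕ-p (subst (λ i → toℕ i < j) (trans (sym (inv (d (suc b))))
              (trans (cong f (trans eq (sym fp))) (inv (ι zero)))) lt)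
        fb : lookup X b ≡ free
        fb with lookup X b | notTaken
        ... | free   | _ = refl
        ... | buried | q = ⊥-elim (q refl)
        ... | top    | q = ⊥-elim (q refl)
        le : tops (proj₂ (insert b X)) ≤ ℓ
        le = ℕ.≮⇒≥ λ gt → proj₁ (loc (ι zero))
          (subst₂ _<_ (sym toℕ-p) (sym (trans (cong toℕ fp) (toℕ-ι (suc b)))) (ℕ.m<m+n j (s≤s z≤n)))
          (before-weaken (s≤s (ℕ.≤-reflexive (sym toℕ-p))) (s≤s
              (ℕ.≤-reflexive (trans toℕ-p (sym (ℕ.+-identityʳ j)))))
            (open-chain I refl b fp fb 0 (suc ℓ) gt))
      complete {d = d} (buried ∷ X) (v ∷ s) fs I good@(inv , _) = T-∧⇐ (T-≟⇐ (trans (sym (fs zero)) fp))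
        (complete X s (fs ∘ suc) (close I refl fp) good)
        where fp = trans (cong f (sym (proj₂ (Invariant.demand I zero refl)))) (inv (d zero))
      complete {d = d} (top ∷ X) (v ∷ s) fs I good@(inv , _) = T-∧⇐ (T-≟⇐ (trans (sym (fs zero)) fp))
        (complete X s (fs ∘ suc) (close I refl fp) good)
        where fp = trans (cong f (sym (proj₂ (Invariant.demand I zero refl)))) (inv (d zero))

      lookup-free : ∀ k (b : Fin k) → lookup (replicate k free) b ≡ free
      lookup-free k b = Vec.lookup-replicate b free

      topsFrom-free : ∀ k c → topsFrom c (replicate k free) ≡ 0
      topsFrom-free zero    zero    = refl
      topsFrom-free (suc k) zero    = topsFrom-free k zero
      topsFrom-free zero    (suc c) = refl
      topsFrom-free (suc k) (suc c) = topsFrom-free k c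

      -- The second `id` is a placeholder for the left ends, as no arc is open.
      initial : Invariant 0 id just id (replicate n free)
      initial = record
        { toℕ-ι     = λ b → refl
        ; ρ-just    = λ { refl → refl }
        ; ρ-nothing = λ ()
        ; demand    = λ b eq → ⊥-elim (true≢false (trans (cong isFree (sym (lookup-free n b))) eq))
        ; taken     = λ _ _ ()
        ; paired    = λ _ ()
        ; chain     = λ c r le → subst
            (λ k → Before k 0 c) (sym (ℕ.n≤0⇒n≡0 (subst (r ≤_) (topsFrom-free n c) le))) []
        ; chain⁻¹   = λ { c zero [] → z≤n ; c (suc r) (snoc i () _ _) }
        ; local     = λ _ ()
        }

    length-involutions : length (involutions (2 * ℓ) n) ≡ completions (replicate n free)
    length-involutions = begin
      length (involutions (2 * ℓ) n)                          ≡⟨ length-filter n _ ⟩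
      count n _
          ≡⟨ count-cong n (λ τ → agree (avoiding? τ) (sound′ τ) (complete′ τ)) ⟩
      count n (accept id just id (replicate n free))
          ≡⟨ count-accept (replicate n free) (λ h → refl) ⟩
      completions (replicate n free)                          ∎
      where
      Avoiding : Vec (Fin n) n → Set
      Avoiding τ = IsInvolution τ × ¬ HasDescending (suc (2 * ℓ)) τ
      open Correctness
      avoiding? : ∀ τ → Dec (Avoiding τ)
      avoiding? τ = isInvolution? τ ×-dec ¬? (hasDescending? (suc (2 * ℓ)) τ)
      sound′ : ∀ τ → T (accept id just id (replicate n free) τ) → Avoiding τ
      sound′ τ acc = let inv , loc = sound (lookup τ) (replicate n free) τ (λ b → refl) (initial (lookup τ)) acc
        in inv , λ d → Descents.local⇒no-descent (lookup τ) inv loc (hasDescending⇒after τ d)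
      complete′ : ∀ τ → Avoiding τ → T (accept id just id (replicate n free) τ)
      complete′ τ (inv , no-d) = complete (lookup τ) (replicate n free) τ
          (λ b → refl) (initial (lookup τ))
        (inv , Descents.no-descent⇒local (lookup τ) inv (λ a → no-d (after⇒hasDescending τ a)))
      agree : ∀ {A : Set} {b} (a? : Dec A) → (T b → A) → (A → T b) → does a? ≡ b
      agree {b = true}  (yes _)  to from = refl
      agree {b = false} (yes a)  to from = ⊥-elim (from a)
      agree {b = true}  (no ¬a)  to from = ⊥-elim (¬a (to tt))
      agree {b = false} (no _)   to from = refl

open Reading

-- Laurent polynomials form a commutative ring

module LaurentPolynomials where
  open ≡ using (refl; sym; trans; cong; cong₂; module ≡-Reasoning)
  open import Data.Rational.Base using (_+_; _*_; -_)
  open ≡-Reasoning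
  open +-*-Solver using (solve; _:=_; _:+_; _:*_)

  does-⇔ : ∀ {A B : Set} (a? : Dec A) (b? : Dec B) → (A → B) → (B → A) → does a? ≡ does b?
  does-⇔ (yes a) (yes b) to from = refl
  does-⇔ (yes a) (no ¬b) to from = ⊥-elim (¬b (to a))
  does-⇔ (no ¬a) (yes b) to from = ⊥-elim (¬a (from b))
  does-⇔ (no ¬a) (no ¬b) to from = refl

  module LaurentRing (ℓ : ℕ) where
    open RawRing (laurentRawRing ℓ) using () renaming (_≈_ to _≋_; _*_ to _⊛_; -_ to ⊝_; 1# to 𝟙)

    private
      Exponent = Vec ℤ ℓ
      Term = ℚ × Exponent

    infixl 6 _⊖_
    _⊖_ : Exponent → Exponent → Exponent
    _⊖_ = zipWith ℤ._-_

    value : Exponent → Term → ℚ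
    value e (q , a) = if does (Vec.≡-dec ℤ._≟_ a e) then q else 0ℚ

    zipWith-⊖ : ∀ {n} (e a b : Vec ℤ n) → zipWith ℤ._+_ a b ≡ e → b ≡ zipWith ℤ._-_ e a
    zipWith-⊖ []      []      []      eq   = refl
    zipWith-⊖ (_ ∷ e) (a ∷ as) (b ∷ bs) refl = cong₂ _∷_
      (sym ([i+j]-i≡j a b))
      (zipWith-⊖ e as bs refl)

    zipWith-⊖⁻¹ : ∀ {n} (e a b : Vec ℤ n) → b ≡ zipWith ℤ._-_ e a → zipWith ℤ._+_ a b ≡ e
    zipWith-⊖⁻¹ []      []       []       eq   = refl
    zipWith-⊖⁻¹ (e ∷ es) (a ∷ as) (_ ∷ _) refl = cong₂ _∷_
      (i+[j-i]≡j a e)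
      (zipWith-⊖⁻¹ es as _ refl)

    zipWith-⊖-swap : ∀ (e a b : Exponent) → b ≡ e ⊖ a → a ≡ e ⊖ b
    zipWith-⊖-swap e a b eq = zipWith-⊖ e b a
        (trans (Vec.zipWith-comm ℤ.+-comm b a) (zipWith-⊖⁻¹ e a b eq))

    if-* : ∀ (b : Bool) q r → (if b then q * r else 0ℚ) ≡ q * (if b then r else 0ℚ)
    if-* true  q r = refl
    if-* false q r = sym (ℚ.*-zeroʳ q)

    value-mulTerm : ∀ e (s t : Term) → value e (mulTerm s t) ≡ proj₁ s * value (e ⊖ proj₂ s) t
    value-mulTerm e (q , a) (r , b) = trans
      (cong (if_then q * r else 0ℚ) (does-⇔ (Vec.≡-dec ℤ._≟_ (zipWith ℤ._+_ a b) e)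
          (Vec.≡-dec ℤ._≟_ b (e ⊖ a))
        (zipWith-⊖ e a b) (zipWith-⊖⁻¹ e a b)))
      (if-* (does (Vec.≡-dec ℤ._≟_ b (e ⊖ a))) q r)

    -- Both sides are the product of the two scalars if the exponents add up to `e`, and 0
    -- otherwise.
    value-swap : ∀ e (s t : Term) → proj₁ s * value (e ⊖ proj₂ s) t ≡ proj₁ t * value (e ⊖ proj₂ t) s
    value-swap e (q , a) (r , b) = begin
      q * (if does (Vec.≡-dec ℤ._≟_ b (e ⊖ a)) then r else 0ℚ)
          ≡⟨ if-* (does (Vec.≡-dec ℤ._≟_ b (e ⊖ a))) q r ⟨
      (if does (Vec.≡-dec ℤ._≟_ b (e ⊖ a)) then q * r else 0ℚ)
        ≡⟨ cong₂ (if_then_else 0ℚ) (does-⇔ (Vec.≡-dec ℤ._≟_ b (e ⊖ a)) (Vec.≡-dec ℤ._≟_ a (e ⊖ b))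
             (zipWith-⊖-swap e a b) (zipWith-⊖-swap e b a)) (ℚ.*-comm q r) ⟩
      (if does (Vec.≡-dec ℤ._≟_ a (e ⊖ b)) then r * q else 0ℚ)
          ≡⟨ if-* (does (Vec.≡-dec ℤ._≟_ a (e ⊖ b))) r q ⟩
      r * (if does (Vec.≡-dec ℤ._≟_ a (e ⊖ b)) then q else 0ℚ) ∎

    coefficient-++ : ∀ e (f g : Laurent ℓ) → coefficient e (f ++ g) ≡ coefficient e f + coefficient e g
    coefficient-++ e []      g = sym (ℚ.+-identityˡ _)
    coefficient-++ e (t ∷ f) g = trans (cong (value e t +_) (coefficient-++ e f g))
      (sym (ℚ.+-assoc (value e t) (coefficient e f) (coefficient e g)))

    coefficient-⊝ : ∀ e (f : Laurent ℓ) → coefficient e (⊝ f) ≡ - coefficient e f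
    coefficient-⊝ e []            = refl
    coefficient-⊝ e ((q , a) ∷ f) = begin
      value e (- q , a) + coefficient e (⊝ f)
          ≡⟨ cong₂ _+_ (if-neg (does (Vec.≡-dec ℤ._≟_ a e))) (coefficient-⊝ e f) ⟩
      - value e (q , a) + - coefficient e f   ≡⟨ ℚ.neg-distrib-+ (value e (q , a)) (coefficient e f) ⟨
      - (value e (q , a) + coefficient e f)   ∎
      where
      if-neg : ∀ b → (if b then - q else 0ℚ) ≡ - (if b then q else 0ℚ)
      if-neg true  = refl
      if-neg false = refl

    coefficient-map : ∀ e s (g : Laurent ℓ) →
      coefficient e (List.map (mulTerm s) g) ≡ proj₁ s * coefficient (e ⊖ proj₂ s) g
    coefficient-map e s []      = sym (ℚ.*-zeroʳ (proj₁ s))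
    coefficient-map e s (t ∷ g) = trans (cong₂ _+_ (value-mulTerm e s t) (coefficient-map e s g))
      (sym (ℚ.*-distribˡ-+ (proj₁ s) _ _))

    coefficient-∷⊛ : ∀ e s (f g : Laurent ℓ) →
      coefficient e ((s ∷ f) ⊛ g) ≡ proj₁ s * coefficient (e ⊖ proj₂ s) g + coefficient e (f ⊛ g)
    coefficient-∷⊛ e s f g = trans (coefficient-++ e (List.map (mulTerm s) g) (f ⊛ g))
      (cong (_+ coefficient e (f ⊛ g)) (coefficient-map e s g))

    ⊛-congˡ : ∀ f {g h : Laurent ℓ} → g ≋ h → f ⊛ g ≋ f ⊛ h
    ⊛-congˡ []      eq e = refl
    ⊛-congˡ (s ∷ f) {g} {h} eq e = begin
      coefficient e ((s ∷ f) ⊛ g) ≡⟨ coefficient-∷⊛ e s f g ⟩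
      proj₁ s * coefficient (e ⊖ proj₂ s) g + coefficient e (f ⊛ g)
          ≡⟨ cong₂ _+_ (cong (proj₁ s *_) (eq _)) (⊛-congˡ f eq e) ⟩
      proj₁ s * coefficient (e ⊖ proj₂ s) h + coefficient e (f ⊛ h) ≡⟨ coefficient-∷⊛ e s f h ⟨
      coefficient e ((s ∷ f) ⊛ h) ∎

    -- The list product unfolds along its first factor. Unfolding along the second as well gives
    -- commutativity, which holds for coefficients and not for lists.
    coefficient-⊛∷ : ∀ e t (f g : Laurent ℓ) →
      coefficient e (f ⊛ (t ∷ g)) ≡ proj₁ t * coefficient (e ⊖ proj₂ t) f + coefficient e (f ⊛ g)
    coefficient-⊛∷ e t []      g = trans (sym (ℚ.*-zeroʳ (proj₁ t))) (sym (ℚ.+-identityʳ _))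
    coefficient-⊛∷ e t (s ∷ f) g = begin
      coefficient e ((s ∷ f) ⊛ (t ∷ g))
        ≡⟨ coefficient-∷⊛ e s f (t ∷ g) ⟩
      proj₁ s * (value (e ⊖ proj₂ s) t + G) + coefficient e (f ⊛ (t ∷ g))
        ≡⟨ cong₂ _+_ (ℚ.*-distribˡ-+ (proj₁ s) _ _) (coefficient-⊛∷ e t f g) ⟩
      (proj₁ s * value (e ⊖ proj₂ s) t + proj₁ s * G) + (proj₁ t * F + coefficient e (f ⊛ g))
        ≡⟨ cong (λ u → (u + proj₁ s * G) + (proj₁ t * F + coefficient e (f ⊛ g))) (value-swap e s t) ⟩
      (proj₁ t * value (e ⊖ proj₂ t) s + proj₁ s * G) + (proj₁ t * F + coefficient e (f ⊛ g))
        ≡⟨ solve 5 (λ t v sG F c → (t :* v :+ sG) :+ (t :* F :+ c) := t :* (v :+ F) :+ (sG :+ c)) refl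
             (proj₁ t) (value (e ⊖ proj₂ t) s) (proj₁ s * G) F _ ⟩
      proj₁ t * (value (e ⊖ proj₂ t) s + F) + (proj₁ s * G + coefficient e (f ⊛ g))
        ≡⟨ cong (proj₁ t * coefficient (e ⊖ proj₂ t) (s ∷ f) +_) (coefficient-∷⊛ e s f g) ⟨
      proj₁ t * coefficient (e ⊖ proj₂ t) (s ∷ f) + coefficient e ((s ∷ f) ⊛ g) ∎
      where
      F = coefficient (e ⊖ proj₂ t) f
      G = coefficient (e ⊖ proj₂ s) g

    ⊛-comm : ∀ (f g : Laurent ℓ) → f ⊛ g ≋ g ⊛ f
    ⊛-comm []      g e = cong (coefficient e) (sym (List.cartesianProductWith-zeroʳ mulTerm g))
    ⊛-comm (s ∷ f) g e = begin
      coefficient e ((s ∷ f) ⊛ g)                                    ≡⟨ coefficient-∷⊛ e s f g ⟩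
      proj₁ s * coefficient (e ⊖ proj₂ s) g + coefficient e (f ⊛ g)
          ≡⟨ cong (proj₁ s * coefficient (e ⊖ proj₂ s) g +_) (⊛-comm f g e) ⟩
      proj₁ s * coefficient (e ⊖ proj₂ s) g + coefficient e (g ⊛ f)  ≡⟨ coefficient-⊛∷ e s g f ⟨
      coefficient e (g ⊛ (s ∷ f))                                    ∎

    ⊛-distribʳ : ∀ (h f g : Laurent ℓ) → (f ++ g) ⊛ h ≡ f ⊛ h ++ g ⊛ h
    ⊛-distribʳ h f g = List.cartesianProductWith-distribʳ-++ mulTerm f g h

    mulTerm-assoc : ∀ (s t u : Term) → mulTerm (mulTerm s t) u ≡ mulTerm s (mulTerm t u)
    mulTerm-assoc (q , a) (r , b) (p , c) = cong₂ _,_ (ℚ.*-assoc q r p)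
        (Vec.zipWith-assoc ℤ.+-assoc a b c)

    map-⊛ : ∀ s (g h : Laurent ℓ) → List.map (mulTerm s) g ⊛ h ≡ List.map (mulTerm s) (g ⊛ h)
    map-⊛ s []      h = refl
    map-⊛ s (t ∷ g) h = begin
      List.map (mulTerm (mulTerm s t)) h ++ List.map (mulTerm s) g ⊛ h
        ≡⟨ cong₂ _++_ (trans (List.map-cong (mulTerm-assoc s t) h) (List.map-∘ h)) (map-⊛ s g h) ⟩
      List.map (mulTerm s) (List.map (mulTerm t) h) ++ List.map (mulTerm s) (g ⊛ h)
        ≡⟨ List.map-++ (mulTerm s) (List.map (mulTerm t) h) (g ⊛ h) ⟨
      List.map (mulTerm s) ((t ∷ g) ⊛ h) ∎

    ⊛-assoc : ∀ (f g h : Laurent ℓ) → (f ⊛ g) ⊛ h ≡ f ⊛ (g ⊛ h)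
    ⊛-assoc []      g h = refl
    ⊛-assoc (s ∷ f) g h = trans (⊛-distribʳ h (List.map (mulTerm s) g) (f ⊛ g))
      (cong₂ _++_ (map-⊛ s g h) (⊛-assoc f g h))

    ⊛-identityˡ : ∀ (f : Laurent ℓ) → 𝟙 ⊛ f ≡ f
    ⊛-identityˡ f = trans (List.++-identityʳ _) (trans
      (List.map-cong (λ { (q , a) → cong₂ _,_ (ℚ.*-identityˡ q)
          (Vec.zipWith-identityˡ ℤ.+-identityˡ a) }) f) (List.map-id f))

    private
      list : ∀ {f g : Laurent ℓ} → f ≡ g → f ≋ g
      list refl e = refl

      trans≋ : ∀ {f g h : Laurent ℓ} → f ≋ g → g ≋ h → f ≋ h
      trans≋ p q e = trans (p e) (q e)

      ++-cong : ∀ {f f′ g g′ : Laurent ℓ} → f ≋ f′ → g ≋ g′ → (f ++ g) ≋ (f′ ++ g′)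
      ++-cong {f} {f′} {g} {g′} p q e =
        trans (coefficient-++ e f g) (trans (cong₂ _+_ (p e) (q e)) (sym (coefficient-++ e f′ g′)))

      ++-comm : ∀ (f g : Laurent ℓ) → (f ++ g) ≋ (g ++ f)
      ++-comm f g e = trans (coefficient-++ e f g)
        (trans (ℚ.+-comm (coefficient e f) (coefficient e g)) (sym (coefficient-++ e g f)))

      ⊝-inverseʳ : ∀ (f : Laurent ℓ) → (f ++ ⊝ f) ≋ []
      ⊝-inverseʳ f e = trans (coefficient-++ e f (⊝ f))
        (trans (cong (coefficient e f +_) (coefficient-⊝ e f)) (ℚ.+-inverseʳ (coefficient e f)))

      ⊛-distribˡ : ∀ (h f g : Laurent ℓ) → h ⊛ (f ++ g) ≋ (h ⊛ f ++ h ⊛ g)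
      ⊛-distribˡ h f g e = trans (⊛-comm h (f ++ g) e) (trans (cong (coefficient e) (⊛-distribʳ h f g))
        (++-cong {f ⊛ h} {h ⊛ f} {g ⊛ h} {h ⊛ g} (⊛-comm f h) (⊛-comm g h) e))

    laurentRing : CommutativeRing 0ℓ 0ℓ
    laurentRing = record
      { RawRing (laurentRawRing ℓ)
      ; isCommutativeRing = record
        { isRing = record
          { +-isAbelianGroup = record
            { isGroup = record
              { isMonoid = record
                { isSemigroup = record
                  { isMagma = record
                    { isEquivalence = record
                      { refl  = λ e → refl
                      ; sym   = λ p e → sym (p e)
                      ; trans = λ {f} {g} {h} → trans≋ {f} {g} {h}
                      }
                    ; ∙-cong = λ {f} {f′} {g} {g′} → ++-cong {f} {f′} {g} {g′}
                    }
                  ; assoc = λ f g h → list (List.++-assoc f g h)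
                  }
                ; identity = (λ f e → refl) , (λ f → list (List.++-identityʳ f))
                }
              ; inverse = (λ f → trans≋ {⊝ f ++ f} {f ++ ⊝ f} {[]} (++-comm (⊝ f) f) (⊝-inverseʳ f))
                  , ⊝-inverseʳ
              ; ⁻¹-cong = λ {f} {g} p e → trans (coefficient-⊝ e f)
                  (trans (cong -_ (p e)) (sym (coefficient-⊝ e g)))
              }
            ; comm = ++-comm
            }
          ; *-cong = λ {f} {f′} {g} {g′} p q → trans≋ {f ⊛ g} {f ⊛ g′} {f′ ⊛ g′} (⊛-congˡ f {g} {g′} q)
              (trans≋ {f ⊛ g′} {g′ ⊛ f} {f′ ⊛ g′} (⊛-comm f g′)
                (trans≋ {g′ ⊛ f} {g′ ⊛ f′} {f′ ⊛ g′} (⊛-congˡ g′ {f} {f′} p) (⊛-comm g′ f′)))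
          ; *-assoc = λ f g h → list (⊛-assoc f g h)
          ; *-identity = (λ f → list (⊛-identityˡ f)) ,
              (λ f → trans≋ {f ⊛ 𝟙} {𝟙 ⊛ f} {f} (⊛-comm f 𝟙) (list (⊛-identityˡ f)))
          ; distrib = ⊛-distribˡ , (λ h f g → list (⊛-distribʳ h f g))
          }
        ; *-comm = ⊛-comm
        }
      }

open LaurentPolynomials

-- The coefficients of the determinant

module Determinants where
  open ≡ using (refl; sym; trans; cong; cong₂; subst; module ≡-Reasoning)
  open import Data.Rational.Base using (_+_; _*_; -_)
  open ≡-Reasoning
  open +-*-Solver using (solve; _:=_; _:+_; _:*_; :-_)

  private variable
    n : ℕ

  ⟦_≟_⟧ : ℤ → ℤ → ℚ
  ⟦ y ≟ z ⟧ = if does (y ℤ.≟ z) then 1ℚ else 0ℚ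

  ≟-true : ∀ {y z} → y ≡ z → ⟦ y ≟ z ⟧ ≡ 1ℚ
  ≟-true {y} {z} eq = cong (if_then 1ℚ else 0ℚ) (dec-true (y ℤ.≟ z) eq)

  ≟-false : ∀ {y z} → y ≢ z → ⟦ y ≟ z ⟧ ≡ 0ℚ
  ≟-false {y} {z} neq = cong (if_then 1ℚ else 0ℚ) (dec-false (y ℤ.≟ z) neq)

  -- The coefficient of x^z in x^r + x̄^(r+1).
  entryCoefficient : ℕ → ℤ → ℚ
  entryCoefficient r z = ⟦ z ≟ ℤ.+ r ⟧ + ⟦ z ≟ ℤ.-[1+ r ] ⟧

  -- Laplace expansion of a determinant whose columns are indexed by ys.
  expand : (ℤ → Lattice n) → Lattice (suc n)
  expand {zero}  f (y ∷ ys) = f y ys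
  expand {suc n} f (y ∷ ys) = f y ys + - expand (λ z zs → f z (y ∷ zs)) ys

  -- Each column involves only its own variable, so a coefficient of the Laurent determinant is a
  -- determinant of numbers, with entries `entryCoefficient (r + i) (y j)`.
  coefficientDet : ℕ → Lattice n
  coefficientDet {zero}  r [] = 1ℚ
  coefficientDet {suc n} r ys = expand (λ z zs → entryCoefficient r z * coefficientDet (suc r) zs) ys

  expand-cong : ∀ {f g : ℤ → Lattice n} → (∀ z zs → f z zs ≡ g z zs) → ∀ ys → expand f ys ≡ expand g ys
  expand-cong {zero}  eq (y ∷ ys) = eq y ys
  expand-cong {suc n} eq (y ∷ ys) = cong₂ (λ p q → p + - q) (eq y ys)
      (expand-cong (λ z zs → eq z (y ∷ zs)) ys)

  expand-neg : ∀ (f : ℤ → Lattice n) ys → expand (λ z zs → - f z zs) ys ≡ - expand f ys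
  expand-neg {zero}  f (y ∷ ys) = refl
  expand-neg {suc n} f (y ∷ ys) = trans (cong (λ q → - f y ys + - q) (expand-neg _ ys))
      (sym (ℚ.neg-distrib-+ (f y ys) _))

  -- An exchange of the first two columns swaps their two cofactor terms, which have opposite signs;
  -- in every other term it happens inside the minor, where `f z` is alternating.
  expand-alternating : ∀ {f : ℤ → Lattice n} → (∀ z k → Alternating k (f z)) → ∀ k →
      Alternating k (expand f)
  expand-alternating {suc zero} {f} anti zero (here {a = a} {b} {[]}) =
    solve 2 (λ p q → p :+ :- q := :- (q :+ :- p)) refl (f b (a ∷ [])) (f a (b ∷ []))
  expand-alternating {suc (suc n)} {f} anti zero (here {a = a} {b} {ys}) = begin
    f b (a ∷ ys) + - (f a (b ∷ ys) + - expand (λ z zs → f z (b ∷ a ∷ zs)) ys)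
      ≡⟨ cong (λ u → f b (a ∷ ys) + - (f a (b ∷ ys) + - u))
           (trans (expand-cong (λ z zs → anti z 0 here) ys) (expand-neg _ ys)) ⟩
    f b (a ∷ ys) + - (f a (b ∷ ys) + - - expand (λ z zs → f z (a ∷ b ∷ zs)) ys)
      ≡⟨ solve 3 (λ p q r → p :+ :- (q :+ :- :- r) := :- (q :+ :- (p :+ :- r))) refl (f b (a ∷ ys))
          (f a (b ∷ ys)) _ ⟩
    - (f a (b ∷ ys) + - (f b (a ∷ ys) + - expand (λ z zs → f z (a ∷ b ∷ zs)) ys)) ∎
  expand-alternating {suc n} {f} anti (suc k) (there {y = y} {ys = ys} {zs} sw) = begin
    f y zs + - expand (λ z zs → f z (y ∷ zs)) zs
      ≡⟨ cong₂ (λ p q → p + - q) (anti y k sw) (expand-alternating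
          (λ z k sw → anti z (suc k) (there sw)) k sw) ⟩
    - f y ys + - - expand (λ z zs → f z (y ∷ zs)) ys
      ≡⟨ ℚ.neg-distrib-+ (f y ys) _ ⟨
    - (f y ys + - expand (λ z zs → f z (y ∷ zs)) ys) ∎

  coefficientDet-alternating : ∀ r k → Alternating k (coefficientDet {n} r)
  coefficientDet-alternating {suc n} r k = expand-alternating (λ z k sw →
    trans (cong (entryCoefficient r z *_) (coefficientDet-alternating (suc r) k sw))
          (sym (ℚ.neg-distribʳ-* (entryCoefficient r z) _))) k

  expand-zero : ∀ {s} {f : ℤ → Lattice n} → (∀ z zs → ℤ.+ s ℤ.≤ z → f z zs ≡ 0ℚ) → ∀ {s′} ys →
      s ℕ.≤ s′ →
    Above s′ ys → expand f ys ≡ 0ℚ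
  expand-zero {zero}  v (y ∷ ys) le (p , ab) = v y ys (ℤ.≤-trans (ℤ.+≤+ le) p)
  expand-zero {suc n} v (y ∷ ys) le (p , ab) =
    cong₂ (λ p q → p + - q) (v y ys (ℤ.≤-trans (ℤ.+≤+ le) p))
          (expand-zero (λ z zs → v z (y ∷ zs)) ys (ℕ.m≤n⇒m≤1+n le) ab)

  entryCoefficient-above : ∀ r z → ℤ.+ suc r ℤ.≤ z → entryCoefficient r z ≡ 0ℚ
  entryCoefficient-above r (ℤ.+ z) (ℤ.+≤+ p) =
    cong (_+ 0ℚ) (≟-false {ℤ.+ z} {ℤ.+ r} λ { refl → ℕ.<-irrefl refl p })

  -- Row `s` has no exponent above s, while the later columns ask for at least s + 1. Only the first
  -- cofactor survives, and the matrix is in effect triangular.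
  coefficientDet-above : ∀ {s} (y : ℤ) (ys : Vec ℤ n) → Above (suc s) ys →
    coefficientDet s (y ∷ ys) ≡ entryCoefficient s y * coefficientDet (suc s) ys
  coefficientDet-above {zero}  y [] ab = refl
  coefficientDet-above {suc n} {s} y ys ab = trans
    (cong (λ q → entryCoefficient s y * coefficientDet (suc s) ys + - q)
      (expand-zero {s = suc s} (λ z zs p →
          trans (cong (_* coefficientDet (suc s) (y ∷ zs)) (entryCoefficient-above s z p))
          (ℚ.*-zeroˡ (coefficientDet (suc s) (y ∷ zs)))) ys ℕ.≤-refl ab))
    (ℚ.+-identityʳ _)

  -- At such points only the product of the diagonal entries is left, and a raised coordinate
  -- exceeds the largest exponent of its row.
  coefficientDet-extremal : ∀ {s} k (y : Vec ℤ n) → Above s y → shift ℤ.suc k (coefficientDet s) y ≡ 0ℚ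
  coefficientDet-extremal k []       ab = refl
  coefficientDet-extremal {s = s} zero (y ∷ ys) (p , ab) = trans (coefficientDet-above (ℤ.suc y) ys ab)
    (trans (cong (_* coefficientDet (suc s) ys) (entryCoefficient-above s (ℤ.suc y) (ℤ.suc-mono p)))
        (ℚ.*-zeroˡ (coefficientDet (suc s) ys)))
  coefficientDet-extremal {s = s} (suc k) (y ∷ ys) (p , ab) = begin
    shift ℤ.suc k (coefficientDet s ∘ (y ∷_)) ys
      ≡⟨ shift-above-cong k (λ zs → coefficientDet-above y zs) ys ab ⟩
    shift ℤ.suc k (λ zs → entryCoefficient s y * coefficientDet (suc s) zs) ys
      ≡⟨ shift-scale k (entryCoefficient s y) _ ys ⟩
    entryCoefficient s y * shift ℤ.suc k (coefficientDet (suc s)) ys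
      ≡⟨ cong (entryCoefficient s y *_) (coefficientDet-extremal k ys ab) ⟩
    entryCoefficient s y * 0ℚ
      ≡⟨ ℚ.*-zeroʳ (entryCoefficient s y) ⟩
    0ℚ ∎
    where
    shift-above-cong : ∀ {n s} k {c c′ : Lattice n} → (∀ y → Above s y → c y ≡ c′ y) →
      ∀ y → Above s y → shift ℤ.suc k c y ≡ shift ℤ.suc k c′ y
    shift-above-cong k       v []       ab       = refl
    shift-above-cong zero    v (y ∷ ys) (p , ab) = v _ (ℤ.≤-trans p (ℤ.i≤suc[i] y) , ab)
    shift-above-cong (suc k) v (y ∷ ys) (p , ab) = shift-above-cong k (λ zs ab → v _ (p , ab)) ys ab
    shift-scale : ∀ {n} k a (c : Lattice n) y → shift ℤ.suc k (λ z → a * c z) y ≡ a * shift ℤ.suc k c y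
    shift-scale k       a c []       = sym (ℚ.*-zeroʳ a)
    shift-scale zero    a c (y ∷ ys) = refl
    shift-scale (suc k) a c (y ∷ ys) = shift-scale k a _ ys

  mirror-involutive : ∀ z → mirror (mirror z) ≡ z
  mirror-involutive z = begin
    ℤ.pred (ℤ.- ℤ.pred (ℤ.- z))        ≡⟨ cong ℤ.pred (ℤ.neg-distrib-+ -1ℤ (ℤ.- z)) ⟩
    ℤ.pred (ℤ.suc (ℤ.- (ℤ.- z)))       ≡⟨ ℤ.pred-suc (ℤ.- (ℤ.- z)) ⟩
    ℤ.- (ℤ.- z)                        ≡⟨ ℤ.neg-involutive z ⟩
    z                                  ∎

  mirror-+ : ∀ r → mirror (ℤ.+ r) ≡ ℤ.-[1+ r ]
  mirror-+ zero    = refl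
  mirror-+ (suc r) = refl

  entryCoefficient-mirror : ∀ r z → entryCoefficient r (mirror z) ≡ entryCoefficient r z
  entryCoefficient-mirror r z = trans
    (cong₂ _+_
      (cong (if_then 1ℚ else 0ℚ) (does-⇔ (mirror z ℤ.≟ ℤ.+ r) (z ℤ.≟ ℤ.-[1+ r ])
        (λ eq → trans (sym (mirror-involutive z)) (trans (cong mirror eq) (mirror-+ r)))
        (λ { refl → trans (cong mirror (sym (mirror-+ r))) (mirror-involutive (ℤ.+ r)) })))
      (cong (if_then 1ℚ else 0ℚ) (does-⇔ (mirror z ℤ.≟ ℤ.-[1+ r ]) (z ℤ.≟ ℤ.+ r)
        (λ eq → trans (sym (mirror-involutive z))
            (trans (cong mirror (trans eq (sym (mirror-+ r)))) (mirror-involutive (ℤ.+ r))))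
        (λ { refl → mirror-+ r }))))
    (ℚ.+-comm ⟦ z ≟ ℤ.-[1+ r ] ⟧ ⟦ z ≟ ℤ.+ r ⟧)

  coefficientDet-mirrored : ∀ r → Mirrored (coefficientDet {n} r)
  coefficientDet-mirrored r []       = refl
  coefficientDet-mirrored {suc zero}    r (y ∷ []) = cong (_* 1ℚ) (entryCoefficient-mirror r y)
  coefficientDet-mirrored {suc (suc n)} r (y ∷ ys) = cong₂ (λ p q → p * coefficientDet (suc r) ys + - q)
    (entryCoefficient-mirror r y)
    (expand-cong (λ z zs → cong (entryCoefficient r z *_) (coefficientDet-mirrored (suc r)
        (y ∷ zs))) ys)

  signed : ℕ → ℚ → ℚ
  signed zero    q = q
  signed (suc n) q = - signed n q

  sum-neg : ∀ {n} (f : Fin n → ℚ) → Σℚ.sum (λ j → - f j) ≡ - Σℚ.sum f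
  sum-neg {zero}  f = refl
  sum-neg {suc n} f = trans (cong (- f zero +_) (sum-neg (f ∘ suc))) (sym (ℚ.neg-distrib-+ (f zero) _))

  expand-tabulate : ∀ (f : ℤ → Lattice n) (t : Fin (suc n) → ℤ) →
    expand f (tabulate t) ≡ Σℚ.sum λ j → signed (toℕ j) (f (t j) (tabulate (Vector.removeAt t j)))
  expand-tabulate {zero}  f t = sym (ℚ.+-identityʳ _)
  expand-tabulate {suc n} f t = cong (f (t zero) (tabulate (t ∘ suc)) +_) (trans
    (cong -_ (expand-tabulate (λ z zs → f z (t zero ∷ zs)) (t ∘ suc)))
        (sym (sum-neg (λ j → signed (toℕ j)
        (f (t (suc j)) (t zero ∷ tabulate (Vector.removeAt (t ∘ suc) j)))))))

  coefficientDet-staircase : ∀ n s (t : Fin n → ℤ) → (∀ j → t j ≡ ℤ.+ (s ℕ.+ toℕ j)) →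
    Above s (tabulate t) × coefficientDet s (tabulate t) ≡ 1ℚ
  coefficientDet-staircase zero    s t eq = tt , refl
  coefficientDet-staircase (suc n) s t eq =
    let ab , one = coefficientDet-staircase n (suc s) (t ∘ suc)
            (λ j → trans (eq (suc j)) (cong ℤ.+_ (ℕ.+-suc s (toℕ j))))
        t₀ = trans (eq zero) (cong ℤ.+_ (ℕ.+-identityʳ s))
    in (ℤ.≤-reflexive (sym t₀) , ab) , (begin
      coefficientDet s (tabulate t)
        ≡⟨ coefficientDet-above (t zero) _ ab ⟩
      entryCoefficient s (t zero) * coefficientDet (suc s) (tabulate (t ∘ suc))
        ≡⟨ cong₂ _*_ (trans (cong (entryCoefficient s) t₀) (cong₂ _+_ (≟-true {ℤ.+ s} refl) refl)) one ⟩
      1ℚ ∎)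

  -- From Laurent polynomial determinants to determinants of coefficients

  module DetCoefficient (ℓ : ℕ) where
    open LaurentRing ℓ
    open CommutativeRing laurentRing using
        (ring; rawRing; *-assoc; *-cong; *-congʳ; *-congˡ; *-identityˡ; distribʳ)
      renaming (_≈_ to _≋_; _+_ to _⊞_; _*_ to _⊛_; -_ to ⊝_; 1# to 𝟙; sym to ≋-sym; trans to ≋-trans)
    open RawMonoidDefs (RawRing.+-rawMonoid (laurentRawRing ℓ)) using () renaming (sum to Σᴸ)
    open RawSemiringDefs (RawRing.rawSemiring (laurentRawRing ℓ)) using (_^_)
    open Determinant (laurentRawRing ℓ) using (det)
    open RightHandSides ℓ using (x; x̄; entry)
    module Ringᴸ = Algebra.Properties.Ring ring

    coefficient-Σ : ∀ e {n} (f : Fin n → Laurent ℓ) → coefficient e (Σᴸ f) ≡ Σℚ.sum (coefficient e ∘ f)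
    coefficient-Σ e {zero}  f = refl
    coefficient-Σ e {suc n} f = trans (coefficient-++ e (f zero) _)
        (cong (coefficient e (f zero) +_) (coefficient-Σ e (f ∘ suc)))

    coefficient-signed : ∀ e n (f : Laurent ℓ) → coefficient e ((⊝ 𝟙) ^ n ⊛ f)
        ≡ signed n (coefficient e f)
    coefficient-signed e zero    f = *-identityˡ f e
    coefficient-signed e (suc n) f = begin
      coefficient e ((⊝ 𝟙 ⊛ (⊝ 𝟙) ^ n) ⊛ f) ≡⟨ *-assoc (⊝ 𝟙) ((⊝ 𝟙) ^ n) f e ⟩
      coefficient e (⊝ 𝟙 ⊛ ((⊝ 𝟙) ^ n ⊛ f)) ≡⟨ Ringᴸ.-1*x≈-x ((⊝ 𝟙) ^ n ⊛ f) e ⟩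
      coefficient e (⊝ ((⊝ 𝟙) ^ n ⊛ f))     ≡⟨ coefficient-⊝ e ((⊝ 𝟙) ^ n ⊛ f) ⟩
      - coefficient e ((⊝ 𝟙) ^ n ⊛ f)       ≡⟨ cong -_ (coefficient-signed e n f) ⟩
      - signed n (coefficient e f)          ∎

    private
      exponent : Fin ℓ → ℤ → Vec ℤ ℓ
      exponent a k = tabulate λ i → if does (i Fin.≟ a) then k else 0ℤ

    ⊖-exponent : ∀ e a k → e ⊖ exponent a k ≡ updateAt e a (ℤ._- k)
    ⊖-exponent e a k = begin
      e ⊖ exponent a k                                ≡⟨ Vec.tabulate∘lookup _ ⟨
      tabulate (lookup (e ⊖ exponent a k))            ≡⟨ Vec.tabulate-cong pointwise ⟩
      tabulate (lookup (updateAt e a (ℤ._- k)))       ≡⟨ Vec.tabulate∘lookup _ ⟩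
      updateAt e a (ℤ._- k)                           ∎
      where
      pointwise : ∀ i → lookup (e ⊖ exponent a k) i ≡ lookup (updateAt e a (ℤ._- k)) i
      pointwise i = trans (Vec.lookup-zipWith ℤ._-_ i e (exponent a k))
        (trans (cong (λ z → lookup e i ℤ.- z) (Vec.lookup∘tabulate _ i)) (cases (i Fin.≟ a)))
        where
        cases : (d : Dec (i ≡ a)) → lookup e i ℤ.- (if does d then k else 0ℤ)
            ≡ lookup (updateAt e a (ℤ._- k)) i
        cases (yes refl) = sym (Vec.lookup∘updateAt i e)
        cases (no i≢a)   = trans (ℤ.+-identityʳ (lookup e i)) (sym (Vec.lookup∘updateAt′ i a i≢a e))

    coefficient-variablePower : ∀ e a k (f : Laurent ℓ) →
      coefficient e (variablePower a k ⊛ f) ≡ coefficient (updateAt e a (ℤ._- k)) f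
    coefficient-variablePower e a k f = begin
      coefficient e (variablePower a k ⊛ f)              ≡⟨ coefficient-∷⊛ e (1ℚ , exponent a k) [] f ⟩
      1ℚ * coefficient (e ⊖ exponent a k) f + 0ℚ         ≡⟨ solve 1
          (λ q → con 1ℚ :* q :+ con 0ℚ := q) refl (coefficient (e ⊖ exponent a k) f) ⟩
      coefficient (e ⊖ exponent a k) f                   ≡⟨ cong
          (λ e → coefficient e f) (⊖-exponent e a k) ⟩
      coefficient (updateAt e a (ℤ._- k)) f              ∎
      where open +-*-Solver using (con)

    coefficient-variablePower-^ : ∀ e a k p (f : Laurent ℓ) →
      coefficient e (variablePower a k ^ p ⊛ f) ≡ coefficient (updateAt e a (ℤ._- ℤ.+ p ℤ.* k)) f
    coefficient-variablePower-^ e a k zero f = trans (*-identityˡ f e)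
      (cong (λ e → coefficient e f) (sym (Vec.updateAt-id-local a e (ℤ.+-identityʳ (lookup e a)))))
    coefficient-variablePower-^ e a k (suc p) f = begin
      coefficient e ((variablePower a k ⊛ variablePower a k ^ p) ⊛ f)
        ≡⟨ *-assoc (variablePower a k) (variablePower a k ^ p) f e ⟩
      coefficient e (variablePower a k ⊛ (variablePower a k ^ p ⊛ f))
        ≡⟨ coefficient-variablePower e a k (variablePower a k ^ p ⊛ f) ⟩
      coefficient (updateAt e a (ℤ._- k)) (variablePower a k ^ p ⊛ f)
        ≡⟨ coefficient-variablePower-^ _ a k p f ⟩
      coefficient (updateAt (updateAt e a (ℤ._- k)) a (ℤ._- ℤ.+ p ℤ.* k)) f
        ≡⟨ cong (λ e → coefficient e f) (Vec.updateAt-updateAt-local a e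
            (i-k-p*k≡i-[1+p]*k (lookup e a) k p)) ⟩
      coefficient (updateAt e a (ℤ._- ℤ.+ suc p ℤ.* k)) f ∎

    -- Absence of x_a, asked of the listed terms and not of the coefficients, so that products and
    -- determinants inherit it term by term.
    FreeOf : Fin ℓ → Laurent ℓ → Set
    FreeOf a = All (λ t → lookup (proj₂ t) a ≡ 0ℤ)

    freeOf-coefficient : ∀ {a e} (f : Laurent ℓ) → FreeOf a f → lookup e a ≢ 0ℤ → coefficient e f ≡ 0ℚ
    freeOf-coefficient         []            []        ≢0 = refl
    freeOf-coefficient {a} {e} ((q , b) ∷ f) (eq ∷ fr) ≢0 = cong₂ _+_
      (cong (if_then q else 0ℚ) (dec-false (Vec.≡-dec ℤ._≟_ b e) λ { refl → ≢0 eq }))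
          (freeOf-coefficient f fr ≢0)

    freeOf-⊛ : ∀ {a} (f g : Laurent ℓ) → FreeOf a f → FreeOf a g → FreeOf a (f ⊛ g)
    freeOf-⊛     []      g []        fr = []
    freeOf-⊛ {a} (s ∷ f) g (eq ∷ fr) fr′ = All.++⁺
      (All.map⁺ (All.map (λ {t} eq′ → trans (Vec.lookup-zipWith ℤ._+_ a (proj₂ s) (proj₂ t))
          (cong₂ ℤ._+_ eq eq′)) fr′))
      (freeOf-⊛ f g fr fr′)

    freeOf-𝟙 : ∀ {a} → FreeOf a 𝟙
    freeOf-𝟙 {a} = Vec.lookup-replicate a 0ℤ ∷ []

    freeOf-^ : ∀ {a} (f : Laurent ℓ) n → FreeOf a f → FreeOf a (f ^ n)
    freeOf-^ f zero    fr = freeOf-𝟙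
    freeOf-^ f (suc n) fr = freeOf-⊛ f (f ^ n) fr (freeOf-^ f n fr)

    freeOf-Σ : ∀ {a n} (f : Fin n → Laurent ℓ) → (∀ j → FreeOf a (f j)) → FreeOf a (Σᴸ f)
    freeOf-Σ {n = zero}  f fr = []
    freeOf-Σ {n = suc n} f fr = All.++⁺ (fr zero) (freeOf-Σ (f ∘ suc) (fr ∘ suc))

    freeOf-det : ∀ {a n} (M : Fin n → Fin n → Laurent ℓ) → (∀ i j → FreeOf a (M i j)) → FreeOf a (det M)
    freeOf-det {n = zero}  M fr = freeOf-𝟙
    freeOf-det {a} {suc n} M fr = freeOf-Σ _ λ j →
      freeOf-⊛ ((⊝ 𝟙) ^ toℕ j) _ (freeOf-^ (⊝ 𝟙) (toℕ j) (Vec.lookup-replicate a 0ℤ ∷ []))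
        (freeOf-⊛ (M zero j) _ (fr zero j) (freeOf-det _ λ i k → fr (suc i) (punchIn j k)))

    freeOf-variablePower : ∀ {a} b k → a ≢ b → FreeOf a (variablePower b k)
    freeOf-variablePower {a} b k a≢b = trans (Vec.lookup∘tabulate _ a)
      (cong (if_then k else 0ℤ) (dec-false (a Fin.≟ b) a≢b)) ∷ []

    entryAt : ℕ → Fin ℓ → Laurent ℓ
    entryAt r a = x a ^ r ⊞ x̄ a ^ suc r

    module _ (D : Laurent ℓ) (a : Fin ℓ) (fr : FreeOf a D) (v : ℚ) (e : Vec ℤ ℓ)
             -- The exponent of x_a reaches 0 by subtracting multiples of 1 or of -1, so `φ` is kept
             -- general.
             (coefficient-D : ∀ φ → φ (lookup e a) ≡ 0ℤ → coefficient (updateAt e a φ) D ≡ v) where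

      coefficient-power : ∀ k p z → ℤ.+ p ℤ.* k ≡ z → coefficient e (variablePower a k ^ p ⊛ D)
          ≡ ⟦ lookup e a ≟ z ⟧ * v
      coefficient-power k p z eq with lookup e a ℤ.≟ z
      ... | yes refl = trans (coefficient-variablePower-^ e a k p D)
        (trans (coefficient-D _ (trans (cong (λ u → lookup e a ℤ.- u) eq)
            (ℤ.+-inverseʳ (lookup e a)))) (sym (ℚ.*-identityˡ v)))
      ... | no neq = trans (coefficient-variablePower-^ e a k p D)
        (trans (freeOf-coefficient D fr λ eq′ → neq (trans (ℤ.i-j≡0⇒i≡j (lookup e a) (ℤ.+ p ℤ.* k)
          (trans (sym (Vec.lookup∘updateAt a e)) eq′)) eq)) (sym (ℚ.*-zeroˡ v)))

      coefficient-entry : ∀ r → coefficient e (entryAt r a ⊛ D) ≡ entryCoefficient r (lookup e a) * v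
      coefficient-entry r = begin
        coefficient e (entryAt r a ⊛ D)
          ≡⟨ distribʳ D (x a ^ r) (x̄ a ^ suc r) e ⟩
        coefficient e (x a ^ r ⊛ D ⊞ x̄ a ^ suc r ⊛ D)
          ≡⟨ coefficient-++ e (x a ^ r ⊛ D) (x̄ a ^ suc r ⊛ D) ⟩
        coefficient e (x a ^ r ⊛ D) + coefficient e (x̄ a ^ suc r ⊛ D)
          ≡⟨ cong₂ _+_ (coefficient-power 1ℤ r (ℤ.+ r) (ℤ.*-identityʳ (ℤ.+ r)))
               (coefficient-power -1ℤ (suc r) ℤ.-[1+ r ]
                   (trans (ℤ.*-comm (ℤ.+ suc r) -1ℤ) (ℤ.-1*i≡-i (ℤ.+ suc r)))) ⟩
        ⟦ lookup e a ≟ ℤ.+ r ⟧ * v + ⟦ lookup e a ≟ ℤ.-[1+ r ] ⟧ * v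
          ≡⟨ ℚ.*-distribʳ-+ v ⟦ lookup e a ≟ ℤ.+ r ⟧ ⟦ lookup e a ≟ ℤ.-[1+ r ] ⟧ ⟨
        entryCoefficient r (lookup e a) * v ∎

    -- Minors lose columns while the ring keeps all variables; so the induction is about the columns
    -- selected by an injection `φ`, with `e` zero at the other variables. An entry of the first row
    -- meets a minor free of its variable, and the coefficient factors.
    coefficient-det : ∀ {n} r (φ : Fin n → Fin ℓ) → (∀ {i j} → φ i ≡ φ j → i ≡ j) →
      (M : Fin n → Fin n → Laurent ℓ) → (∀ i j → M i j ≡ entryAt (r ℕ.+ toℕ i) (φ j)) →
      ∀ e → (∀ i → (∀ j → φ j ≢ i) → lookup e i ≡ 0ℤ) →
      coefficient e (det M) ≡ coefficientDet r (tabulate (lookup e ∘ φ))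
    coefficient-det {zero} r φ inj M M≡ e zeros = trans
      (cong (λ b → (if b then 1ℚ else 0ℚ) + 0ℚ) (dec-true (Vec.≡-dec ℤ._≟_ (replicate ℓ 0ℤ) e) (begin
        replicate ℓ 0ℤ                      ≡⟨ Vec.tabulate∘lookup _ ⟨
        tabulate (lookup (replicate ℓ 0ℤ))  ≡⟨ Vec.tabulate-cong
            (λ i → trans (Vec.lookup-replicate i 0ℤ) (sym (zeros i λ ()))) ⟩
        tabulate (lookup e)                 ≡⟨ Vec.tabulate∘lookup e ⟩
        e                                   ∎))) refl
    coefficient-det {suc n} r φ inj M M≡ e zeros = begin
      coefficient e (det M)
        ≡⟨ coefficient-Σ e (λ j → (⊝ 𝟙) ^ toℕ j ⊛ (M zero j ⊛ minor j)) ⟩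
      Σℚ.sum (λ j → coefficient e ((⊝ 𝟙) ^ toℕ j ⊛ (M zero j ⊛ minor j)))
        ≡⟨ Σℚ.sum-cong-≗ (λ j → trans (coefficient-signed e (toℕ j) (M zero j ⊛ minor j))
            (cong (signed (toℕ j)) (term j))) ⟩
      Σℚ.sum (λ j → signed (toℕ j) (entryCoefficient r (t j)
          * coefficientDet (suc r) (tabulate (Vector.removeAt t j))))
        ≡⟨ expand-tabulate (λ z zs → entryCoefficient r z * coefficientDet (suc r) zs) t ⟨
      coefficientDet r (tabulate t) ∎
      where
      t : Fin (suc n) → ℤ
      t = lookup e ∘ φ
      minor : Fin (suc n) → Laurent ℓ
      minor j = det (λ i → Vector.removeAt (M (suc i)) j)
      M≡′ : ∀ j i k → M (suc i) (punchIn j k) ≡ entryAt (suc r ℕ.+ toℕ i) (φ (punchIn j k))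
      M≡′ j i k = trans (M≡ (suc i) (punchIn j k)) (cong (λ r → entryAt r (φ (punchIn j k)))
          (ℕ.+-suc r (toℕ i)))
      φ≢ : ∀ j k → φ (punchIn j k) ≢ φ j
      φ≢ j k eq = Fin.punchInᵢ≢i j k (inj eq)
      freeOf-minor : ∀ j → FreeOf (φ j) (minor j)
      freeOf-minor j = freeOf-det _ λ i k → subst (FreeOf (φ j)) (sym (M≡′ j i k))
        (All.++⁺ (freeOf-^ _ (suc r ℕ.+ toℕ i) (freeOf-variablePower _ 1ℤ (φ≢ j k ∘ sym)))
                 (freeOf-^ _ (suc (suc r ℕ.+ toℕ i)) (freeOf-variablePower _ -1ℤ (φ≢ j k ∘ sym))))
      minor-coefficient : ∀ j ψ → ψ (t j) ≡ 0ℤ →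
        coefficient (updateAt e (φ j) ψ) (minor j) ≡ coefficientDet (suc r)
            (tabulate (Vector.removeAt t j))
      minor-coefficient j ψ ψ0 = trans
        (coefficient-det (suc r) (φ ∘ punchIn j) (Fin.punchIn-injective j _ _ ∘ inj) _ (M≡′ j)
            (updateAt e (φ j) ψ) zeros′)
        (cong (coefficientDet (suc r)) (Vec.tabulate-cong λ k →
            Vec.lookup∘updateAt′ (φ (punchIn j k)) (φ j) (φ≢ j k) e))
        where
        zeros′ : ∀ i → (∀ k → φ (punchIn j k) ≢ i) → lookup (updateAt e (φ j) ψ) i ≡ 0ℤ
        zeros′ i away with i Fin.≟ φ j
        ... | yes refl = trans (Vec.lookup∘updateAt (φ j) e) ψ0
        ... | no i≢φj = trans (Vec.lookup∘updateAt′ i (φ j) i≢φj e) (zeros i outside)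
          where
          outside : ∀ k → φ k ≢ i
          outside k eq with j Fin.≟ k
          ... | yes refl = i≢φj (sym eq)
          ... | no j≢k = away (punchOut j≢k) (trans (cong φ (Fin.punchIn-punchOut j≢k)) eq)
      term : ∀ j → coefficient e (M zero j ⊛ minor j) ≡
        entryCoefficient r (t j) * coefficientDet (suc r) (tabulate (Vector.removeAt t j))
      term j = trans
        (cong (λ m → coefficient e (m ⊛ minor j))
            (trans (M≡ zero j) (cong (λ r → entryAt r (φ j)) (ℕ.+-identityʳ r))))
        (coefficient-entry (minor j) (φ j) (freeOf-minor j) _ e (minor-coefficient j) r)

    coefficient-det-entry : ∀ e → coefficient e (det entry) ≡ coefficientDet 0 e
    coefficient-det-entry e = trans (coefficient-det 0 id id entry (λ i j → refl) e λ i none →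
        ⊥-elim (none i refl))
      (cong (coefficientDet 0) (Vec.tabulate∘lookup e))

open Determinants

-- Power series

module SeriesAlgebra where
  open import Data.Nat.Combinatorics using (_C_)

  module Series {c r} (R : CommutativeRing c r) where
    open CommutativeRing R hiding (zero)
    open Algebra.Properties.Ring ring using (-0#≈0#; -‿distribʳ-*; -‿involutive)
    open Algebra.Properties.Semiring.Exp semiring using (_^_; ^-congˡ)
    open Algebra.Properties.Semiring.Mult semiring using (×-comm-*; ×-congʳ; ×-assoc-*) renaming
        (_×_ to _·_)
    open Algebra.Properties.Semiring.Sum semiring
      using (sum; sum-cong-≋; sum-replicate-zero; *-distribˡ-sum; *-distribʳ-sum; sum-remove)
    open Algebra.Properties.CommutativeSemiring.Binomial commutativeSemiring using () renaming
        (theorem to binomial-theorem)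
    open Algebra.Solver.Ring.NaturalCoefficients.Default commutativeSemiring using
        (solve; _:=_; _:+_; _:*_)
    open PowerSeries rawRing
    open Relation.Binary.Reasoning.Setoid setoid
    module S = RawRing rawRing⟦t⟧
    module Det = Determinant rawRing
    module DetS = Determinant rawRing⟦t⟧
    open RawMonoidDefs S.+-rawMonoid using () renaming (sum to sumS)
    open RawSemiringDefs S.rawSemiring using () renaming (_^_ to _^S_)

    sum-zero : ∀ {n} (f : Fin n → Carrier) → (∀ j → f j ≈ 0#) → sum f ≈ 0#
    sum-zero {n} f eq = trans (sum-cong-≋ eq) (sum-replicate-zero n)

    1-ts : Carrier → Series
    1-ts s = S.1# S.+ S.- (t S.* constant s)

    1-ts-1 : ∀ s → 1-ts s 1 ≈ - s
    1-ts-1 s = begin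
      0# + - (0# * 0# + (1# * s + 0#)) ≈⟨ +-identityˡ _ ⟩
      - (0# * 0# + (1# * s + 0#))
        ≈⟨ -‿cong (trans (+-cong (zeroˡ 0#) (trans (+-identityʳ _) (*-identityˡ s))) (+-identityˡ s)) ⟩
      - s ∎

    1-ts-suc : ∀ s n → 1-ts s (suc (suc n)) ≈ 0#
    1-ts-suc s n = trans (+-identityˡ _) (trans (-‿cong (sum-zero term zeros)) -0#≈0#)
      where
      term : Fin (suc (suc (suc n))) → Carrier
      term k = t (toℕ k) * constant s (suc (suc n) ∸ toℕ k)
      zeros : ∀ k → term k ≈ 0#
      zeros zero          = zeroˡ _
      zeros (suc zero)    = zeroʳ _
      zeros (suc (suc k)) = zeroˡ _

    -- One step of dividing the constant d by 1 - ts leaves the constant sd as numerator.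
    geometric : ∀ s d n (f : Series) → (∀ k → f k ≈ constant d k) → (f / 1-ts s) n ≈ s ^ n * d
    geometric s d zero    f eq = trans (eq 0) (sym (*-identityˡ d))
    geometric s d (suc n) f eq = trans (geometric s (s * d) n _ eq′) (begin
      s ^ n * (s * d)  ≈⟨ solve 3 (λ p s d → p :* (s :* d) := (s :* p) :* d) refl (s ^ n) s d ⟩
      s ^ suc n * d    ∎)
      where
      eq′ : ∀ k → f (suc k) + - (f 0 * 1-ts s (suc k)) ≈ constant (s * d) k
      eq′ zero = begin
        f 1 + - (f 0 * 1-ts s 1)   ≈⟨ +-cong (eq 1) (-‿cong (*-cong (eq 0) (1-ts-1 s))) ⟩
        0# + - (d * - s)           ≈⟨ +-identityˡ _ ⟩
        - (d * - s)                ≈⟨ -‿cong (-‿distribʳ-* d s) ⟨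
        - - (d * s)                ≈⟨ -‿involutive (d * s) ⟩
        d * s                      ≈⟨ *-comm d s ⟩
        s * d                      ∎
      eq′ (suc k) = begin
        f (suc (suc k)) + - (f 0 * 1-ts s (suc (suc k)))
            ≈⟨ +-cong (eq _) (-‿cong (*-congˡ (1-ts-suc s k))) ⟩
        0# + - (f 0 * 0#)                                ≈⟨ +-identityˡ _ ⟩
        - (f 0 * 0#)                                     ≈⟨ -‿cong (zeroʳ (f 0)) ⟩
        - 0#                                             ≈⟨ -0#≈0# ⟩
        0#                                               ∎

    S*-cong : ∀ {f f′ g g′ : Series} → f S.≈ f′ → g S.≈ g′ → f S.* g S.≈ f′ S.* g′
    S*-cong p q n = sum-cong-≋ {suc n} λ k → *-cong (p (toℕ k)) (q (n ∸ toℕ k))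

    -- u n plays the role of 1 / n!.
    module Exponential (u : ℕ → Carrier) (u₀ : u 0 ≈ 1#)
      (u-* : ∀ {n k} → k ℕ.≤ n → u k * u (n ∸ k) ≈ (n C k) · u n) where

      -- The series d e^(t b).
      exp : Carrier → Carrier → Series
      exp d b n = u n * (d * b ^ n)

      exp-cong : ∀ {d d′ b b′} → d ≈ d′ → b ≈ b′ → exp d b S.≈ exp d′ b′
      exp-cong p q n = *-congˡ (*-cong p (^-congˡ n q))

      constant-exp : ∀ a b → constant a S.* (λ n → u n * b ^ n) S.≈ exp a b
      constant-exp a b n = begin
        a * (u n * b ^ n) + sum {n} (λ k → 0# * _)  ≈⟨ +-congˡ (sum-zero {n} _ (λ k → zeroˡ _)) ⟩
        a * (u n * b ^ n) + 0#                      ≈⟨ +-identityʳ _ ⟩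
        a * (u n * b ^ n)                           ≈⟨ solve 3
            (λ a u p → a :* (u :* p) := u :* (a :* p)) refl a (u n) (b ^ n) ⟩
        exp a b n                                   ∎

      -- The binomial theorem, with `u-*` as the identity 1/k! · 1/(n-k)! = C(n,k)/n!.
      exp-* : ∀ a b d e → exp a b S.* exp d e S.≈ exp (a * d) (b + e)
      exp-* a b d e n = begin
        sum {suc n} (λ k → (u (toℕ k) * (a * b ^ toℕ k)) * (u (n ∸ toℕ k) * (d * e ^ (n ∸ toℕ k))))
          ≈⟨ sum-cong-≋ {suc n} (λ k → term k) ⟩
        sum {suc n} (λ k → (u n * (a * d)) * ((n C toℕ k) · (b ^ toℕ k * e ^ (n ∸ toℕ k))))
          ≈⟨ *-distribˡ-sum {suc n} (u n * (a * d))
              (λ k → (n C toℕ k) · (b ^ toℕ k * e ^ (n ∸ toℕ k))) ⟨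
        (u n * (a * d)) * sum {suc n} (λ k → (n C toℕ k) · (b ^ toℕ k * e ^ (n ∸ toℕ k)))
          ≈⟨ *-congˡ (binomial-theorem n b e) ⟨
        (u n * (a * d)) * (b + e) ^ n
          ≈⟨ *-assoc (u n) (a * d) _ ⟩
        exp (a * d) (b + e) n ∎
        where
        term : ∀ (k : Fin (suc n)) →
          (u (toℕ k) * (a * b ^ toℕ k)) * (u (n ∸ toℕ k) * (d * e ^ (n ∸ toℕ k))) ≈
          (u n * (a * d)) * ((n C toℕ k) · (b ^ toℕ k * e ^ (n ∸ toℕ k)))
        term k = begin
          (u i * (a * p)) * (u (n ∸ i) * (d * q))
            ≈⟨ solve 6 (λ x y a d p q → (x :* (a :* p)) :* (y :* (d :* q)) := (x :* y) :*
                ((a :* d) :* (p :* q)))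
                 refl (u i) (u (n ∸ i)) a d p q ⟩
          (u i * u (n ∸ i)) * ((a * d) * (p * q))    ≈⟨ *-congʳ (u-* (Fin.toℕ≤pred[n] k)) ⟩
          ((n C i) · u n) * ((a * d) * (p * q))      ≈⟨ ×-assoc-* (n C i) (u n) _ ⟩
          (n C i) · (u n * ((a * d) * (p * q)))
              ≈⟨ ×-congʳ (n C i) (*-assoc (u n) (a * d) (p * q)) ⟨
          (n C i) · ((u n * (a * d)) * (p * q))      ≈⟨ ×-comm-* (n C i) (u n * (a * d)) (p * q) ⟨
          (u n * (a * d)) * ((n C i) · (p * q))      ∎
          where
          i = toℕ k
          p = b ^ i
          q = e ^ (n ∸ i)

      exp-zero : ∀ d n → exp d 0# (suc n) ≈ 0#
      exp-zero d n = trans (*-congˡ (trans (*-congˡ (zeroˡ _)) (zeroʳ d))) (zeroʳ _)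

      exp-0 : ∀ d b → exp d b 0 ≈ d
      exp-0 d b = trans (*-cong u₀ (*-identityʳ d)) (*-identityˡ d)

      1-exp : S.1# S.≈ exp 1# 0#
      1-exp zero    = sym (exp-0 1# 0#)
      1-exp (suc n) = sym (exp-zero 1# n)

      -1-exp : S.- S.1# S.≈ exp (- 1#) 0#
      -1-exp zero    = sym (exp-0 (- 1#) 0#)
      -1-exp (suc n) = trans -0#≈0# (sym (exp-zero (- 1#) n))

      -1^-exp : ∀ j → (S.- S.1#) ^S j S.≈ exp ((- 1#) ^ j) 0#
      -1^-exp zero    = 1-exp
      -1^-exp (suc j) n = trans (S*-cong {S.- S.1#} {exp (- 1#) 0#} -1-exp (-1^-exp j) n)
        (trans (exp-* (- 1#) 0# ((- 1#) ^ j) 0# n) (exp-cong {(- 1#) ^ suc j} refl (+-identityˡ 0#) n))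

      sum-exp : ∀ {k} (f : Fin k → Series) d b → (∀ j → f j S.≈ exp (d j) b) → sumS f S.≈ exp (sum d) b
      sum-exp {zero}  f d b eq zero    = sym (trans (*-congˡ (zeroˡ _)) (zeroʳ _))
      sum-exp {zero}  f d b eq (suc n) = sym (trans (*-congˡ (zeroˡ _)) (zeroʳ _))
      sum-exp {suc k} f d b eq n = begin
        f zero n + sumS (f ∘ suc) n
          ≈⟨ +-cong (eq zero n) (sum-exp (f ∘ suc) (d ∘ suc) b (eq ∘ suc) n) ⟩
        u n * (d zero * b ^ n) + u n * (sum (d ∘ suc) * b ^ n)
          ≈⟨ solve 4 (λ u d e p → u :* (d :* p) :+ u :* (e :* p) := u :* ((d :+ e) :* p)) refl (u n)
              (d zero) (sum (d ∘ suc)) (b ^ n) ⟩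
        exp (sum d) b n ∎

      -- Each term of the expansion has one factor from every column, so only series with the same
      -- exponent are ever added; signs count as exponentials with exponent 0.
      det-exp : ∀ {k} (M : Fin k → Fin k → Carrier) (N : Fin k → Fin k → Series) (a : Fin k → Carrier) →
        (∀ i j → N i j S.≈ exp (M i j) (a j)) → DetS.det N S.≈ exp (Det.det M) (sum a)
      det-exp {zero}  M N a eq = 1-exp
      det-exp {suc k} M N a eq = sum-exp _ (λ j → (- 1#) ^ toℕ j * (M zero j * minor j))
          (sum a) λ j n → begin
        ((S.- S.1#) ^S toℕ j S.* (N zero j S.* minorS j)) n
          ≈⟨ S*-cong {(S.- S.1#) ^S toℕ j} (-1^-exp (toℕ j)) (λ n →
               trans (S*-cong {N zero j} (eq zero j)
                       (det-exp _ _ (Vector.removeAt a j) λ i l → eq (suc i) _) n)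
                     (exp-* (M zero j) (a j) (minor j) (sum (Vector.removeAt a j)) n)) n ⟩
        (exp ((- 1#) ^ toℕ j) 0# S.* exp (M zero j * minor j) (a j + sum (Vector.removeAt a j))) n
          ≈⟨ exp-* ((- 1#) ^ toℕ j) 0# (M zero j * minor j) (a j + sum (Vector.removeAt a j)) n ⟩
        exp ((- 1#) ^ toℕ j * (M zero j * minor j)) (0# + (a j + sum (Vector.removeAt a j))) n
          ≈⟨ exp-cong refl (trans (+-identityˡ _) (sym (sum-remove {i = j} a))) n ⟩
        exp ((- 1#) ^ toℕ j * (M zero j * minor j)) (sum a) n ∎
        where
        minor : Fin (suc k) → Carrier
        minor j = Det.det λ i → Vector.removeAt (M (suc i)) j
        minorS : Fin (suc k) → Series
        minorS j = DetS.det λ i → Vector.removeAt (N (suc i)) j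

open SeriesAlgebra

-- Coefficients of the two right-hand sides

module CoefficientExtraction where
  open ≡ using (refl; sym; trans; cong; cong₂; module ≡-Reasoning)
  open ≡-Reasoning
  open import Data.Nat.Combinatorics using (_C_)

  sum-updateAt : ∀ {φ ψ : ℤ → ℤ} → φ ≗ ψ → ∀ {n} (c : Lattice n) y →
    Σℚ.sum (λ j → c (updateAt y j φ)) ≡ shiftsFrom ψ 0 c y
  sum-updateAt eq c []       = refl
  sum-updateAt eq c (y ∷ ys) = cong₂ ℚ._+_ (cong (λ z → c (z ∷ ys)) (eq y))
      (sum-updateAt eq (c ∘ (y ∷_)) ys)

  1/! : ℕ → ℚ
  1/! n = (1/ (n !)) {{n ℕ.!≢0}}

  1/!-* : ∀ {n k} → k ℕ.≤ n → 1/! k ℚ.* 1/! (n ∸ k) ≡ fromℕ (n C k) ℚ.* 1/! n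
  1/!-* {n} {k} k≤n = begin
    p ℚ.* q
      ≡⟨ ℚ.*-identityʳ (p ℚ.* q) ⟨
    (p ℚ.* q) ℚ.* 1ℚ
      ≡⟨ cong ((p ℚ.* q) ℚ.*_) (trans (sym (1/-inverseˡ (n !) {{n ℕ.!≢0}}))
          (ℚ.*-comm (1/! n) (fromℕ (n !)))) ⟩
    (p ℚ.* q) ℚ.* (fromℕ (n !) ℚ.* 1/! n)
      ≡⟨ cong (λ m → (p ℚ.* q) ℚ.* (m ℚ.* 1/! n)) n!-split ⟩
    (p ℚ.* q) ℚ.* ((fromℕ (n C k) ℚ.* (fromℕ (k !) ℚ.* fromℕ ((n ∸ k) !))) ℚ.* 1/! n)
      ≡⟨ solve 6 (λ p q a b c u → (p :* q) :* ((a :* (b :* c)) :* u) := ((p :* b) :* (q :* c)) :*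
          (a :* u)) refl
           p q (fromℕ (n C k)) (fromℕ (k !)) (fromℕ ((n ∸ k) !)) (1/! n) ⟩
    ((p ℚ.* fromℕ (k !)) ℚ.* (q ℚ.* fromℕ ((n ∸ k) !))) ℚ.* (fromℕ (n C k) ℚ.* 1/! n)
      ≡⟨ cong₂ (λ a b → (a ℚ.* b) ℚ.* (fromℕ (n C k) ℚ.* 1/! n)) (1/-inverseˡ (k !) {{k ℕ.!≢0}})
          (1/-inverseˡ ((n ∸ k) !) {{(n ∸ k) ℕ.!≢0}}) ⟩
    (1ℚ ℚ.* 1ℚ) ℚ.* (fromℕ (n C k) ℚ.* 1/! n)
      ≡⟨ ℚ.*-identityˡ _ ⟩
    fromℕ (n C k) ℚ.* 1/! n ∎
    where
    open +-*-Solver using (solve; _:=_; _:*_)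
    p = 1/! k
    q = 1/! (n ∸ k)
    n!-split : fromℕ (n !) ≡ fromℕ (n C k) ℚ.* (fromℕ (k !) ℚ.* fromℕ ((n ∸ k) !))
    n!-split = begin
      fromℕ (n !)
        ≡⟨ cong fromℕ (ℕ.m/n*n≡m {{k ℕ.!* (n ∸ k) !≢0}} (ℕ.k![n∸k]!∣n! k≤n)) ⟨
      fromℕ ((n ! ℕ./ (k ! ℕ.* (n ∸ k) !)) {{k ℕ.!* (n ∸ k) !≢0}} ℕ.* (k ! ℕ.* (n ∸ k) !))
        ≡⟨ cong (λ m → fromℕ (m ℕ.* (k ! ℕ.* (n ∸ k) !))) (ℕ.nCk≡n!/k![n-k]! k≤n) ⟨
      fromℕ ((n C k) ℕ.* (k ! ℕ.* (n ∸ k) !))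
        ≡⟨ fromℕ-* (n C k) _ ⟩
      fromℕ (n C k) ℚ.* fromℕ (k ! ℕ.* (n ∸ k) !)
        ≡⟨ cong (fromℕ (n C k) ℚ.*_) (fromℕ-* (k !) ((n ∸ k) !)) ⟩
      fromℕ (n C k) ℚ.* (fromℕ (k !) ℚ.* fromℕ ((n ∸ k) !)) ∎

  module Extraction (ℓ : ℕ) where
    open LaurentRing ℓ
    open DetCoefficient ℓ using (coefficient-Σ; coefficient-variablePower; coefficient-det-entry)
    open CommutativeRing laurentRing using (semiring; *-assoc; *-comm; *-congˡ; *-congʳ; distribʳ)
      renaming (_≈_ to _≋_; _+_ to _⊞_; _*_ to _⊛_; 1# to 𝟙; refl to ≋-refl; sym to ≋-sym; trans to
          ≋-trans)
    module L = CommutativeRing laurentRing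
    open Algebra.Properties.Semiring.Exp semiring using (_^_; ^-congˡ)
    open Algebra.Properties.Semiring.Mult semiring using () renaming (_×_ to _·_)
    open Algebra.Properties.Semiring.Sum semiring using (sum; *-distribʳ-sum; ∑-distrib-+)
    open RightHandSides ℓ
    open Determinant (laurentRawRing ℓ) using (det)
    open Weights ℓ using (δ)
    open Completions ℓ
    open Series laurentRing using (geometric; module Exponential)

    -- On coefficients, multiplication by Σ x_j + x̄_j is `step`: a factor x_j lowers the exponent
    -- looked up and x̄_j raises it, hence the exchange of the two sums below.
    steps-coefficient : ∀ n f y → steps n (λ y → coefficient y f) y
        ≡ coefficient y ((sum x ⊞ sum x̄) ^ n ⊛ f)
    steps-coefficient zero    f y = sym (L.*-identityˡ f y)
    steps-coefficient (suc n) f y = begin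
      steps n (step (λ y → coefficient y f)) y         ≡⟨ steps-cong n step-coefficient y ⟩
      steps n (λ y → coefficient y (s ⊛ f)) y          ≡⟨ steps-coefficient n (s ⊛ f) y ⟩
      coefficient y (s ^ n ⊛ (s ⊛ f))                  ≡⟨ *-assoc (s ^ n) s f y ⟨
      coefficient y ((s ^ n ⊛ s) ⊛ f)
          ≡⟨ *-congʳ {f} {s ^ n ⊛ s} {s ^ suc n} (*-comm (s ^ n) s) y ⟩
      coefficient y (s ^ suc n ⊛ f)                    ∎
      where
      s = sum x ⊞ sum x̄
      shifts : ∀ {ψ} k → (∀ z → z ℤ.- k ≡ ψ z) → ∀ y →
        coefficient y (sum (λ j → variablePower j k) ⊛ f) ≡ shiftsFrom ψ 0 (λ y → coefficient y f) y
      shifts k eq y = begin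
        coefficient y (sum (λ j → variablePower j k) ⊛ f)
          ≡⟨ *-distribʳ-sum f (λ j → variablePower j k) y ⟩
        coefficient y (sum (λ j → variablePower j k ⊛ f))
          ≡⟨ coefficient-Σ y (λ j → variablePower j k ⊛ f) ⟩
        Σℚ.sum (λ j → coefficient y (variablePower j k ⊛ f))
          ≡⟨ Σℚ.sum-cong-≗ (λ j → coefficient-variablePower y j k f) ⟩
        Σℚ.sum (λ j → coefficient (updateAt y j (ℤ._- k)) f)
          ≡⟨ sum-updateAt eq (λ y → coefficient y f) y ⟩
        shiftsFrom _ 0 (λ y → coefficient y f) y ∎
      step-coefficient : step (λ y → coefficient y f) ≗ (λ y → coefficient y (s ⊛ f))
      step-coefficient y = begin
        step (λ y → coefficient y f) y
          ≡⟨ ℚ.+-comm (shiftsFrom ℤ.suc 0 (λ y → coefficient y f) y)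
              (shiftsFrom ℤ.pred 0 (λ y → coefficient y f) y) ⟩
        shiftsFrom ℤ.pred 0 (λ y → coefficient y f) y ℚ.+ shiftsFrom ℤ.suc 0 (λ y → coefficient y f) y
          ≡⟨ cong₂ ℚ._+_ (shifts 1ℤ (λ z → ℤ.+-comm z -1ℤ) y) (shifts -1ℤ (λ z → ℤ.+-comm z 1ℤ) y) ⟨
        coefficient y (sum x ⊛ f) ℚ.+ coefficient y (sum x̄ ⊛ f)
          ≡⟨ coefficient-++ y (sum x ⊛ f) (sum x̄ ⊛ f) ⟨
        coefficient y (sum x ⊛ f ⊞ sum x̄ ⊛ f)
          ≡⟨ distribʳ f (sum x) (sum x̄) y ⟨
        coefficient y (s ⊛ f) ∎

    -- Both generating functions follow from this, by a geometric and by an exponential series.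
    count-involutions : ∀ n →
      fromℕ (length (involutions (2 ℕ.* ℓ) n)) ≡ coefficient δ ((sum x ⊞ sum x̄) ^ n ⊛ det entry)
    count-involutions n = begin
      fromℕ (length (involutions (2 ℕ.* ℓ) n)) ≡⟨ cong fromℕ (Automaton.length-involutions ℓ n) ⟩
      completionsℚ (replicate n free)          ≡⟨ completions-steps n symmetric extremal one ⟩
      steps n (coefficientDet 0) δ             ≡⟨ steps-cong n (λ y → sym (coefficient-det-entry y)) δ ⟩
      steps n (λ y → coefficient y (det entry)) δ ≡⟨ steps-coefficient n (det entry) δ ⟩
      coefficient δ ((sum x ⊞ sum x̄) ^ n ⊛ det entry) ∎
      where
      symmetric : Symmetric (coefficientDet 0)
      symmetric = record { alternating = coefficientDet-alternating 0 ; mirrored =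
          coefficientDet-mirrored 0 }
      extremal : Extremal (coefficientDet 0)
      extremal k y ab = coefficientDet-extremal k y ab
      one : coefficientDet 0 δ ≡ 1ℚ
      one = proj₂ (coefficientDet-staircase ℓ 0 (λ j → ℤ.+ toℕ j) (λ j → refl))

    ogf≈ : ∀ n → ogf (2 ℕ.* ℓ) n ≡ extract ogfKernel n
    ogf≈ n = begin
      ogf (2 ℕ.* ℓ) n                                 ≡⟨ fromℕ-/1 _ ⟨
      fromℕ (length (involutions (2 ℕ.* ℓ) n))        ≡⟨ count-involutions n ⟩
      coefficient δ ((sum x ⊞ sum x̄) ^ n ⊛ det entry) ≡⟨ geometric (sum x ⊞ sum x̄) (det entry) n _
          (λ k e → refl) δ ⟨
      extract ogfKernel n                             ∎

    scalar-* : ∀ q r → scalar q ⊛ scalar r ≋ scalar {ℓ} (q ℚ.* r)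
    scalar-* q r e = cong (λ a → coefficient e (monomial (q ℚ.* r) a))
        (Vec.zipWith-identityˡ ℤ.+-identityˡ _)

    coefficient-scalar : ∀ e q f → coefficient e (scalar q ⊛ f) ≡ q ℚ.* coefficient e f
    coefficient-scalar e q f = begin
      coefficient e (scalar q ⊛ f)
          ≡⟨ coefficient-∷⊛ e (q , replicate ℓ 0ℤ) [] f ⟩
      q ℚ.* coefficient (e ⊖ replicate ℓ 0ℤ) f ℚ.+ 0ℚ                 ≡⟨ ℚ.+-identityʳ _ ⟩
      q ℚ.* coefficient (e ⊖ replicate ℓ 0ℤ) f
        ≡⟨ cong (λ e → q ℚ.* coefficient e f) (Vec.zipWith-identityʳ ℤ.+-identityʳ e) ⟩
      q ℚ.* coefficient e f                                           ∎

    coefficient-× : ∀ n e f → coefficient e (n · f) ≡ fromℕ n ℚ.* coefficient e f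
    coefficient-× zero    e f =
        sym (trans (cong (ℚ._* coefficient e f) fromℕ-0) (ℚ.*-zeroˡ (coefficient e f)))
    coefficient-× (suc n) e f = begin
      coefficient e (f ⊞ n · f)                              ≡⟨ coefficient-++ e f (n · f) ⟩
      coefficient e f ℚ.+ coefficient e (n · f)
          ≡⟨ cong₂ ℚ._+_ (sym (ℚ.*-identityˡ (coefficient e f))) (coefficient-× n e f) ⟩
      1ℚ ℚ.* coefficient e f ℚ.+ fromℕ n ℚ.* coefficient e f
          ≡⟨ ℚ.*-distribʳ-+ (coefficient e f) 1ℚ (fromℕ n) ⟨
      (1ℚ ℚ.+ fromℕ n) ℚ.* coefficient e f
        ≡⟨ cong (ℚ._* coefficient e f) (trans (cong (ℚ._+ fromℕ n) (sym fromℕ-1)) (sym (fromℕ-+ 1 n))) ⟩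
      fromℕ (suc n) ℚ.* coefficient e f                       ∎

    u : ℕ → Laurent ℓ
    u n = scalar (1/! n)

    u-* : ∀ {n k} → k ℕ.≤ n → u k ⊛ u (n ∸ k) ≋ (n C k) · u n
    u-* {n} {k} k≤n e = begin
      coefficient e (u k ⊛ u (n ∸ k))                         ≡⟨ scalar-* (1/! k) (1/! (n ∸ k)) e ⟩
      coefficient e (scalar (1/! k ℚ.* 1/! (n ∸ k)))
          ≡⟨ cong (λ q → coefficient e (scalar q)) (1/!-* k≤n) ⟩
      coefficient e (scalar (fromℕ (n C k) ℚ.* 1/! n))        ≡⟨ scalar-* (fromℕ (n C k)) (1/! n) e ⟨
      coefficient e (scalar (fromℕ (n C k)) ⊛ u n)
          ≡⟨ coefficient-scalar e (fromℕ (n C k)) (u n) ⟩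
      fromℕ (n C k) ℚ.* coefficient e (u n)                   ≡⟨ coefficient-× (n C k) e (u n) ⟨
      coefficient e ((n C k) · u n)                          ∎

    open Exponential u (λ e → refl) (λ {n} {k} → u-* {n} {k}) using (exp; det-exp; constant-exp)

    egf≈ : ∀ n → egf (2 ℕ.* ℓ) n ≡ extract egfKernel n
    egf≈ n = begin
      egf (2 ℕ.* ℓ) n
        ≡⟨ /-fromℕ _ (n !) {{n ℕ.!≢0}} ⟩
      1/! n ℚ.* fromℕ (length (involutions (2 ℕ.* ℓ) n))
        ≡⟨ cong (1/! n ℚ.*_) (count-involutions n) ⟩
      1/! n ℚ.* coefficient δ ((sum x ⊞ sum x̄) ^ n ⊛ det entry)
        ≡⟨ cong (1/! n ℚ.*_) (L.trans {(sum x ⊞ sum x̄) ^ n ⊛ det entry}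
            {det entry ⊛ (sum x ⊞ sum x̄) ^ n} {det entry ⊛ sum a ^ n}
            (*-comm ((sum x ⊞ sum x̄) ^ n) (det entry))
             (*-congˡ {det entry} {(sum x ⊞ sum x̄) ^ n} {sum a ^ n}
                 (^-congˡ n {sum x ⊞ sum x̄} {sum a} (≋-sym {sum a} {sum x ⊞ sum x̄}
                 (∑-distrib-+ x x̄)))) δ) ⟩
      1/! n ℚ.* coefficient δ (det entry ⊛ sum a ^ n)
        ≡⟨ coefficient-scalar δ (1/! n) (det entry ⊛ sum a ^ n) ⟨
      coefficient δ (exp (det entry) (sum a) n)
        ≡⟨ det-exp entry _ a (λ i j → constant-exp (entry i j) (a j)) n δ ⟨
      extract egfKernel n ∎
      where
      a : Fin ℓ → Laurent ℓ
      a j = x j ⊞ x̄ j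

open CoefficientExtraction

open import Data.Nat.Base using (_*_; _≥_)

proposition10 : (ℓ : ℕ) → ℓ ≥ 1 →
  let open RightHandSides ℓ
      open RawRing ℚ⟦t⟧ using (_≈_)
      m = 2 * ℓ
  in (ogf m ≈ extract ogfKernel) × (egf m ≈ extract egfKernel)
proposition10 ℓ _ = ogf≈ , egf≈
  where open Extraction ℓ
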